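{- Unweighted Borda Manipulation admits an algorithm with running time $O^*(2^{9|\mathcal{C}|^2\log|\mathcal{C}|})$, where $\mathcal{C}\cup\{p\}$ is the set of candidates.
   Context: Borda elections: a set of candidates $\mathcal{C}\cup\{p\}$ (with $p\notin\mathcal{C}$) and a multiset of votes, each vote being a bijection $\pi:\mathcal{C}\cup\{p\}\to\{1,\dots,|\mathcal{C}|+1\}$. A vote $\pi$ gives candidate $c$ the score $\pi(c)-1$; the total score of a candidate is the sum over all votes. $p$ wins only if it has strictly higher total score than every other candidate. Unweighted Borda Manipulation (UBM): input is an election with candidates $\mathcal{C}\cup\{p\}$ and a multiset $\Pi_{\mathcal{V}}$ of votes in which $p$ is not the winner, and a set $\mathcal{V}'$ of $t$ manipulators. Question: can the manipulators cast votes $\Pi_{\mathcal{V}'}$ so that with all votes $\Pi_{\mathcal{V}}\uplus\Pi_{\mathcal{V}'}$ the candidate $p$ has strictly higher total score than every candidate in $\mathcal{C}$? The notation $O^*(\cdot)$ suppresses factors polynomial in the input size. -}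

module Defs where

open import Data.Bool.Base using (Bool; true; false; not; if_then_else_)
open import Data.Fin.Base using (Fin; zero; suc; toℕ)
open import Data.Fin.Permutation using (Permutation′; _⟨$⟩ʳ_)
open import Data.List.Base using (List; []; _∷_; _++_; map; concatMap; length; allFin)
open import Data.Nat.Base using (ℕ; zero; suc; _+_; _*_; _∸_; _<_; _≡ᵇ_; NonZero)
open import Data.Nat.ListAction using (sum)
open import Data.Nat.Logarithm using (⌊log₂_⌋)
open import Data.Product.Base using (Σ-syntax)
open import Data.Vec.Base using (Vec; toList)
open import Relation.Binary.PropositionalEquality using (_≡_)
open import Relation.Nullary.Negation.Core using (¬_)

private
  variable
    m : ℕ

------------------------------------------------------------------------
-- Borda elections

-- 𝒞 ∪ {p} for |𝒞| = m: p is zero, and suc c is the candidate c ∈ 𝒞.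

Candidate : ℕ → Set
Candidate m = Fin (suc m)

p : Candidate m
p = zero

-- A bijection onto the positions {1,…,m+1}, with position j represented
-- by the element of Fin (suc m) whose toℕ is j - 1.

Vote : ℕ → Set
Vote m = Permutation′ (suc m)

position : Vote m → Candidate m → ℕ
position π c = suc (toℕ (π ⟨$⟩ʳ c))

score : Vote m → Candidate m → ℕ
score π c = position π c ∸ 1

totalScore : List (Vote m) → Candidate m → ℕ
totalScore votes c = sum (map (λ π → score π c) votes)

pWins : List (Vote m) → Set
pWins {m} votes = (c : Fin m) → totalScore votes (suc c) < totalScore votes p

record UBM : Set where
  field
    ∣𝒞∣            : ℕ
    votes          : List (Vote ∣𝒞∣)
    t              : ℕ
    p-not-winner   : ¬ pWins votes

open UBM public

Manipulable : UBM → Set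
Manipulable I = Σ[ ballots ∈ Vec (Vote (∣𝒞∣ I)) (t I) ] pWins (votes I ++ toList ballots)

-- The candidates, the entries of the given votes and the manipulators are
-- all listed one by one in an instance, so each counts towards its size.

size : UBM → ℕ
size I = suc (∣𝒞∣ I) + length (votes I) * suc (∣𝒞∣ I) + t I

encode : UBM → List ℕ
encode I = ∣𝒞∣ I ∷ length (votes I) ∷ t I ∷
           concatMap (λ π → map (position π) (allFin (suc (∣𝒞∣ I)))) (votes I)

------------------------------------------------------------------------
-- Random access machines with logarithmic cost

-- A program mentions only finitely many registers; unbounded storage is
-- reached through load and store, which address the memory indirectly.

Reg : Set
Reg = ℕ

infixr 5 _⨾_

data Program : Set where
  skip       : Program
  const      : Reg → ℕ → Program              -- r := k
  add        : Reg → Reg → Reg → Program      -- r := a + b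
  sub        : Reg → Reg → Reg → Program      -- r := max (a - b) 0
  load       : Reg → Reg → Program            -- r := memory[a]
  store      : Reg → Reg → Program            -- memory[a] := b
  _⨾_        : Program → Program → Program
  ifNonZero  : Reg → Program → Program → Program
  whileNonZero : Reg → Program → Program

record State : Set where
  constructor ⟪_,_⟫
  field
    reg : Reg → ℕ
    mem : ℕ → ℕ

open State public

_[_↦_] : (ℕ → ℕ) → ℕ → ℕ → (ℕ → ℕ)
(f [ i ↦ v ]) j = if j ≡ᵇ i then v else f j

setReg : State → Reg → ℕ → State
setReg σ r v = ⟪ reg σ [ r ↦ v ] , mem σ ⟫

setMem : State → ℕ → ℕ → State
setMem σ a v = ⟪ reg σ , mem σ [ a ↦ v ] ⟫

-- The number of binary digits of n (and 1 for n = 0).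

ℓ : ℕ → ℕ
ℓ n = suc ⌊log₂ n ⌋

private
  variable
    σ σ′ σ″  : State
    P Q      : Program
    r a b k  : ℕ
    T T′     : ℕ

-- ⟨ P , σ ⟩⇓[ T ] σ′: started in σ, P halts in σ′ after time T.  Every
-- step is charged the lengths of the numbers it reads, including addresses.

data ⟨_,_⟩⇓[_]_ : Program → State → ℕ → State → Set where

  run-skip  : ⟨ skip , σ ⟩⇓[ 1 ] σ

  run-const : ⟨ const r k , σ ⟩⇓[ ℓ k ] setReg σ r k

  run-add   : ⟨ add r a b , σ ⟩⇓[ ℓ (reg σ a) + ℓ (reg σ b) ]
                setReg σ r (reg σ a + reg σ b)

  run-sub   : ⟨ sub r a b , σ ⟩⇓[ ℓ (reg σ a) + ℓ (reg σ b) ]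
                setReg σ r (reg σ a ∸ reg σ b)

  run-load  : ⟨ load r a , σ ⟩⇓[ ℓ (reg σ a) + ℓ (mem σ (reg σ a)) ]
                setReg σ r (mem σ (reg σ a))

  run-store : ⟨ store a b , σ ⟩⇓[ ℓ (reg σ a) + ℓ (reg σ b) ]
                setMem σ (reg σ a) (reg σ b)

  run-⨾     : ⟨ P , σ ⟩⇓[ T ] σ′ → ⟨ Q , σ′ ⟩⇓[ T′ ] σ″ →
              ⟨ P ⨾ Q , σ ⟩⇓[ T + T′ ] σ″

  run-then  : NonZero (reg σ r) → ⟨ P , σ ⟩⇓[ T ] σ′ →
              ⟨ ifNonZero r P Q , σ ⟩⇓[ ℓ (reg σ r) + T ] σ′

  run-else  : reg σ r ≡ 0 → ⟨ Q , σ ⟩⇓[ T ] σ′ →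
              ⟨ ifNonZero r P Q , σ ⟩⇓[ ℓ (reg σ r) + T ] σ′

  run-loop  : NonZero (reg σ r) → ⟨ P , σ ⟩⇓[ T ] σ′ →
              ⟨ whileNonZero r P , σ′ ⟩⇓[ T′ ] σ″ →
              ⟨ whileNonZero r P , σ ⟩⇓[ ℓ (reg σ r) + T + T′ ] σ″

  run-exit  : reg σ r ≡ 0 → ⟨ whileNonZero r P , σ ⟩⇓[ ℓ (reg σ r) ] σ

-- The input word is stored from memory cell 0 on; all other cells and all
-- registers are initially 0.

cells : List ℕ → ℕ → ℕ
cells []       _       = 0
cells (w ∷ _)  zero    = w
cells (_ ∷ ws) (suc i) = cells ws i

initial : List ℕ → State
initial input = ⟪ (λ _ → 0) , cells input ⟫

accepts : State → Bool
accepts σ = not (reg σ 0 ≡ᵇ 0)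

{-# OPTIONS --safe #-}

-- A manipulator may put p on top, so a successful manipulation consists of t
-- bijections of 𝒞 onto the scores 0,…,m-1 (m = |𝒞|) under which no candidate
-- collects as much as the lead that p then has; with one slack per candidate, the
-- sum of their score vectors must equal a given target vector.  The target is
-- reached binary digit by binary digit, lowest digit first.  Of equal votes, pairs
-- can be moved to the next digit, so by the pigeonhole principle at most m ^ m
-- votes are needed at each digit: a list L of votes splits as R, K, K with
-- |R| ≤ m ^ m.  The carries between digits therefore have entries bounded by some
-- D = m ^ O(m), and the carries that are reachable form a set of at most
-- (D + 1) ^ (m + 1) vectors.
--
-- A vector is the number with these digits in base W, and a set of vectors is a
-- bitmap in the memory, so every operation on sets consists of shifts of bitmaps.
-- A vote is added candidate by candidate, with further digits counting how often
-- each score was used; the votes are the codes where each of these digits is 1.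
-- A carry is halved coordinate by coordinate: guess the quotient u ≤ D, take
-- 2 u + b (b the bit of the target) from the digit, record u in a further digit,
-- and keep the codes where all the old digits were cancelled exactly.

module Submission where

open import Defs
open import Data.Bool.Base using (Bool; true; false; not; _∧_; T; if_then_else_)
open import Data.Empty using (⊥; ⊥-elim)
open import Data.Fin.Base using (Fin; zero; suc; toℕ; fromℕ<; funToFin; finToFun; fromℕ; punchIn)
open import Data.Fin.Permutation using (Permutation′; _⟨$⟩ʳ_; _⟨$⟩ˡ_; permutation; inverseˡ; inverseʳ; remove; insert; punchIn-permute; insert-punchIn)
open import Data.Fin.Properties using (toℕ<n; toℕ-fromℕ<; toℕ-injective; pigeonhole; finToFun-funToFin; toℕ-fromℕ; toℕ≤pred[n])
open import Data.List.Base using (List; []; _∷_; _++_; map; length; lookup; concatMap; allFin; tabulate)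
open import Data.List.Properties using (length-map; length-++; length-tabulate; map-tabulate; map-++)
open import Data.Nat.Base
open import Data.Nat.DivMod
open import Data.Nat.Divisibility using (divides)
open import Data.Nat.ListAction using (sum)
open import Data.Nat.ListAction.Properties using (sum-++)
open import Data.Nat.Logarithm using (⌊log₂⌋-mono-≤; ⌊log₂[2^n]⌋≡n)
open import Data.Nat.Properties
open import Data.Nat.Solver using (module +-*-Solver)
open import Data.Product.Base using (_×_; _,_; proj₁; proj₂; ∃-syntax; Σ-syntax)
open import Data.Sum.Base using (_⊎_; inj₁; inj₂)
open import Data.Unit.Base using (tt)
open import Data.Vec.Base as Vec using (Vec; toList)
open import Function.Base using (_∘_; id)
open import Function.Bundles using (_⇔_; mk⇔; Equivalence)
open import Relation.Binary.Definitions using (tri<; tri≈; tri>)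
open import Relation.Binary.PropositionalEquality
open import Relation.Nullary using (yes; no)
open import Relation.Nullary.Reflects using (Reflects; ofʸ; ofⁿ)

-- The time is governed by the length `Z` of a bitmap and the number `N` of votes per level. All
-- parameters are powers of `q = m + 2`, and `N * Z` is `q ^ (2 * m ^ 2 + 9 * m + 6)`. For larger
-- `m`, `q ≤ m ^ 2` brings this, up to polynomial factors, below `m ^ (9 * m ^ 2)`, that is, 2 to
-- the power of 9 m² log m. The remaining costs may be crude as long as they are polynomial in the
-- size. Votes and manipulators are listed one by one, so every target is polynomial: it is halved
-- by counting, and the number of levels is an upper bound `K` of the targets instead of its
-- logarithm. Every number is at most the last address `M`, whose length is polynomial, so a step is
-- charged one fixed price. The carries stay bounded: a carry up to `D`, at most `N * m` from the
-- votes of a digit and one slack bit add up to at most `D + D`, since `N * m < D`. The base `W`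
-- exceeds every digit that can arise on the way, so equal codes have equal digits. No bitmap is
-- ever erased. Each one is written into blank cells behind its predecessor, and the initial zeros
-- of the memory serve as the empty set.

-- What a program leaves unchanged

-- Registers and stores are tracked syntactically, so that what a program
-- leaves unchanged is found by computation.

unwritten : Program → Reg → Bool
unwritten skip               x = true
unwritten (const r _)        x = not (x ≡ᵇ r)
unwritten (add r _ _)        x = not (x ≡ᵇ r)
unwritten (sub r _ _)        x = not (x ≡ᵇ r)
unwritten (load r _)         x = not (x ≡ᵇ r)
unwritten (store _ _)        x = true
unwritten (P ⨾ Q)            x = unwritten P x ∧ unwritten Q x
unwritten (ifNonZero _ P Q)  x = unwritten P x ∧ unwritten Q x
unwritten (whileNonZero _ P) x = unwritten P x

storeless : Program → Bool
storeless (store _ _)        = false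
storeless (P ⨾ Q)            = storeless P ∧ storeless Q
storeless (ifNonZero _ P Q)  = storeless P ∧ storeless Q
storeless (whileNonZero _ P) = storeless P
storeless _                  = true

-- Registers are framed one by one, the memory only as a whole: a program with a `store` promises
-- nothing here, and what it leaves of the memory is stated where it is needed, as with `Agree`.
record Frame (P : Program) (σ σ′ : State) : Set where
  constructor mkFrame
  field
    regs   : ∀ x → T (unwritten P x) → reg σ′ x ≡ reg σ x
    memory : T (storeless P) → mem σ′ ≡ mem σ

open Frame public

private
  T-∧ˡ : ∀ {a b} → T (a ∧ b) → T a
  T-∧ˡ {true} _ = tt

  T-∧ʳ : ∀ {a b} → T (a ∧ b) → T b
  T-∧ʳ {true} t = t

  setReg-other : ∀ σ r v x → T (not (x ≡ᵇ r)) → reg (setReg σ r v) x ≡ reg σ x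
  setReg-other σ r v x t with x ≡ᵇ r
  ... | false = refl

frame : ∀ {P σ T′ σ′} → ⟨ P , σ ⟩⇓[ T′ ] σ′ → Frame P σ σ′
frame run-skip = mkFrame (λ _ _ → refl) (λ _ → refl)
frame {σ = σ} run-const = mkFrame (setReg-other σ _ _) (λ _ → refl)
frame {σ = σ} run-add   = mkFrame (setReg-other σ _ _) (λ _ → refl)
frame {σ = σ} run-sub   = mkFrame (setReg-other σ _ _) (λ _ → refl)
frame {σ = σ} run-load  = mkFrame (setReg-other σ _ _) (λ _ → refl)
frame run-store = mkFrame (λ _ _ → refl) (λ ())
frame (run-⨾ p q) with frame p | frame q
... | mkFrame f g | mkFrame f′ g′ =
  mkFrame (λ x t → trans (f′ x (T-∧ʳ t)) (f x (T-∧ˡ t)))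
          (λ t → trans (g′ (T-∧ʳ t)) (g (T-∧ˡ t)))
frame (run-then _ p) with frame p
... | mkFrame f g = mkFrame (λ x t → f x (T-∧ˡ t)) (λ t → g (T-∧ˡ t))
frame (run-else _ p) with frame p
... | mkFrame f g = mkFrame (λ x t → f x (T-∧ʳ t)) (λ t → g (T-∧ʳ t))
frame (run-loop _ p q) with frame p | frame q
... | mkFrame f g | mkFrame f′ g′ =
  mkFrame (λ x t → trans (f′ x t) (f x t)) (λ t → trans (g′ t) (g t))
frame (run-exit _) = mkFrame (λ _ _ → refl) (λ _ → refl)

-- A program logic for total correctness and cost

-- Costs are counted in units while all numbers stay at most M.

module Logic (M : ℕ) where

  -- No step reads more than two numbers, so this pays for any single step while all numbers are at
  -- most `M`.
  unit : ℕ
  unit = ℓ M + ℓ M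

  record Small (σ : State) : Set where
    constructor mkSmall
    field
      regs≤ : ∀ x → reg σ x ≤ M
      mem≤  : ∀ a → mem σ a ≤ M

  open Small public

  ℓ-mono : ∀ {a} → a ≤ M → ℓ a ≤ ℓ M
  ℓ-mono a≤M = s≤s (⌊log₂⌋-mono-≤ a≤M)

  small-setReg : ∀ {σ} r v → Small σ → v ≤ M → Small (setReg σ r v)
  small-setReg {σ} r v (mkSmall p q) v≤M = mkSmall go q
    where
    go : ∀ x → reg (setReg σ r v) x ≤ M
    go x with x ≡ᵇ r
    ... | true  = v≤M
    ... | false = p x

  small-setMem : ∀ {σ} a v → Small σ → v ≤ M → Small (setMem σ a v)
  small-setMem {σ} a v (mkSmall p q) v≤M = mkSmall p go
    where
    go : ∀ x → mem (setMem σ a v) x ≤ M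
    go x with x ≡ᵇ a
    ... | true  = v≤M
    ... | false = q x

  -- The run itself is stored, so that a derivation proves termination and yields the time and the
  -- final state that the theorem asks for. `Small` is carried along because the price of the steps
  -- that follow depends on it.
  record Exec (P : Program) (σ : State) (n : ℕ) (Q : State → Set) : Set where
    constructor mkExec
    field
      {time}  : ℕ
      {final} : State
      run     : ⟨ P , σ ⟩⇓[ time ] final
      time≤   : time ≤ n * unit
      small   : Small final
      post    : Q final

  open Exec public

  private
    variable
      P P′ : Program
      σ    : State
      n n′ : ℕ
      Q R  : State → Set

    pair≤ : ∀ {a b} → a ≤ M → b ≤ M → ℓ a + ℓ b ≤ 1 * unit
    pair≤ a≤ b≤ = ≤-trans (+-mono-≤ (ℓ-mono a≤) (ℓ-mono b≤)) (≤-reflexive (sym (*-identityˡ unit)))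

    single≤ : ∀ {a} → a ≤ M → ℓ a ≤ unit
    single≤ a≤ = ≤-trans (ℓ-mono a≤) (m≤m+n (ℓ M) (ℓ M))

    single≤₁ : ∀ {a} → a ≤ M → ℓ a ≤ 1 * unit
    single≤₁ a≤ = ≤-trans (single≤ a≤) (≤-reflexive (sym (*-identityˡ unit)))

  weaken : n ≤ n′ → Exec P σ n Q → Exec P σ n′ Q
  weaken n≤ e = mkExec (run e) (≤-trans (time≤ e) (*-monoˡ-≤ unit n≤)) (small e) (post e)

  -- The continuation receives the frame of `P`, so `R` need not mention the registers that `P`
  -- leaves alone.
  bind : Exec P σ n R →
         (∀ σ₁ → Small σ₁ → Frame P σ σ₁ → R σ₁ → Exec P′ σ₁ n′ Q) →
         Exec (P ⨾ P′) σ (n + n′) Q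
  bind {n = n} {n′ = n′} e f = mkExec (run-⨾ (run e) (run e′))
    (≤-trans (+-mono-≤ (time≤ e) (time≤ e′)) (≤-reflexive (sym (*-distribʳ-+ unit n n′))))
    (small e′) (post e′)
    where e′ = f _ (small e) (frame (run e)) (post e)

  finish : Exec P σ n R → (∀ σ₁ → Small σ₁ → Frame P σ σ₁ → R σ₁ → Q σ₁) → Exec P σ n Q
  finish e f = mkExec (run e) (time≤ e) (small e) (f _ (small e) (frame (run e)) (post e))

  -- Every instruction comes with a value v that its result is known to equal,
  -- so that the symbolic states stay in normal form.

  skipₑ : Small σ → Q σ → Exec skip σ 1 Q
  skipₑ sm q = mkExec run-skip (s≤s z≤n) sm q

  constₑ : ∀ {r} k → Small σ → k ≤ M →
           (Small (setReg σ r k) → Q (setReg σ r k)) → Exec (const r k) σ 1 Q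
  constₑ {r = r} k sm k≤ q = mkExec run-const (single≤₁ k≤) sm′ (q sm′)
    where sm′ = small-setReg r k sm k≤

  addₑ : ∀ {r a b} v → Small σ → reg σ a + reg σ b ≡ v → v ≤ M →
         (Small (setReg σ r v) → Q (setReg σ r v)) → Exec (add r a b) σ 1 Q
  addₑ {r = r} _ sm refl v≤ q = mkExec run-add (pair≤ (regs≤ sm _) (regs≤ sm _)) sm′ (q sm′)
    where sm′ = small-setReg r _ sm v≤

  subₑ : ∀ {r a b} v → Small σ → reg σ a ∸ reg σ b ≡ v →
         (Small (setReg σ r v) → Q (setReg σ r v)) → Exec (sub r a b) σ 1 Q
  subₑ {σ = σ} {r = r} {a} {b} _ sm refl q = mkExec run-sub (pair≤ (regs≤ sm _) (regs≤ sm _)) sm′ (q sm′)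
    where sm′ = small-setReg r _ sm (≤-trans (m∸n≤m (reg σ a) (reg σ b)) (regs≤ sm a))

  loadₑ : ∀ {r a} v → Small σ → mem σ (reg σ a) ≡ v →
          (Small (setReg σ r v) → Q (setReg σ r v)) → Exec (load r a) σ 1 Q
  loadₑ {r = r} _ sm refl q = mkExec run-load (pair≤ (regs≤ sm _) (mem≤ sm _)) sm′ (q sm′)
    where sm′ = small-setReg r _ sm (mem≤ sm _)

  storeₑ : ∀ {a b} x v → Small σ → reg σ a ≡ x → reg σ b ≡ v →
           (Small (setMem σ x v) → Q (setMem σ x v)) → Exec (store a b) σ 1 Q
  storeₑ {a = a} {b} _ _ sm refl refl q = mkExec run-store (pair≤ (regs≤ sm _) (regs≤ sm _)) sm′ (q sm′)
    where sm′ = small-setMem _ _ sm (regs≤ sm b)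

  seq : Exec P σ n (λ σ₁ → Exec P′ σ₁ n′ Q) → Exec (P ⨾ P′) σ (n + n′) Q
  seq e = bind e (λ _ _ _ e′ → e′)

  ifₑ : ∀ {r} → Small σ → (NonZero (reg σ r) → Exec P σ n Q) →
        (reg σ r ≡ 0 → Exec P′ σ n Q) → Exec (ifNonZero r P P′) σ (suc n) Q
  ifₑ {σ = σ} {P = P} {n = n} {Q = Q} {P′ = P′} {r = r} sm p q = go (reg σ r) refl
    where
    go : ∀ v → reg σ r ≡ v → Exec (ifNonZero r P P′) σ (suc n) Q
    go zero eq = mkExec (run-else eq (run e)) (+-mono-≤ (single≤ (regs≤ sm r)) (time≤ e)) (small e) (post e)
      where e = q eq
    go (suc v) eq = mkExec (run-then nz (run e)) (+-mono-≤ (single≤ (regs≤ sm r)) (time≤ e)) (small e) (post e)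
      where
      nz = subst NonZero (sym eq) _
      e  = p nz

  -- The invariant is indexed by the number of rounds still to come, which is the content of the
  -- counter `r`. Each round pays one unit for its test, and the failing test accounts for the final
  -- 1. The frame given to the body reaches back to the state before the loop.
  for : ∀ {r} (Inv : ℕ → State → Set) k → Small σ → reg σ r ≡ k → Inv k σ →
        (∀ j σ₁ → Small σ₁ → Frame P σ σ₁ → j < k → reg σ₁ r ≡ suc j → Inv (suc j) σ₁ →
           Exec P σ₁ n (λ σ₂ → reg σ₂ r ≡ j × Inv j σ₂)) →
        Exec (whileNonZero r P) σ (k * suc n + 1) (Inv 0)
  for {σ = σ} {P = P} {n = n} {r = r} Inv k sm eq inv body = go k σ sm (mkFrame (λ _ _ → refl) (λ _ → refl)) ≤-refl eq inv
    where
    go : ∀ j σ₁ → Small σ₁ → Frame P σ σ₁ → j ≤ k → reg σ₁ r ≡ j → Inv j σ₁ →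
         Exec (whileNonZero r P) σ₁ (j * suc n + 1) (Inv 0)
    go zero σ₁ sm₁ fr _ eq₁ inv₁ = mkExec (run-exit eq₁) (single≤₁ (regs≤ sm₁ r)) sm₁ inv₁
    go (suc j) σ₁ sm₁ fr j<k eq₁ inv₁ =
      mkExec (run-loop (subst NonZero (sym eq₁) _) (run e) (run e′))
        (≤-trans (+-mono-≤ (+-mono-≤ (single≤ (regs≤ sm₁ r)) (time≤ e)) (time≤ e′))
          (≤-reflexive (trans (sym (*-distribʳ-+ unit (suc n) (j * suc n + 1)))
                              (cong (_* unit) (sym (+-assoc (suc n) (j * suc n) 1))))))
        (small e′) (post e′)
      where
      e  = body j σ₁ sm₁ fr j<k eq₁ inv₁
      fr′ = frame (run e)
      e′ = go j (final e) (small e)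
             (mkFrame (λ x t → trans (regs fr′ x t) (regs fr x t)) (λ t → trans (memory fr′ t) (memory fr t)))
             (<⇒≤ j<k) (proj₁ (post e)) (proj₂ (post e))

  -- The counter runs down while the invariant counts up; `for` is used with an invariant that keeps
  -- both numbers and their sum `k`.
  repeat : ∀ {r} (Inv : ℕ → State → Set) k → Small σ → reg σ r ≡ k → Inv 0 σ →
           (∀ i j σ₁ → Small σ₁ → Frame P σ σ₁ → i < k → reg σ₁ r ≡ suc j → Inv i σ₁ →
              Exec P σ₁ n (λ σ₂ → reg σ₂ r ≡ j × Inv (suc i) σ₂)) →
           Exec (whileNonZero r P) σ (k * suc n + 1) (Inv k)
  repeat {σ = σ} {P = P} {n = n} {r = r} Inv k sm eq inv body =
    finish (for Inv′ k sm eq (0 , refl , inv) round)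
      λ { σ₁ _ _ (i , i+0≡k , inv₁) → subst (λ i → Inv i σ₁) (trans (sym (+-identityʳ i)) i+0≡k) inv₁ }
    where
    Inv′ : ℕ → State → Set
    Inv′ j σ₁ = ∃[ i ] (i + j ≡ k × Inv i σ₁)
    round : ∀ j σ₁ → Small σ₁ → Frame P σ σ₁ → j < k → reg σ₁ r ≡ suc j → Inv′ (suc j) σ₁ →
            Exec P σ₁ n (λ σ₂ → reg σ₂ r ≡ j × Inv′ j σ₂)
    round j σ₁ sm₁ fr _ eq₁ (i , i+j≡k , inv₁) =
      finish (body i j σ₁ sm₁ fr (subst (i <_) i+j≡k (m<m+n i (s≤s z≤n))) eq₁ inv₁)
        λ { _ _ _ (eq₂ , inv₂) → eq₂ , suc i , trans (sym (+-suc i j)) i+j≡k , inv₂ }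

-- The program

-- Register 1 holds 1, 2 holds m = |𝒞|, 3 the number of votes, 4 the number t of
-- manipulators, 5 the base W, 11 the bound N on the votes of a level, 12 the
-- power X = W ^ (m + 1), 13 the code U, 14 the distance Z = X ^ 2 of two bitmaps,
-- 20 the address of the targets, 28 that of the current bitmap, 40 holds 0,
-- 42 holds 2, 46 holds D + 1 and 47 holds E = 2 D + 1.

-- r8 := r8 * W
times-W : Program
times-W = const 6 0 ⨾ add 7 5 40 ⨾ whileNonZero 7 (add 6 6 8 ⨾ sub 7 7 1) ⨾ add 8 6 40

-- r9 := r8 * (1 + W + … + W ^ (r10 ∸ 1)), r8 := r8 * W ^ r10
geometric : Program
geometric = const 9 0 ⨾ whileNonZero 10 (add 9 9 8 ⨾ times-W ⨾ sub 10 10 1)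

-- for each x < r18: if cell r15 + x * r17 is nonzero, set cell r16 + x
transfer-step transfer : Program
transfer-step = load 19 15 ⨾ ifNonZero 19 (store 16 1) skip ⨾ add 15 15 17 ⨾ add 16 16 1 ⨾ sub 18 18 1
transfer = whileNonZero 18 transfer-step

-- shift the current bitmap by r43 into the next one
push : Program
push = add 15 28 40 ⨾ add 16 28 14 ⨾ add 16 16 43 ⨾ add 17 1 40 ⨾ add 18 14 40 ⨾ transfer

-- Register 31 is the weight `w` of the current candidate. For the score `i`, register 33 holds
-- `i * w` and register 8 holds `X * W ^ i`; their sum is the shift. Register 30 remembers the
-- bitmap from before the vote: `select` and `keep` fill one fresh bitmap with the codes that gained
-- a vote and with the old ones.
score-step candidate-step select keep vote-step : Program
score-step = add 43 33 8 ⨾ push ⨾ add 33 33 31 ⨾ times-W ⨾ sub 27 27 1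
candidate-step =
  const 33 0 ⨾ add 8 12 40 ⨾ add 27 2 40 ⨾ whileNonZero 27 score-step ⨾ add 28 28 14 ⨾
  add 8 31 40 ⨾ times-W ⨾ add 31 8 40 ⨾ sub 26 26 1
select = add 15 28 13 ⨾ add 16 28 14 ⨾ add 16 16 1 ⨾ add 17 1 40 ⨾ add 18 12 40 ⨾ transfer
keep = add 15 30 40 ⨾ add 16 28 14 ⨾ add 17 1 40 ⨾ add 18 12 40 ⨾ transfer
vote-step =
  add 30 28 40 ⨾ add 31 5 40 ⨾ add 26 2 40 ⨾ whileNonZero 26 candidate-step ⨾
  select ⨾ keep ⨾ add 28 28 14 ⨾ sub 35 35 1

-- halve the target in cell r25; r43 := r44, less r31 if the target was odd
halve : Program
halve =
  const 38 0 ⨾ const 37 0 ⨾ load 39 25 ⨾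
  whileNonZero 39 (add 38 38 37 ⨾ sub 37 1 37 ⨾ sub 39 39 1) ⨾
  store 25 38 ⨾ add 43 44 40 ⨾ ifNonZero 37 (sub 43 43 31) skip

-- Registers 31, 44 and 45 hold `w`, `E * w` and `X * w ∸ 2 * w` for the weight `w` of the current
-- coordinate, and `scale` moves all three to the next one. Raising the guessed quotient by one adds
-- register 45 to the shift. Register 36 collects the terms `E * w`.
quotient-step carry-step scale slack-step level : Program
quotient-step = push ⨾ add 43 43 45 ⨾ sub 27 27 1
carry-step = halve ⨾ add 27 46 40 ⨾ whileNonZero 27 quotient-step ⨾ add 28 28 14 ⨾ add 36 36 44
scale =
  add 8 31 40 ⨾ times-W ⨾ add 31 8 40 ⨾ add 8 44 40 ⨾ times-W ⨾ add 44 8 40 ⨾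
  add 8 45 40 ⨾ times-W ⨾ add 45 8 40
slack-step = const 43 0 ⨾ push ⨾ add 43 31 40 ⨾ push ⨾ add 28 28 14
level =
  add 35 11 40 ⨾ whileNonZero 35 vote-step ⨾
  const 36 0 ⨾ const 31 1 ⨾ add 44 47 40 ⨾ sub 45 12 42 ⨾ add 25 20 40 ⨾ carry-step ⨾ add 26 2 40 ⨾
  whileNonZero 26 (scale ⨾ add 25 25 1 ⨾ slack-step ⨾ carry-step ⨾ sub 26 26 1) ⨾
  -- By now register 36 is the code with all lower digits `E`. A scan from there with step `X`
  -- visits exactly codes with these lower digits and reads off their upper parts.
  add 15 28 36 ⨾ add 16 28 14 ⨾ add 17 12 40 ⨾ add 18 12 40 ⨾ transfer ⨾
  add 28 28 14 ⨾ sub 34 34 1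

-- Register 5 holds `q = m + 2` until `N`, `D` and `W` have been computed as powers of `q`, and only
-- then becomes `W`. Register 41 is the code with digits 0, 1, ..., 1, from which the first level
-- starts.
constants : Program
constants =
  const 1 1 ⨾ const 42 2 ⨾ load 2 40 ⨾ load 3 1 ⨾ load 4 42 ⨾ add 5 2 42 ⨾
  const 8 1 ⨾ add 10 2 40 ⨾ geometric ⨾ add 11 8 40 ⨾
  times-W ⨾ add 46 8 1 ⨾ add 47 46 8 ⨾
  add 10 42 40 ⨾ geometric ⨾ add 5 8 40 ⨾
  add 10 2 40 ⨾ geometric ⨾ add 41 9 40 ⨾ add 12 8 40 ⨾
  add 10 2 40 ⨾ geometric ⨾ add 13 9 40 ⨾ times-W ⨾ add 14 8 40

-- r24 := the sum of r3 cells at distance r21, from cell r23 on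
column-sum : Program
column-sum =
  const 24 0 ⨾ add 15 23 40 ⨾ add 18 3 40 ⨾
  whileNonZero 18 (load 19 15 ⨾ add 24 24 19 ⨾ add 15 15 21 ⨾ sub 18 18 1)

target-step targets : Program
target-step =
  add 23 23 1 ⨾ add 25 25 1 ⨾ column-sum ⨾ sub 24 22 24 ⨾ store 25 24 ⨾ sub 26 26 1
targets =
  -- Column 0 belongs to p, and the pointer that has run through it rests on the first cell behind
  -- the input.
  add 21 2 1 ⨾ const 23 3 ⨾ column-sum ⨾ add 20 15 40 ⨾
  add 22 24 40 ⨾ add 18 4 40 ⨾ whileNonZero 18 (add 22 22 2 ⨾ sub 18 18 1) ⨾
  store 20 4 ⨾ add 25 20 40 ⨾ add 26 2 40 ⨾ whileNonZero 26 target-step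

program : Program
program =
  constants ⨾ targets ⨾
  -- The number of levels is p's column sum with `m` points per manipulator, plus `t`. No target
  -- exceeds this number `K`, and `K < 2 ^ K`, so after `K` halvings all targets are 0 and the
  -- answer is whether the carry 0 is reachable, which is the first cell of the last bitmap.
  add 28 25 1 ⨾ add 16 28 41 ⨾ store 16 1 ⨾ add 34 22 4 ⨾
  whileNonZero 34 level ⨾ load 0 28

-- Updates and geometric sums

update-≡ : ∀ f i v → (f [ i ↦ v ]) i ≡ v
update-≡ f i v with i ≡ᵇ i | ≡⇒≡ᵇ i i refl
... | true | _ = refl

update-≢ : ∀ f i v {j} → j ≢ i → (f [ i ↦ v ]) j ≡ f j
update-≢ f i v {j} ne with j ≡ᵇ i | ≡ᵇ⇒≡ j i
... | true  | e = ⊥-elim (ne (e _))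
... | false | _ = refl

geometricSum : ℕ → ℕ → ℕ → ℕ
geometricSum W p zero    = 0
geometricSum W p (suc k) = p + geometricSum W (p * W) k

-- The extra `q` on the left pays for the induction step, where `q + q ≤ q * W`.
geometricSum-bound : ∀ W q k → 2 ≤ W → geometricSum W q k + q ≤ q * W ^ k
geometricSum-bound W q zero    2≤W = ≤-reflexive (sym (*-identityʳ q))
geometricSum-bound W q (suc k) 2≤W = begin
  q + geometricSum W (q * W) k + q     ≡⟨ solve 2 (λ q s → q :+ s :+ q := s :+ q :* con 2) refl q (geometricSum W (q * W) k) ⟩
  geometricSum W (q * W) k + q * 2     ≤⟨ +-monoʳ-≤ _ (*-monoʳ-≤ q 2≤W) ⟩
  geometricSum W (q * W) k + q * W     ≤⟨ geometricSum-bound W (q * W) k 2≤W ⟩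
  q * W * W ^ k                        ≡⟨ *-assoc q W (W ^ k) ⟩
  q * W ^ suc k                        ∎
  where
  open ≤-Reasoning
  open +-*-Solver

-- The sets of codes that the bitmaps represent

Below : ℕ → (ℕ → Set) → Set
Below n S = ∀ {x} → S x → x < n

-- The effect of one scan over `n` cells: the bitmap of `S`, shifted by `g`, is or-ed into that of
-- `T`.
Added : (T S : ℕ → Set) (n g : ℕ) → ℕ → Set
Added T S n g y = T y ⊎ ∃[ x ] (x < n × S x × y ≡ x + g)

Shifted : (S : ℕ → Set) (g : ℕ → ℕ) (k : ℕ) → ℕ → Set
Shifted S g k y = ∃[ x ] ∃[ i ] (i < k × S x × y ≡ x + g i)

-- `Below n S` guarantees that a scan of `n` cells sees all of `S`.
Shifted-suc : ∀ {S g k n} → Below n S → ∀ y → Added (Shifted S g k) S n (g k) y ⇔ Shifted S g (suc k) y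
Shifted-suc {S} {g} {k} {n} bl y = mk⇔ to from
  where
  to : Added (Shifted S g k) S n (g k) y → Shifted S g (suc k) y
  to (inj₁ (x , i , i<k , r)) = x , i , m<n⇒m<1+n i<k , r
  to (inj₂ (x , _ , s , e)) = x , k , n<1+n k , s , e
  from : Shifted S g (suc k) y → Added (Shifted S g k) S n (g k) y
  from (x , i , s≤s i≤k , s , e) with i ≟ k
  ... | yes refl = inj₂ (x , bl s , s , e)
  ... | no i≢k = inj₁ (x , i , ≤∧≢⇒< i≤k i≢k , s , e)

module Codes (m W D : ℕ) where

  -- The `m + 1` lower digits of a code lie below `X`, the upper digits are its multiples of `X`,
  -- and `Z` leaves room for `m + 1` of these. `U` has 1 in each of the `m` upper digits that count
  -- scores. `E` is the largest value of `2u + b` for `u ≤ D` and a bit `b`.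
  X Z U E : ℕ
  X = W ^ suc m
  Z = X * X
  U = geometricSum W X m
  E = suc (D + D)

  -- The current candidate, whose digit has weight w, gets a score below k, which
  -- is recorded in the upper digits.

  Scored : (S : ℕ → Set) (w k : ℕ) → ℕ → Set
  Scored S w = Shifted S (λ i → i * w + X * W ^ i)

  Stage : (ℕ → Set) → ℕ → ℕ → Set
  Stage S zero    = S
  Stage S (suc k) = Scored (Stage S k) (W ^ suc k) m

  -- The selected codes have all upper digits 1; the lowest digit counts the votes.

  Voted : (ℕ → Set) → ℕ → Set
  Voted S = Added (Added (λ _ → ⊥) (λ x → Stage S m (U + x)) X 1) S X 0

  Slack : (ℕ → Set) → ℕ → ℕ → Set
  Slack S w = Added (Added (λ _ → ⊥) S Z 0) S Z w

  -- Guess a quotient digit u ≤ D, subtract 2u + b from the digit of weight w,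
  -- raised by E so that it stays nonnegative, and put u in the upper digits.

  Carried : (S : ℕ → Set) (w b k : ℕ) → ℕ → Set
  Carried S w b = Shifted S (λ u → (E * w ∸ b * w) + u * (X * w ∸ 2 * w))

  -- `Voted` retains the old codes, so this stands for at most, not exactly, so many votes.
  Votes : (ℕ → Set) → ℕ → ℕ → Set
  Votes S zero    = S
  Votes S (suc j) = Voted (Votes S j)

  -- Coordinate 0 counts the votes, whose number must be met exactly; it gets no slack.
  Halves : (ℕ → Set) → (ℕ → ℕ) → ℕ → ℕ → Set
  Halves S b zero    = Carried S 1 (b 0 % 2) (suc D)
  Halves S b (suc i) = Carried (Slack (Halves S b i) (W ^ suc i)) (W ^ suc i) (b (suc i) % 2) (suc D)

  code : (ℕ → ℕ) → ℕ → ℕ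
  code v zero    = 0
  code v (suc k) = code v k + v k * W ^ k

  -- In the selected codes all lower digits are E.

  Next : ℕ → (ℕ → Set) → (ℕ → ℕ) → ℕ → Set
  Next N S b = Added (λ _ → ⊥) (λ x → Halves (Votes S N) b m (code (λ _ → E) (suc m) + X * x)) X 0

  code< : ∀ v k → (∀ i → i < k → v i < W) → code v k < W ^ k
  code< v zero    v<W = s≤s z≤n
  code< v (suc k) v<W = begin-strict
    code v k + v k * W ^ k <⟨ +-monoˡ-< (v k * W ^ k) (code< v k (λ i i<k → v<W i (m<n⇒m<1+n i<k))) ⟩
    suc (v k) * W ^ k      ≤⟨ *-monoˡ-≤ (W ^ k) (v<W k (n<1+n k)) ⟩
    W ^ suc k              ∎
    where open ≤-Reasoning

-- The parameters and their inequalities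

module Parameters (m : ℕ) where

  -- These are `q ^ m`, `q ^ (m + 1)` and `q ^ (m + 3)`. `N` is at least `m ^ m`, the number of
  -- votes left unpaired. `D` exceeds `N * m`, the most these votes add to a coordinate. The last
  -- factor `q ^ 2` gives a digit of base `W` room for more than `4 D`.
  q N D W : ℕ
  q = suc (suc m)
  N = q ^ m
  D = N * q
  W = D * q ^ 2

  N-nonZero : NonZero N
  N-nonZero = m^n≢0 q m

  D-nonZero : NonZero D
  D-nonZero = m*n≢0 N q {{N-nonZero}}

  instance
    W-nonZero : NonZero W
    W-nonZero = m*n≢0 D (q ^ 2) {{D-nonZero}} {{m^n≢0 q 2}}

  open Codes m W D public using (X; Z; U; E)

  1≤N : 1 ≤ N
  1≤N = >-nonZero⁻¹ N {{N-nonZero}}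

  q²≤W : q ^ 2 ≤ W
  q²≤W = m≤n*m (q ^ 2) D {{D-nonZero}}

  q≤W : q ≤ W
  q≤W = ≤-trans (≤-trans (m≤m*n q q) (≤-reflexive (cong (q *_) (sym (*-identityʳ q))))) q²≤W

  2≤W : 2 ≤ W
  2≤W = ≤-trans (s≤s (s≤s z≤n)) q≤W

  W≤X : W ≤ X
  W≤X = m≤m*n W (W ^ m) {{m^n≢0 W m}}

  X≤Z : X ≤ Z
  X≤Z = m≤m*n X X {{m^n≢0 W (suc m)}}

  2≤D : 2 ≤ D
  2≤D = ≤-trans (s≤s (s≤s z≤n)) (m≤n*m q N {{N-nonZero}})

  4D≤W : D * 4 ≤ W
  4D≤W = *-monoʳ-≤ D (*-mono-≤ {2} {q} (s≤s (s≤s z≤n)) (≤-trans (s≤s (s≤s z≤n)) (m≤m*n q 1)))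

  E<W : E < W
  E<W = ≤-trans (≤-trans (+-monoʳ-≤ 2 (≤-reflexive (solve 1 (λ d → d :+ d := d :* con 2) refl D)))
          (≤-trans (+-monoˡ-≤ (D * 2) (≤-trans 2≤D (m≤m*n D 2))) (≤-reflexive (solve 1 (λ d → d :* con 2 :+ d :* con 2 := d :* con 4) refl D)))) 4D≤W
    where open +-*-Solver

  m^m≤N : m ^ m ≤ N
  m^m≤N = ^-monoˡ-≤ m (m≤n+m m 2)

  Nm<D : N * m < D
  Nm<D = *-monoʳ-< N {{N-nonZero}} (s≤s (n≤1+n m))

  -- The largest digit arises when a carry with its votes, at most `D + N * m`, is raised by `E` and
  -- a slack bit; this is less than `D * 4 + 2`.
  W-large : 1 ≤ m → D * 4 + 2 ≤ W
  W-large 1≤m = ≤-trans (+-monoʳ-≤ (D * 4) 2≤D) (≤-trans (≤-reflexive (solve 1 (λ d → d :* con 4 :+ d := d :* con 5) refl D))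
    (*-monoʳ-≤ D (≤-trans (s≤s (s≤s (s≤s (s≤s (s≤s z≤n))))) (^-monoˡ-≤ 2 {3} {q} (s≤s (s≤s 1≤m))))))
    where open +-*-Solver

-- Columns of the input and the target vector

columnSum : ℕ → (ℕ → ℕ) → ℕ → ℕ → ℕ
columnSum m μ a zero    = 0
columnSum m μ a (suc k) = μ a + columnSum m μ (a + suc m) k

-- The last cell read is `a + (k - 1) * suc m`, and `a + k * suc m ≤ c + m` puts it below `c`. This
-- lets later columns be summed while targets are already being stored behind the input.
columnSum-cong : ∀ {m μ μ′} a k c → (∀ y → y < c → μ y ≡ μ′ y) → a + k * suc m ≤ c + m → columnSum m μ a k ≡ columnSum m μ′ a k
columnSum-cong a zero    c eq a≤ = refl
columnSum-cong {m} a (suc k) c eq a≤ = cong₂ _+_ (eq a a<c) (columnSum-cong (a + suc m) k c eq (≤-trans (≤-reflexive (+-assoc a (suc m) (k * suc m))) a≤))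
  where
  a<c : a < c
  a<c = +-cancelʳ-≤ m (suc a) c (≤-trans (≤-reflexive (sym (+-suc a m)))
          (≤-trans (m≤m+n (a + suc m) (k * suc m)) (≤-trans (≤-reflexive (+-assoc a (suc m) (k * suc m))) a≤)))

module Input (m : ℕ) where

  base : ℕ → ℕ
  base n = 3 + n * suc m

  -- Positions are summed in place of scores. Each column exceeds its total score by `n`, which
  -- cancels in `target`.
  total : (ℕ → ℕ) → ℕ → ℕ → ℕ
  total μ n t = columnSum m μ 3 n + t * m

  -- Coordinate 0 asks for `t` ballots, the others for p's lead. Truncating a negative lead to 0
  -- does no harm: the starting carry already has 1 in these coordinates, so a target 0 cannot be
  -- met.
  target : (ℕ → ℕ) → ℕ → ℕ → ℕ → ℕ
  target μ n t zero    = t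
  target μ n t (suc i) = total μ n t ∸ columnSum m μ (3 + suc i) n

-- Execution of the basic blocks

module Blocks (M : ℕ) where
  open Logic M

  private
    variable
      σ : State

    +0 : ∀ {x y} → y ≡ 0 → x + y ≡ x
    +0 {x} refl = +-identityʳ x

    1≤-small : reg σ 1 ≡ 1 → Small σ → 1 ≤ M
    1≤-small e sm = subst (_≤ M) e (regs≤ sm 1)

  times-W-exec : ∀ {w q} → Small σ → reg σ 1 ≡ 1 → reg σ 40 ≡ 0 → reg σ 5 ≡ w → reg σ 8 ≡ q →
                 q * w ≤ M → Exec times-W σ (w * 3 + 4) (λ σ′ → reg σ′ 8 ≡ q * w)
  times-W-exec {σ} {w} {q} sm e1 e40 e5 e8 qw≤ =
    weaken (≤-reflexive (solve 1 (λ w → con 1 :+ (con 1 :+ ((w :* con 3 :+ con 1) :+ con 1)) := w :* con 3 :+ con 4) refl w)) (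
    seq (constₑ 0 sm z≤n λ sm₁ →
    seq (addₑ w sm₁ (trans (+0 e40) e5) (subst (_≤ M) e5 (regs≤ sm 5)) λ sm₂ →
    bind (for (λ j σ₁ → reg σ₁ 6 + q * j ≡ q * w) w sm₂ refl refl step) λ σ₃ sm₃ fr inv →
    addₑ (q * w) sm₃ (trans (cong₂ _+_ refl (trans (regs fr 40 _) e40)) (trans (cong (reg σ₃ 6 +_) (sym (*-zeroʳ q))) inv)) qw≤ λ _ → refl)))
    where
    open +-*-Solver
    σ₂ = setReg (setReg σ 6 0) 7 w
    step : ∀ j σ₁ → Small σ₁ → Frame (add 6 6 8 ⨾ sub 7 7 1) σ₂ σ₁ → j < w → reg σ₁ 7 ≡ suc j →
           reg σ₁ 6 + q * suc j ≡ q * w →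
           Exec (add 6 6 8 ⨾ sub 7 7 1) σ₁ 2 (λ σ₃ → reg σ₃ 7 ≡ j × reg σ₃ 6 + q * j ≡ q * w)
    step j σ₁ sm₁ fr _ e7 inv =
      seq (addₑ (reg σ₁ 6 + q) sm₁ (cong (reg σ₁ 6 +_) (trans (regs fr 8 _) e8))
            (≤-trans (m≤m+n _ _) (≤-trans (≤-reflexive inv′) qw≤)) λ sm₂ →
      subₑ j sm₂ (cong₂ _∸_ e7 (trans (regs fr 1 _) e1)) λ _ → refl , inv′)
      where
      inv′ : reg σ₁ 6 + q + q * j ≡ q * w
      inv′ = trans (trans (+-assoc (reg σ₁ 6) q (q * j)) (cong (reg σ₁ 6 +_) (sym (*-suc q j)))) inv
  geometric-exec : ∀ {w q k} .{{_ : NonZero w}} → Small σ → reg σ 1 ≡ 1 → reg σ 40 ≡ 0 →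
                   reg σ 5 ≡ w → reg σ 8 ≡ q → reg σ 10 ≡ k →
                   q * w ^ k ≤ M → geometricSum w q k ≤ M →
                   Exec geometric σ (k * (w * 3 + 7) + 2)
                     (λ σ′ → reg σ′ 8 ≡ q * w ^ k × reg σ′ 9 ≡ geometricSum w q k)
  geometric-exec {σ} {w} {q} {k} sm e1 e40 e5 e8 e10 pow≤ sum≤ =
    weaken (≤-reflexive (solve 2 (λ w k → con 1 :+ (k :* (con 1 :+ (con 1 :+ ((w :* con 3 :+ con 4) :+ con 1))) :+ con 1)
                                   := k :* (w :* con 3 :+ con 7) :+ con 2) refl w k)) (
    seq (constₑ 0 sm z≤n λ sm₁ →
    finish (for Inv k sm₁ e10 (cong (_* w ^ k) e8 , cong (λ z → geometricSum w z k) e8) step)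
      λ σ₃ _ _ (i₁ , i₂) → trans (sym (*-identityʳ _)) i₁ , trans (sym (+-identityʳ _)) i₂))
    where
    open +-*-Solver
    Inv : ℕ → State → Set
    Inv j σ₁ = reg σ₁ 8 * w ^ j ≡ q * w ^ k × reg σ₁ 9 + geometricSum w (reg σ₁ 8) j ≡ geometricSum w q k
    body = add 9 9 8 ⨾ times-W ⨾ sub 10 10 1
    step : ∀ j σ₁ → Small σ₁ → Frame body (setReg σ 9 0) σ₁ → j < k → reg σ₁ 10 ≡ suc j → Inv (suc j) σ₁ →
           Exec body σ₁ (1 + ((w * 3 + 4) + 1)) (λ σ₂ → reg σ₂ 10 ≡ j × Inv j σ₂)
    step j σ₁ sm₁ fr _ e10′ (i₁ , i₂) =
      seq (addₑ (g + r) sm₁ refl (≤-trans (m≤m+n (g + r) (geometricSum w (r * w) j)) (≤-trans (≤-reflexive i₂′) sum≤)) λ sm₂ →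
      bind (times-W-exec sm₂ (trans (regs fr 1 _) e1) (trans (regs fr 40 _) e40) (trans (regs fr 5 _) e5) refl
             (≤-trans (m≤m*n (r * w) (w ^ j) {{m^n≢0 w j}}) (≤-trans (≤-reflexive i₁′) pow≤))) λ σ₃ sm₃ fr₃ e8′ →
      subₑ j sm₃ (cong₂ _∸_ (trans (regs fr₃ 10 _) e10′) (trans (regs fr₃ 1 _) (trans (regs fr 1 _) e1))) λ _ →
        refl , trans (cong (_* w ^ j) e8′) i₁′ ,
        trans (cong₂ _+_ (regs fr₃ 9 _) (cong (λ z → geometricSum w z j) e8′)) i₂′)
      where
      r = reg σ₁ 8
      g = reg σ₁ 9
      i₁′ : r * w * w ^ j ≡ q * w ^ k
      i₁′ = trans (*-assoc r w (w ^ j)) i₁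
      i₂′ : g + r + geometricSum w (r * w) j ≡ geometricSum w q k
      i₂′ = trans (+-assoc g r _) i₂

  Transferred : (σ σ′ : State) (a b s n : ℕ) → Set
  Transferred σ σ′ a b s n =
    (∀ y → y < b → mem σ′ y ≡ mem σ y) ×
    (∀ y → mem σ′ y ≢ 0 ⇔ (mem σ y ≢ 0 ⊎ ∃[ x ] (x < n × y ≡ b + x × mem σ (a + s * x) ≢ 0)))

  -- Every source cell lies below `b`, and nothing below `b` is written, so the scan always reads
  -- original contents. Hence the result can be described by the initial memory alone.
  transfer-exec : ∀ {a b s n} → Small σ → reg σ 1 ≡ 1 →
                  reg σ 15 ≡ a → reg σ 16 ≡ b → reg σ 17 ≡ s → reg σ 18 ≡ n →
                  (∀ x → x < n → a + s * x < b) → a + s * n ≤ M → b + n ≤ M →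
                  Exec transfer σ (n * 7 + 1) (λ σ′ → Transferred σ σ′ a b s n)
  transfer-exec {σ} {a} {b} {s} {n} sm e1 e15 e16 e17 e18 below src≤ dst≤ =
    finish (repeat Inv n sm e18 inv₀ step) λ σ₁ _ _ (_ , _ , t) → t
    where
    Inv : ℕ → State → Set
    Inv i σ₁ = (reg σ₁ 15 ≡ a + s * i × reg σ₁ 16 ≡ b + i × Transferred σ σ₁ a b s i)

    inv₀ : Inv 0 σ
    inv₀ = trans e15 (sym (trans (cong (a +_) (*-zeroʳ s)) (+-identityʳ a))) , trans e16 (sym (+-identityʳ b)) ,
           (λ _ _ → refl) , λ y → mk⇔ inj₁ λ { (inj₁ p) → p ; (inj₂ (_ , () , _)) }

    step : ∀ i j σ₁ → Small σ₁ → Frame transfer-step σ σ₁ → i < n → reg σ₁ 18 ≡ suc j → Inv i σ₁ →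
           Exec transfer-step σ₁ 6 (λ σ₂ → reg σ₂ 18 ≡ j × Inv (suc i) σ₂)
    step i j σ₁ sm₁ fr i<n e18′ (e15′ , e16′ , low , high) =
      seq (loadₑ v sm₁ (trans (cong (mem σ₁) e15′) (low _ (below i i<n))) λ sm₂ →
      bind (ifₑ {n = 1} {Q = Mid} sm₂
              (λ nz → storeₑ (b + i) 1 sm₂ e16′ (trans (regs fr 1 _) e1) λ _ → (λ _ _ → refl) , inj₁ (≢-nonZero⁻¹ v {{nz}} , λ _ → refl))
              (λ v≡0 → skipₑ sm₂ ((λ _ _ → refl) , inj₂ (v≡0 , λ _ → refl)))) λ σ₃ sm₃ fr₃ (rg , md) →
      seq (addₑ (a + s * suc i) sm₃
             (trans (cong₂ _+_ (trans (rg 15 _) e15′) (trans (rg 17 _) (trans (regs fr 17 _) e17)))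
                    (trans (+-assoc a (s * i) s) (cong (a +_) (trans (+-comm (s * i) s) (sym (*-suc s i))))))
             (≤-trans (+-monoʳ-≤ a (*-monoʳ-≤ s i<n)) src≤) λ sm₄ →
      seq (addₑ (b + suc i) sm₄
             (trans (cong₂ _+_ (trans (rg 16 _) e16′) (trans (rg 1 _) (trans (regs fr 1 _) e1)))
                    (trans (+-assoc b i 1) (cong (b +_) (+-comm i 1))))
             (≤-trans (+-monoʳ-≤ b i<n) dst≤) λ sm₅ →
      subₑ j sm₅ (cong₂ _∸_ (trans (rg 18 _) e18′) (trans (rg 1 _) (trans (regs fr 1 _) e1))) λ sm₆ →
      refl , refl , refl , transferred (mem σ₃) md)))
      where
      v = mem σ (a + s * i)
      σ₂ = setReg σ₁ 19 v
      Mid : State → Set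
      Mid σ₃ = (∀ x → T (unwritten skip x) → reg σ₃ x ≡ reg σ₂ x) ×
               ((v ≢ 0 × (∀ y → mem σ₃ y ≡ mem (setMem σ₁ (b + i) 1) y)) ⊎ (v ≡ 0 × (∀ y → mem σ₃ y ≡ mem σ₁ y)))
      Goal : (ℕ → ℕ) → Set
      Goal μ = (∀ y → y < b → μ y ≡ mem σ y) ×
               (∀ y → μ y ≢ 0 ⇔ (mem σ y ≢ 0 ⊎ ∃[ x ] (x < suc i × y ≡ b + x × mem σ (a + s * x) ≢ 0)))
      transferred : ∀ μ → ((v ≢ 0 × (∀ y → μ y ≡ mem (setMem σ₁ (b + i) 1) y)) ⊎ (v ≡ 0 × (∀ y → μ y ≡ mem σ₁ y))) → Goal μ
      transferred μ (inj₁ (v≢0 , eq)) =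
        (λ y y<b → trans (eq y) (trans (update-≢ (mem σ₁) (b + i) 1 (λ e → <⇒≱ y<b (≤-trans (m≤m+n b i) (≤-reflexive (sym e))))) (low y y<b))) ,
        λ y → mk⇔ (to y) (from y)
        where
        to : ∀ y → μ y ≢ 0 → _
        to y μ≢0 with y ≟ b + i
        ... | yes e = inj₂ (i , n<1+n i , e , v≢0)
        ... | no ne with Equivalence.to (high y) (μ≢0 ∘ trans (trans (eq y) (update-≢ (mem σ₁) (b + i) 1 ne)))
        ...   | inj₁ p = inj₁ p
        ...   | inj₂ (x , x<i , p) = inj₂ (x , m<n⇒m<1+n x<i , p)
        from : ∀ y → _ → μ y ≢ 0
        from y p μ≡0 with y ≟ b + i
        ... | yes refl = 1+n≢0 (trans (sym (trans (eq y) (update-≡ (mem σ₁) (b + i) 1))) μ≡0)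
        ... | no ne = Equivalence.from (high y) (old p) (trans (sym (trans (eq y) (update-≢ (mem σ₁) (b + i) 1 ne))) μ≡0)
          where
          old : mem σ y ≢ 0 ⊎ ∃[ x ] (x < suc i × y ≡ b + x × mem σ (a + s * x) ≢ 0) →
                mem σ y ≢ 0 ⊎ ∃[ x ] (x < i × y ≡ b + x × mem σ (a + s * x) ≢ 0)
          old (inj₁ q) = inj₁ q
          old (inj₂ (x , s≤s x≤i , e , q)) = inj₂ (x , ≤∧≢⇒< x≤i (λ x≡i → ne (trans e (cong (b +_) x≡i))) , e , q)
      transferred μ (inj₂ (v≡0 , eq)) =
        (λ y y<b → trans (eq y) (low y y<b)) ,
        λ y → mk⇔ (λ μ≢0 → weak (Equivalence.to (high y) (μ≢0 ∘ trans (eq y))))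
                  (λ p μ≡0 → Equivalence.from (high y) (old p) (trans (sym (eq y)) μ≡0))
        where
        weak : ∀ {y} → mem σ y ≢ 0 ⊎ ∃[ x ] (x < i × y ≡ b + x × mem σ (a + s * x) ≢ 0) →
               mem σ y ≢ 0 ⊎ ∃[ x ] (x < suc i × y ≡ b + x × mem σ (a + s * x) ≢ 0)
        weak (inj₁ p) = inj₁ p
        weak (inj₂ (x , x<i , p)) = inj₂ (x , m<n⇒m<1+n x<i , p)
        old : ∀ {y} → mem σ y ≢ 0 ⊎ ∃[ x ] (x < suc i × y ≡ b + x × mem σ (a + s * x) ≢ 0) →
              mem σ y ≢ 0 ⊎ ∃[ x ] (x < i × y ≡ b + x × mem σ (a + s * x) ≢ 0)
        old (inj₁ q) = inj₁ q
        old (inj₂ (x , s≤s x≤i , e , q)) = inj₂ (x , ≤∧≢⇒< x≤i (λ x≡i → q (trans (cong (λ z → mem σ (a + s * z)) x≡i) v≡0)) , e , q)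

  -- All cells from `a` on are covered, not only `Z` of them: behind a bounded set the memory is
  -- blank.
  Bitmap : State → ℕ → (ℕ → Set) → Set
  Bitmap σ a S = ∀ x → mem σ (a + x) ≢ 0 ⇔ S x

  Agree : ℕ → State → State → Set
  Agree b σ σ′ = ∀ y → y < b → mem σ′ y ≡ mem σ y

  Agree-trans : ∀ {b b′ σ σ₁ σ₂} → b ≤ b′ → Agree b σ σ₁ → Agree b′ σ₁ σ₂ → Agree b σ σ₂
  Agree-trans b≤ f g y y<b = trans (g y (<-≤-trans y<b b≤)) (f y y<b)

  Bitmap-resp : ∀ {σ a S T} → (∀ x → S x ⇔ T x) → Bitmap σ a S → Bitmap σ a T
  Bitmap-resp f bm x = mk⇔ (Equivalence.to (f x) ∘ Equivalence.to (bm x)) (Equivalence.from (bm x) ∘ Equivalence.from (f x))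

  -- The blank cells behind a bitmap are the empty set from which the next one is built.
  Bitmap-∅ : ∀ {σ a S n} → Bitmap σ a S → Below n S → Bitmap σ (a + n) (λ _ → ⊥)
  Bitmap-∅ {σ} {a} {n = n} bm bl y = mk⇔
    (λ ne → <⇒≱ (bl (Equivalence.to (bm (n + y)) (ne ∘ trans (cong (mem σ) (+-assoc a n y))))) (m≤m+n n y)) ⊥-elim

  Bitmap-agree : ∀ {σ σ′ a b S} → Agree b σ σ′ → Bitmap σ a S → ∀ x → a + x < b → mem σ′ (a + x) ≢ 0 ⇔ S x
  Bitmap-agree ag bm x a+x<b = mk⇔ (λ ne → Equivalence.to (bm x) (ne ∘ trans (ag _ a+x<b)))
                                   (λ s e → Equivalence.from (bm x) s (trans (sym (ag _ a+x<b)) e))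

  transferred-set : ∀ {σ σ′ a d g s n S T} → Transferred σ σ′ a (d + g) s n →
                    (∀ x → x < n → mem σ (a + s * x) ≢ 0 ⇔ S x) → Bitmap σ d T →
                    Bitmap σ′ d (Added T S n g)
  transferred-set {σ} {σ′} {a} {d} {g} {s} {n} {S} {T} (low , high) src bm y = mk⇔ to from
    where
    shift : ∀ x → d + g + x ≡ d + (x + g)
    shift x = trans (+-assoc d g x) (cong (d +_) (+-comm g x))
    to : mem σ′ (d + y) ≢ 0 → Added T S n g y
    to ne with Equivalence.to (high (d + y)) ne
    ... | inj₁ p = inj₁ (Equivalence.to (bm y) p)
    ... | inj₂ (x , x<n , e , p) = inj₂ (x , x<n , Equivalence.to (src x x<n) p , +-cancelˡ-≡ d y (x + g) (trans e (shift x)))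
    from : Added T S n g y → mem σ′ (d + y) ≢ 0
    from (inj₁ t) = Equivalence.from (high (d + y)) (inj₁ (Equivalence.from (bm y) t))
    from (inj₂ (x , x<n , s , e)) = Equivalence.from (high (d + y))
      (inj₂ (x , x<n , trans (cong (d +_) e) (sym (shift x)) , Equivalence.from (src x x<n) s))

  -- Execution of a level as a transformation of sets

  module Machine (m W N D base : ℕ) .{{W≢0 : NonZero W}} where

    open Codes m W D

    -- Indexed by the contents of the registers, so that the type does not change
    -- when another register is set.

    record Constants (r1 r2 r5 r11 r12 r13 r14 r20 r40 r42 r46 r47 : ℕ) : Set where
      constructor mkConsts
      field
        e1  : r1 ≡ 1
        e2  : r2 ≡ m
        e5  : r5 ≡ W
        e11 : r11 ≡ N
        e12 : r12 ≡ X
        e13 : r13 ≡ U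
        e14 : r14 ≡ Z
        e20 : r20 ≡ base
        e40 : r40 ≡ 0
        e42 : r42 ≡ 2
        e46 : r46 ≡ suc D
        e47 : r47 ≡ E

    open Constants public

    Consts : State → Set
    Consts σ = Constants (reg σ 1) (reg σ 2) (reg σ 5) (reg σ 11) (reg σ 12) (reg σ 13) (reg σ 14) (reg σ 20) (reg σ 40) (reg σ 42) (reg σ 46) (reg σ 47)

    preserving : Program → Bool
    preserving P = unwritten P 1 ∧ unwritten P 2 ∧ unwritten P 5 ∧ unwritten P 11 ∧ unwritten P 12 ∧
                   unwritten P 13 ∧ unwritten P 14 ∧ unwritten P 20 ∧ unwritten P 40 ∧ unwritten P 42 ∧
                   unwritten P 46 ∧ unwritten P 47

    -- For a concrete `P` the implicit `T (preserving P)` computes to the unit type and is filled in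
    -- silently.
    keepConsts : ∀ P {σ σ′} → {T (preserving P)} → Frame P σ σ′ → Consts σ → Consts σ′
    keepConsts P {σ} {σ′} {t} fr (mkConsts a b c d e f g h i j l o) with unwritten P 1 in u1 | unwritten P 2 in u2 | unwritten P 5 in u5
      | unwritten P 11 in u11 | unwritten P 12 in u12 | unwritten P 13 in u13 | unwritten P 14 in u14 | unwritten P 20 in u20
      | unwritten P 40 in u40 | unwritten P 42 in u42 | unwritten P 46 in u46 | unwritten P 47 in u47
    ... | true | true | true | true | true | true | true | true | true | true | true | true =
      mkConsts (k u1 a) (k u2 b) (k u5 c) (k u11 d) (k u12 e) (k u13 f) (k u14 g) (k u20 h) (k u40 i) (k u42 j) (k u46 l) (k u47 o)
      where
      k : ∀ {x v} → unwritten P x ≡ true → reg σ x ≡ v → reg σ′ x ≡ v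
      k u eq = trans (regs fr _ (subst T (sym u) tt)) eq

    pushCost scoreCost candidateCost : ℕ
    pushCost  = 5 + (Z * 7 + 1)
    scoreCost = 1 + (pushCost + (1 + ((W * 3 + 4) + 1)))
    candidateCost = 3 + ((m * suc scoreCost + 1) + (1 + (1 + ((W * 3 + 4) + 2))))

    -- `S` is required only up to `cur + Z`: from there on lies the bitmap under construction, so
    -- `Bitmap` at `cur` need not survive the first push.
    push-exec : ∀ {σ cur g S T} → Small σ → Consts σ → reg σ 28 ≡ cur → reg σ 43 ≡ g →
                (∀ x → cur + x < cur + Z → mem σ (cur + x) ≢ 0 ⇔ S x) → Bitmap σ (cur + Z) T → cur + Z + g + Z ≤ M →
                Exec push σ pushCost (λ σ′ → Agree (cur + Z) σ σ′ × Bitmap σ′ (cur + Z) (Added T S Z g))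
    push-exec {σ} {cur} {g} {S} {T} sm c e28 e43 src bm top≤ =
      seq (addₑ cur sm (trans (+0 (e40 c)) e28) (≤-trans (m≤m+n cur Z) d≤) λ sm₁ →
      seq (addₑ (cur + Z) sm₁ (cong₂ _+_ e28 (e14 c)) d≤ λ sm₂ →
      seq (addₑ (cur + Z + g) sm₂ (cong (cur + Z +_) e43) (≤-trans (m≤m+n _ Z) top≤) λ sm₃ →
      seq (addₑ 1 sm₃ (trans (+0 (e40 c)) (e1 c)) (1≤-small (e1 c) sm) λ sm₄ →
      seq (addₑ Z sm₄ (trans (+0 (e40 c)) (e14 c)) (≤-trans (m≤n+m Z cur) d≤) λ sm₅ →
      finish (transfer-exec sm₅ (e1 c) refl refl refl refl
               (λ x x<Z → <-≤-trans (+-monoʳ-< cur (subst (_< Z) (sym (*-identityˡ x)) x<Z)) (m≤m+n _ g))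
               (≤-trans (+-monoʳ-≤ cur (≤-reflexive (*-identityˡ Z))) d≤) top≤)
        λ σ₆ _ _ t → (λ y y< → proj₁ t y (<-≤-trans y< (m≤m+n _ g))) ,
          transferred-set {σ} {σ₆} {cur} {cur + Z} {g} {1} {Z} {S} {T} t
            (λ x x<Z → subst (λ z → mem σ (cur + z) ≢ 0 ⇔ S x) (sym (*-identityˡ x)) (src x (+-monoʳ-< cur x<Z))) bm)))))
      where
      d≤ : cur + Z ≤ M
      d≤ = ≤-trans (m≤m+n (cur + Z) g) (≤-trans (m≤m+n _ Z) top≤)

    1≤X : 1 ≤ X
    1≤X = m^n>0 W (suc m)

    X≤Z : X ≤ Z
    X≤Z = m≤m*n X X {{>-nonZero 1≤X}}

    -- Both summands of a shift are at most `Z`, so the scans end by `cur + Z + (Z + Z) + Z`, which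
    -- is the `4 * Z` of the hypothesis.
    candidate-exec : ∀ {σ cur w k S} → Small σ → Consts σ → reg σ 28 ≡ cur → reg σ 31 ≡ w → reg σ 26 ≡ suc k →
                     Bitmap σ cur S → Below Z S → m * w ≤ X → w * W ≤ M → cur + 4 * Z ≤ M →
                     Exec candidate-step σ candidateCost (λ σ′ →
                       reg σ′ 26 ≡ k × reg σ′ 28 ≡ cur + Z × reg σ′ 31 ≡ w * W × Agree (cur + Z) σ σ′ ×
                       Bitmap σ′ (cur + Z) (Scored S w m))
    candidate-exec {σ} {cur} {w} {k} {S} sm c e28 e31 e26 bm bl mw≤ wW≤ top≤ =
      seq (constₑ 0 sm z≤n λ sm₁ →
      seq (addₑ X sm₁ (trans (+0 (e40 c)) (e12 c)) X≤M λ sm₂ →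
      seq (addₑ m sm₂ (trans (+0 (e40 c)) (e2 c)) (subst (_≤ M) (e2 c) (regs≤ sm 2)) λ sm₃ →
      bind (repeat Inv m sm₃ refl
             (refl , sym (*-identityʳ X) , (λ _ _ → refl) ,
              Bitmap-resp {σ} {cur + Z} (λ y → mk⇔ ⊥-elim λ { (_ , _ , () , _) }) (Bitmap-∅ {σ} {cur} bm bl)) step)
        λ { σ₄ sm₄ fr (_ , _ , ag , bm′) →
          let c₄ = keepConsts (whileNonZero 27 score-step) fr c in
      seq (addₑ (cur + Z) sm₄ (cong₂ _+_ (trans (regs fr 28 _) e28) (e14 c₄)) cur+Z≤M λ sm₅ →
      seq (addₑ w sm₅ (trans (+0 (e40 c₄)) (trans (regs fr 31 _) e31)) (subst (_≤ M) e31 (regs≤ sm 31)) λ sm₆ →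
      bind (times-W-exec sm₆ (e1 c₄) (e40 c₄) (e5 c₄) refl wW≤) λ σ₇ sm₇ fr₇ e8 →
      seq (addₑ (w * W) sm₇ (trans (+0 (trans (regs fr₇ 40 _) (e40 c₄))) e8) wW≤ λ sm₈ →
      subₑ k sm₈ (cong₂ _∸_ (trans (regs fr₇ 26 _) (trans (regs fr 26 _) e26)) (trans (regs fr₇ 1 _) (e1 c₄))) λ sm₉ →
      refl , regs fr₇ 28 _ , refl ,
      (λ y y< → trans (cong (λ μ → μ y) (memory fr₇ _)) (ag y y<)) ,
      λ x → subst (λ μ → μ (cur + Z + x) ≢ 0 ⇔ Scored S w m x) (sym (memory fr₇ _)) (bm′ x)))) })))
      where
      σ₃ = setReg (setReg (setReg σ 33 0) 8 X) 27 m
      cur+Z≤M : cur + Z ≤ M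
      cur+Z≤M = ≤-trans (+-monoʳ-≤ cur (m≤m+n Z (3 * Z))) top≤
      Z≤M : Z ≤ M
      Z≤M = ≤-trans (m≤n+m Z cur) cur+Z≤M
      X≤M : X ≤ M
      X≤M = ≤-trans X≤Z Z≤M
      Inv : ℕ → State → Set
      Inv i σ₁ = (reg σ₁ 33 ≡ i * w × reg σ₁ 8 ≡ X * W ^ i × Agree (cur + Z) σ σ₁ ×
                        Bitmap σ₁ (cur + Z) (Scored S w i))
      step : ∀ i j σ₁ → Small σ₁ → Frame score-step σ₃ σ₁ → i < m → reg σ₁ 27 ≡ suc j → Inv i σ₁ →
             Exec score-step σ₁ scoreCost (λ σ₂ → reg σ₂ 27 ≡ j × Inv (suc i) σ₂)
      step i j σ₁ sm₁ fr i<m e27 (e33 , e8 , ag , bm₁) =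
        seq (addₑ (i * w + X * W ^ i) sm₁ (cong₂ _+_ e33 e8) g≤M λ sm₂ →
        bind (push-exec {S = S} {T = Scored S w i} sm₂ c₁ (trans (regs fr 28 _) e28) refl
               (Bitmap-agree {σ} {σ₁} {cur} ag bm) bm₁ top′)
          λ σ₃ sm₃ fr₃ (ag₃ , bm₃) →
        seq (addₑ (i * w + w) sm₃ (cong₂ _+_ (trans (regs fr₃ 33 _) e33) (trans (regs fr₃ 31 _) (trans (regs fr 31 _) e31)))
              (≤-trans (≤-reflexive (+-comm (i * w) w)) (≤-trans (*-monoˡ-≤ w i<m) (≤-trans mw≤ X≤M))) λ sm₄ →
        bind (times-W-exec sm₄ (trans (regs fr₃ 1 _) (e1 c₁)) (trans (regs fr₃ 40 _) (e40 c₁)) (trans (regs fr₃ 5 _) (e5 c₁))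
               (trans (regs fr₃ 8 _) e8) (≤-trans XWW≤Z Z≤M)) λ σ₅ sm₅ fr₅ e8′ →
        subₑ j sm₅ (cong₂ _∸_ (trans (regs fr₅ 27 _) (trans (regs fr₃ 27 _) e27)) (trans (regs fr₅ 1 _) (trans (regs fr₃ 1 _) (e1 c₁)))) λ sm₆ →
        refl , trans (regs fr₅ 33 _) (+-comm (i * w) w) ,
        trans e8′ (trans (*-assoc X (W ^ i) W) (cong (X *_) (*-comm (W ^ i) W))) ,
        (λ y y< → trans (cong (λ μ → μ y) (memory fr₅ _)) (trans (ag₃ y y<) (ag y y<))) ,
        λ y → subst (λ μ → μ (cur + Z + y) ≢ 0 ⇔ Scored S w (suc i) y) (sym (memory fr₅ _))
                (Bitmap-resp {σ₃} {cur + Z} (Shifted-suc bl) bm₃ y)))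
        where
        c₁ : Consts σ₁
        c₁ = keepConsts score-step fr c
        XWW≤Z : X * W ^ i * W ≤ Z
        XWW≤Z = ≤-trans (≤-reflexive (trans (*-assoc X (W ^ i) W) (cong (X *_) (*-comm (W ^ i) W))))
                        (*-monoʳ-≤ X (^-monoʳ-≤ W (≤-trans i<m (n≤1+n m))))
        g≤ : i * w + X * W ^ i ≤ Z + Z
        g≤ = +-mono-≤ (≤-trans (≤-trans (*-monoˡ-≤ w (<⇒≤ i<m)) mw≤) X≤Z)
                      (≤-trans (m≤m*n (X * W ^ i) W) XWW≤Z)
        top′ : cur + Z + (i * w + X * W ^ i) + Z ≤ M
        top′ = ≤-trans (+-monoˡ-≤ Z (+-monoʳ-≤ (cur + Z) g≤))
                 (≤-trans (≤-reflexive (solve 2 (λ c z → c :+ z :+ (z :+ z) :+ z := c :+ con 4 :* z) refl cur Z)) top≤)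
          where open +-*-Solver
        g≤M : i * w + X * W ^ i ≤ M
        g≤M = ≤-trans (≤-trans (m≤n+m _ (cur + Z)) (m≤m+n _ Z)) top′

    voteCost : ℕ
    voteCost = 3 + ((m * suc candidateCost + 1) + ((5 + (X * 7 + 1)) + ((4 + (X * 7 + 1)) + 2)))

    -- The candidates write only from `cur + Z` on, so the bitmap of `S` is still intact when `keep`
    -- returns to it.
    vote-exec : ∀ {σ cur k S} → 2 ≤ W → m ≤ W → Small σ → Consts σ → reg σ 28 ≡ cur → reg σ 35 ≡ suc k →
                Bitmap σ cur S → (∀ i → i ≤ m → Below Z (Stage S i)) → cur + (m + 4) * Z ≤ M →
                Exec vote-step σ voteCost (λ σ′ →
                  reg σ′ 35 ≡ k × reg σ′ 28 ≡ cur + suc m * Z × Agree (cur + Z) σ σ′ ×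
                  Bitmap σ′ (cur + suc m * Z) (Voted S))
    vote-exec {σ} {cur} {k} {S} 2≤W m≤W sm c e28 e35 bm bl top≤ =
      seq (addₑ cur sm (trans (+0 (e40 c)) e28) cur≤M λ sm₁ →
      seq (addₑ W sm₁ (trans (+0 (e40 c)) (e5 c)) (subst (_≤ M) (e5 c) (regs≤ sm 5)) λ sm₂ →
      seq (addₑ m sm₂ (trans (+0 (e40 c)) (e2 c)) (subst (_≤ M) (e2 c) (regs≤ sm 2)) λ sm₃ →
      bind (repeat Inv m sm₃ refl
              (trans e28 (sym (+-identityʳ cur)) , sym (*-identityʳ W) , (λ _ _ → refl) ,
               subst (λ a → Bitmap σ a S) (sym (+-identityʳ cur)) bm) step)
        λ { σ₄ sm₄ fr (e28′ , _ , ag , bm′) → afterwards σ₄ sm₄ fr e28′ ag bm′ })))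
      where
      σ₃ = setReg (setReg (setReg σ 30 cur) 31 W) 26 m
      cur≤M : cur ≤ M
      cur≤M = ≤-trans (m≤m+n cur _) top≤
      Inv : ℕ → State → Set
      Inv i σ₁ = (reg σ₁ 28 ≡ cur + i * Z × reg σ₁ 31 ≡ W ^ suc i × Agree (cur + Z) σ σ₁ ×
                        Bitmap σ₁ (cur + i * Z) (Stage S i))
      step : ∀ i j σ₁ → Small σ₁ → Frame candidate-step σ₃ σ₁ → i < m → reg σ₁ 26 ≡ suc j → Inv i σ₁ →
             Exec candidate-step σ₁ candidateCost (λ σ₂ → reg σ₂ 26 ≡ j × Inv (suc i) σ₂)
      step i j σ₁ sm₁ fr i<m e26 (e28′ , e31 , ag , bm₁) =
        finish (candidate-exec {S = Stage S i} sm₁ (keepConsts candidate-step fr c) e28′ e31 e26 bm₁ (bl i (<⇒≤ i<m))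
                 (*-mono-≤ m≤W (^-monoʳ-≤ W i<m))
                 (≤-trans (≤-reflexive (*-comm (W ^ suc i) W)) (≤-trans (^-monoʳ-≤ W (s≤s i<m)) X≤M))
                 (≤-trans (≤-reflexive (solve 3 (λ c i z → c :+ i :* z :+ con 4 :* z := c :+ (i :+ con 4) :* z) refl cur i Z))
                          (≤-trans (+-monoʳ-≤ cur (*-monoˡ-≤ Z (+-monoˡ-≤ 4 (<⇒≤ i<m)))) top≤)))
          λ { σ₂ _ _ (e26′ , e28″ , e31′ , ag′ , bm₂) →
            e26′ , trans e28″ next , trans e31′ (*-comm (W ^ suc i) W) ,
            Agree-trans {cur + Z} {cur + i * Z + Z} {σ} {σ₁} {σ₂} (+-monoˡ-≤ Z (m≤m+n cur (i * Z))) ag ag′ ,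
            subst (λ a → Bitmap σ₂ a (Stage S (suc i))) next bm₂ }
        where
        open +-*-Solver
        next : cur + i * Z + Z ≡ cur + suc i * Z
        next = solve 3 (λ c i z → c :+ i :* z :+ z := c :+ (con 1 :+ i) :* z) refl cur i Z
        X≤M : X ≤ M
        X≤M = ≤-trans X≤Z (≤-trans (≤-trans (m≤m*n Z (m + 4) {{>-nonZero (≤-trans (s≤s z≤n) (m≤n+m 4 m))}})
                (≤-reflexive (*-comm Z (m + 4)))) (≤-trans (m≤n+m _ cur) top≤))
      afterwards : ∀ σ₄ → Small σ₄ → Frame (whileNonZero 26 candidate-step) σ₃ σ₄ →
                   reg σ₄ 28 ≡ cur + m * Z → Agree (cur + Z) σ σ₄ → Bitmap σ₄ (cur + m * Z) (Stage S m) →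
                   Exec (select ⨾ keep ⨾ add 28 28 14 ⨾ sub 35 35 1) σ₄ ((5 + (X * 7 + 1)) + ((4 + (X * 7 + 1)) + 2))
                     (λ σ′ → reg σ′ 35 ≡ k × reg σ′ 28 ≡ cur + suc m * Z × Agree (cur + Z) σ σ′ ×
                             Bitmap σ′ (cur + suc m * Z) (Voted S))
      afterwards σ₄ sm₄ fr e28′ ag bm₄ =
        bind selecting λ { σ₅ sm₅ fr₅ (ag₅ , bm₅) →
        bind (keeping σ₅ sm₅ fr₅ ag₅ bm₅) λ { σ₆ sm₆ fr₆ (ag₆ , bm₆) →
        seq (addₑ (cur + suc m * Z) sm₆
               (trans (cong₂ _+_ (trans (regs fr₆ 28 _) (trans (regs fr₅ 28 _) e28′)) (e14 (keepConsts keep fr₆ (keepConsts select fr₅ c₄)))) next)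
               (≤-trans (≤-reflexive (sym next)) (≤-trans (m≤m+n _ Z) d≤)) λ sm₇ →
        subₑ k sm₇ (cong₂ _∸_ (trans (regs fr₆ 35 _) (trans (regs fr₅ 35 _) (trans (regs fr 35 _) e35)))
                              (e1 (keepConsts keep fr₆ (keepConsts select fr₅ c₄)))) λ sm₈ →
        refl , refl ,
        (λ y y< → trans (ag₆ y (<-≤-trans y< low≤)) (trans (ag₅ y (<-≤-trans y< low≤)) (ag y y<))) ,
        subst (λ a → Bitmap σ₆ a (Voted S)) next bm₆) } }
        where
        open +-*-Solver
        a = cur + m * Z
        c₄ : Consts σ₄
        c₄ = keepConsts (whileNonZero 26 candidate-step) fr c
        next : a + Z ≡ cur + suc m * Z
        next = solve 3 (λ c i z → c :+ i :* z :+ z := c :+ (con 1 :+ i) :* z) refl cur m Z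
        U+X≤Z : U + X ≤ Z
        U+X≤Z = ≤-trans (geometricSum-bound W X m 2≤W) (*-monoʳ-≤ X (^-monoʳ-≤ W (n≤1+n m)))
        low≤ : cur + Z ≤ a + Z
        low≤ = +-monoˡ-≤ Z (m≤m+n cur (m * Z))
        top′ : a + Z + Z + Z + Z ≤ M
        top′ = ≤-trans (≤-reflexive (solve 3 (λ c i z → c :+ i :* z :+ z :+ z :+ z :+ z := c :+ (i :+ con 4) :* z) refl cur m Z)) top≤
        d≤ : a + Z + Z ≤ M
        d≤ = ≤-trans (≤-trans (m≤m+n _ Z) (m≤m+n _ Z)) top′
        X≤M : X ≤ M
        X≤M = ≤-trans X≤Z (≤-trans (m≤n+m Z _) top′)
        1≤Z : 1 ≤ Z
        1≤Z = ≤-trans 1≤X X≤Z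
        dst≤ : a + Z + 1 + X ≤ M
        dst≤ = ≤-trans (+-mono-≤ (+-monoʳ-≤ (a + Z) 1≤Z) X≤Z) (≤-trans (m≤m+n _ Z) top′)
        1≤M : 1 ≤ M
        1≤M = 1≤-small (e1 c) sm
        selecting : Exec select σ₄ (5 + (X * 7 + 1)) (λ σ₅ → Agree (a + Z) σ₄ σ₅ ×
                      Bitmap σ₅ (a + Z) (Added (λ _ → ⊥) (λ x → Stage S m (U + x)) X 1))
        selecting =
          seq (addₑ (a + U) sm₄ (cong₂ _+_ e28′ (e13 c₄))
                 (≤-trans (+-monoʳ-≤ a (≤-trans (m≤m+n U X) U+X≤Z)) (≤-trans (m≤m+n _ Z) d≤)) λ sm₅ →
          seq (addₑ (a + Z) sm₅ (cong₂ _+_ e28′ (e14 c₄)) (≤-trans (m≤m+n _ Z) d≤) λ sm₆ →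
          seq (addₑ (a + Z + 1) sm₆ (cong (a + Z +_) (e1 c₄)) (≤-trans (m≤m+n _ X) dst≤) λ sm₇ →
          seq (addₑ 1 sm₇ (trans (+0 (e40 c₄)) (e1 c₄)) 1≤M λ sm₈ →
          seq (addₑ X sm₈ (trans (+0 (e40 c₄)) (e12 c₄)) X≤M λ sm₉ →
          finish (transfer-exec sm₉ (e1 c₄) refl refl refl refl
                    (λ x x<X → <-≤-trans (+-monoʳ-< (a + U) (subst (_< X) (sym (*-identityˡ x)) x<X)) srcs≤)
                    (≤-trans (+-monoʳ-≤ (a + U) (≤-reflexive (*-identityˡ X))) (≤-trans srcs≤ (≤-trans (m≤m+n _ X) dst≤))) dst≤)
            λ σ₅ _ _ t → (λ y y< → proj₁ t y (<-≤-trans y< (m≤m+n _ 1))) ,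
              transferred-set {σ₄} {σ₅} {a + U} {a + Z} {1} {1} {X} {λ x → Stage S m (U + x)} {λ _ → ⊥} t
                (λ x x<X → subst (λ z → mem σ₄ z ≢ 0 ⇔ Stage S m (U + x))
                             (trans (sym (+-assoc a U x)) (cong (a + U +_) (sym (*-identityˡ x)))) (bm₄ (U + x)))
                (Bitmap-∅ {σ₄} {a} bm₄ (bl m ≤-refl)))))))
          where
          srcs≤ : a + U + X ≤ a + Z + 1
          srcs≤ = ≤-trans (≤-reflexive (+-assoc a U X)) (≤-trans (+-monoʳ-≤ a U+X≤Z) (m≤m+n _ 1))
        keeping : ∀ σ₅ → Small σ₅ → Frame select σ₄ σ₅ → Agree (a + Z) σ₄ σ₅ →
                  Bitmap σ₅ (a + Z) (Added (λ _ → ⊥) (λ x → Stage S m (U + x)) X 1) →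
                  Exec keep σ₅ (4 + (X * 7 + 1)) (λ σ₆ → Agree (a + Z) σ₅ σ₆ × Bitmap σ₆ (a + Z) (Voted S))
        keeping σ₅ sm₅ fr₅ ag₅ bm₅ =
          seq (addₑ cur sm₅ (trans (+0 (e40 c₅)) (trans (regs fr₅ 30 _) (regs fr 30 _))) cur≤M λ sm₆ →
          seq (addₑ (a + Z) sm₆ (cong₂ _+_ (trans (regs fr₅ 28 _) e28′) (e14 c₅)) (≤-trans (m≤m+n _ Z) d≤) λ sm₇ →
          seq (addₑ 1 sm₇ (trans (+0 (e40 c₅)) (e1 c₅)) 1≤M λ sm₈ →
          seq (addₑ X sm₈ (trans (+0 (e40 c₅)) (e12 c₅)) X≤M λ sm₉ →
          -- The summand 0 gives the destination the shape `d + g` of `transferred-set`, with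
          -- `g = 0`.
          finish (transfer-exec {b = a + Z + 0} sm₉ (e1 c₅) refl (sym (+-identityʳ (a + Z))) refl refl
                    (λ x x<X → <-≤-trans (inside x x<X) (≤-trans low≤ (m≤m+n _ 0)))
                    (≤-trans (+-mono-≤ (m≤m+n cur (m * Z)) (≤-trans (≤-reflexive (*-identityˡ X)) X≤Z)) (≤-trans (m≤m+n _ Z) d≤))
                    (≤-trans (+-monoˡ-≤ X (+-monoʳ-≤ (a + Z) z≤n)) dst≤))
            λ σ₆ _ _ t → (λ y y< → proj₁ t y (<-≤-trans y< (m≤m+n _ 0))) ,
              transferred-set {σ₅} {σ₆} {cur} {a + Z} {0} {1} {X} {S} {Added (λ _ → ⊥) (λ x → Stage S m (U + x)) X 1} t
                (λ x x<X → subst (λ z → mem σ₅ (cur + z) ≢ 0 ⇔ S x) (sym (*-identityˡ x))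
                  (Bitmap-agree {σ} {σ₅} {cur} (λ y y< → trans (ag₅ y (<-≤-trans y< low≤)) (ag y y<)) bm x
                    (subst (λ z → cur + z < cur + Z) (*-identityˡ x) (inside x x<X)))) bm₅))))
          where
          c₅ = keepConsts select fr₅ c₄
          inside : ∀ x → x < X → cur + 1 * x < cur + Z
          inside x x<X = +-monoʳ-< cur (subst (_< Z) (sym (*-identityˡ x)) (<-≤-trans x<X X≤Z))

    halveCost : ℕ → ℕ
    halveCost H = 3 + ((H * 4 + 1) + (2 + 2))

    div-mod-2 : ∀ q f → f ≤ 1 → (f + q * 2) % 2 ≡ f × (f + q * 2) / 2 ≡ q
    div-mod-2 q f f≤1 = trans ([m+kn]%n≡m%n f q 2) (m<n⇒m%n≡m (s≤s f≤1)) ,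
      trans (+-distrib-/-∣ʳ f (divides q refl)) (trans (cong₂ _+_ (m<n⇒m/n≡0 (s≤s f≤1)) (m*n/n≡m q 2)) refl)

    Halved : State → State → ℕ → ℕ → Set
    Halved σ σ′ a b = (∀ y → y ≢ a → mem σ′ y ≡ mem σ y) × mem σ′ a ≡ b / 2

    -- The target is counted down while a flag `f` flips; the quotient `q` grows whenever the flag
    -- falls. Throughout, `f + q * 2` and the rest of the count add up to `b`.
    halve-exec : ∀ {σ a b w e H} → Small σ → Consts σ → reg σ 25 ≡ a → mem σ a ≡ b → reg σ 31 ≡ w → reg σ 44 ≡ e → b ≤ H →
                 Exec halve σ (halveCost H) (λ σ′ → reg σ′ 43 ≡ e ∸ b % 2 * w × Halved σ σ′ a b)
    halve-exec {σ} {a} {b} {w} {e} {H} sm cs e25 ea e31 e44 b≤H =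
      weaken (+-monoʳ-≤ 3 (+-monoˡ-≤ 4 (+-monoˡ-≤ 1 (*-monoˡ-≤ 4 b≤H)))) (
      seq (constₑ 0 sm z≤n λ sm₁ →
      seq (constₑ 0 sm₁ z≤n λ sm₂ →
      seq (loadₑ b sm₂ (trans (cong (mem σ) e25) ea) λ sm₃ →
      bind (for Inv b sm₃ refl (0 , 0 , z≤n , refl , refl , refl) step)
        λ { σ₄ sm₄ fr (q , f , f≤1 , e38 , e37 , eq) → afterwards σ₄ sm₄ fr q f f≤1 e38 e37 (trans (sym (+-identityʳ _)) eq) }))))
      where
      σ₃ = setReg (setReg (setReg σ 38 0) 37 0) 39 b
      body = add 38 38 37 ⨾ sub 37 1 37 ⨾ sub 39 39 1
      b≤M : b ≤ M
      b≤M = subst (_≤ M) ea (mem≤ sm a)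
      Inv : ℕ → State → Set
      Inv j σ₁ = ∃[ q ] ∃[ f ] (f ≤ 1 × reg σ₁ 38 ≡ q × reg σ₁ 37 ≡ f × f + q * 2 + j ≡ b)
      step : ∀ j σ₁ → Small σ₁ → Frame body σ₃ σ₁ → j < b → reg σ₁ 39 ≡ suc j → Inv (suc j) σ₁ →
             Exec body σ₁ 3 (λ σ₂ → reg σ₂ 39 ≡ j × Inv j σ₂)
      step j σ₁ sm₁ fr _ e39 (q , f , f≤1 , e38 , e37 , e) =
        seq (addₑ (q + f) sm₁ (cong₂ _+_ e38 e37) (≤-trans q+f≤ b≤M) λ sm₂ →
        seq (subₑ (1 ∸ f) sm₂ (cong₂ _∸_ (trans (regs fr 1 _) (e1 cs)) e37) λ sm₃ →
        subₑ j sm₃ (cong₂ _∸_ e39 (trans (regs fr 1 _) (e1 cs))) λ sm₄ →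
        refl , q + f , 1 ∸ f , m∸n≤m 1 f , refl , refl , flip f f≤1 e))
        where
        q+f≤ : q + f ≤ b
        q+f≤ = ≤-trans (≤-reflexive (+-comm q f)) (≤-trans (+-monoʳ-≤ f (m≤m*n q 2)) (≤-trans (m≤m+n (f + q * 2) (suc j)) (≤-reflexive e)))
        flip : ∀ f → f ≤ 1 → f + q * 2 + suc j ≡ b → 1 ∸ f + (q + f) * 2 + j ≡ b
        flip zero _ e = trans (solve 2 (λ q j → con 1 :+ (q :+ con 0) :* con 2 :+ j := q :* con 2 :+ (con 1 :+ j)) refl q j) e
          where open +-*-Solver
        flip (suc zero) _ e = trans (solve 2 (λ q j → (q :+ con 1) :* con 2 :+ j := con 1 :+ q :* con 2 :+ (con 1 :+ j)) refl q j) e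
          where open +-*-Solver
        flip (suc (suc _)) (s≤s ()) _
      afterwards : ∀ σ₄ → Small σ₄ → Frame (whileNonZero 39 body) σ₃ σ₄ → ∀ q f → f ≤ 1 →
                   reg σ₄ 38 ≡ q → reg σ₄ 37 ≡ f → f + q * 2 ≡ b →
                   Exec (store 25 38 ⨾ add 43 44 40 ⨾ ifNonZero 37 (sub 43 43 31) skip) σ₄ 4
                     (λ σ′ → reg σ′ 43 ≡ e ∸ b % 2 * w × Halved σ σ′ a b)
      afterwards σ₄ sm₄ fr q f f≤1 e38 e37 refl =
        seq (storeₑ a q sm₄ (trans (regs fr 25 _) e25) e38 λ sm₅ →
        seq (addₑ e sm₅ (trans (+0 (trans (regs fr 40 _) (e40 cs))) e44′) (subst (_≤ M) e44′ (regs≤ sm₄ 44)) λ sm₆ →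
        ifₑ sm₆
          (λ nz → subₑ (e ∸ (f + q * 2) % 2 * w) sm₆ (cong (e ∸_) (trans e31′ (sym (one nz)))) λ _ → refl , halved)
          (λ z → skipₑ sm₆ (sym (cong (λ z → e ∸ z * w) (trans (proj₁ (div-mod-2 q f f≤1)) (trans (sym e37) z))) , halved))))
        where
        e44′ : reg σ₄ 44 ≡ e
        e44′ = trans (regs fr 44 _) e44
        e31′ : reg σ₄ 31 ≡ w
        e31′ = trans (regs fr 31 _) e31
        one : NonZero (reg σ₄ 37) → (f + q * 2) % 2 * w ≡ w
        one nz = trans (cong (_* w) (trans (proj₁ (div-mod-2 q f f≤1)) (≤-antisym f≤1 (subst (1 ≤_) e37 (>-nonZero⁻¹ _ {{nz}}))))) (*-identityˡ w)
        halved : Halved σ (setMem σ₄ a q) a (f + q * 2)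
        halved = (λ y ne → trans (update-≢ (mem σ₄) a q ne) (cong (λ μ → μ y) (memory fr _))) ,
                 trans (update-≡ (mem σ₄) a q) (sym (proj₂ (div-mod-2 q f f≤1)))

    carryCost : ℕ → ℕ
    carryCost H = halveCost H + (1 + ((suc D * suc (pushCost + 2) + 1) + 2))

    -- The two size hypotheses on `w` keep every shift within `Z + Z`: the first part is at most
    -- `E * w`, and the multiples of `X * w ∸ 2 * w` are at most `suc D * (X * w)`.
    carry-exec : ∀ {σ cur w c a b S H} → Small σ → Consts σ → reg σ 28 ≡ cur → reg σ 31 ≡ w →
                 reg σ 44 ≡ E * w → reg σ 45 ≡ X * w ∸ 2 * w → reg σ 25 ≡ a → reg σ 36 ≡ c → mem σ a ≡ b → b ≤ H → a < cur →
                 Bitmap σ cur S → Below Z S → E * w ≤ X → suc D * (X * w) ≤ Z → c + E * w ≤ M → cur + 4 * Z ≤ M →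
                 Exec carry-step σ (carryCost H) (λ σ′ →
                   reg σ′ 28 ≡ cur + Z × reg σ′ 36 ≡ c + E * w ×
                   (∀ y → y < cur + Z → y ≢ a → mem σ′ y ≡ mem σ y) × mem σ′ a ≡ b / 2 ×
                   Bitmap σ′ (cur + Z) (Carried S w (b % 2) (suc D)))
    carry-exec {σ} {cur} {w} {c} {a} {b} {S} {H} sm cs e28 e31 e44 e45 e25 e36 eb b≤H a<cur bm bl Ew≤ DXw≤ c≤ top≤ =
      bind (halve-exec {b = b} {w = w} {E * w} {H} sm cs e25 eb e31 e44 b≤H) λ { σ₁ sm₁ fr₁ (e43 , same , half) →
      let c₁ = keepConsts halve fr₁ cs
          cell : ∀ y → mem σ₁ (cur + y) ≡ mem σ (cur + y)
          cell = λ y → same (cur + y) (λ e → <⇒≱ a<cur (≤-trans (m≤m+n cur y) (≤-reflexive e)))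
          bm₁ : Bitmap σ₁ cur S
          bm₁ = λ x → subst (λ v → v ≢ 0 ⇔ S x) (sym (cell x)) (bm x) in
      seq (addₑ (suc D) sm₁ (trans (+0 (e40 c₁)) (e46 c₁)) (subst (_≤ M) (e46 c₁) (regs≤ sm₁ 46)) λ sm₂ →
      bind (repeat (Inv σ₁) (suc D) sm₂ refl
              (trans e43 (sym (+-identityʳ _)) , (λ _ _ → refl) ,
               Bitmap-resp {σ₁} {cur + Z} (λ y → mk⇔ ⊥-elim λ { (_ , _ , () , _) })
                 (Bitmap-∅ {σ₁} {cur} bm₁ bl))
              (step σ₁ c₁ (trans (regs fr₁ 28 _) e28) (trans (regs fr₁ 45 _) e45) bm₁))
        λ { σ₃ sm₃ fr₃ (_ , ag , bm₃) →
      let c₃ = keepConsts (whileNonZero 27 quotient-step) fr₃ c₁ in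
      seq (addₑ (cur + Z) sm₃ (cong₂ _+_ (trans (regs fr₃ 28 _) (trans (regs fr₁ 28 _) e28)) (e14 c₃)) d≤ λ sm₄ →
      addₑ (c + E * w) sm₄ (cong₂ _+_ (trans (regs fr₃ 36 _) (trans (regs fr₁ 36 _) e36)) (trans (regs fr₃ 44 _) (trans (regs fr₁ 44 _) e44))) c≤ λ _ →
      refl , refl , (λ y y< ne → trans (ag y y<) (same y ne)) , trans (ag a (<-≤-trans a<cur (m≤m+n cur Z))) half ,
      bm₃) }) }
      where
      top′ : cur + Z + Z + Z + Z ≤ M
      top′ = ≤-trans (≤-reflexive (solve 2 (λ c z → c :+ z :+ z :+ z :+ z := c :+ con 4 :* z) refl cur Z)) top≤
        where open +-*-Solver
      d≤ : cur + Z ≤ M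
      d≤ = ≤-trans (≤-trans (≤-trans (m≤m+n _ Z) (m≤m+n _ Z)) (m≤m+n _ Z)) top′
      δ g₀ : ℕ
      δ = X * w ∸ 2 * w
      g₀ = E * w ∸ b % 2 * w
      Inv : State → ℕ → State → Set
      Inv σ₁ i σ₂ = (reg σ₂ 43 ≡ g₀ + i * δ × Agree (cur + Z) σ₁ σ₂ ×
                           Bitmap σ₂ (cur + Z) (Carried S w (b % 2) i))
      g≤ : ∀ i → i ≤ suc D → g₀ + i * δ ≤ Z + Z
      g≤ i i≤ = +-mono-≤ (≤-trans (m∸n≤m (E * w) (b % 2 * w)) (≤-trans Ew≤ X≤Z))
                  (≤-trans (*-mono-≤ i≤ (m∸n≤m (X * w) (2 * w))) DXw≤)
      step : ∀ σ₁ → Consts σ₁ → reg σ₁ 28 ≡ cur → reg σ₁ 45 ≡ δ → Bitmap σ₁ cur S →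
             ∀ i j σ₂ → Small σ₂ → Frame quotient-step (setReg σ₁ 27 (suc D)) σ₂ → i < suc D → reg σ₂ 27 ≡ suc j → Inv σ₁ i σ₂ →
             Exec quotient-step σ₂ (pushCost + 2) (λ σ₃ → reg σ₃ 27 ≡ j × Inv σ₁ (suc i) σ₃)
      step σ₁ c₁ e28 e45 bm i j σ₂ sm₂ fr i<D e27 (e43 , ag , bm₂) =
        bind (push-exec {g = g₀ + i * δ} {S} {Carried S w (b % 2) i} sm₂ c₂ (trans (regs fr 28 _) e28) e43
               (Bitmap-agree {σ₁} {σ₂} {cur} ag bm) bm₂
               (≤-trans (+-monoˡ-≤ Z (+-monoʳ-≤ (cur + Z) (g≤ i (<⇒≤ i<D))))
                  (≤-trans (≤-reflexive (cong (_+ Z) (sym (+-assoc (cur + Z) Z Z)))) top′)))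
          λ { σ₃ sm₃ fr₃ (ag₃ , bm₃) →
        seq (addₑ (g₀ + suc i * δ) sm₃
               (trans (cong₂ _+_ (trans (regs fr₃ 43 _) e43) (trans (regs fr₃ 45 _) (trans (regs fr 45 _) e45)))
                      (trans (+-assoc g₀ (i * δ) δ) (cong (g₀ +_) (+-comm (i * δ) δ))))
               (≤-trans (≤-trans (g≤ (suc i) i<D) (≤-trans (m≤n+m (Z + Z) (cur + Z)) (≤-reflexive (sym (+-assoc (cur + Z) Z Z))))) (≤-trans (m≤m+n _ Z) top′)) λ sm₄ →
        subₑ j sm₄ (cong₂ _∸_ (trans (regs fr₃ 27 _) e27) (e1 (keepConsts push fr₃ c₂))) λ _ →
        refl , refl ,
        (λ y y< → trans (ag₃ y y<) (ag y y<)) ,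
        Bitmap-resp {σ₃} {cur + Z} (Shifted-suc bl) bm₃) }
        where
        c₂ : Consts σ₂
        c₂ = keepConsts quotient-step fr c₁

    slackCost scaleCost : ℕ
    slackCost = 1 + (pushCost + (1 + (pushCost + 1)))
    scaleCost = 1 + ((W * 3 + 4) + (2 + ((W * 3 + 4) + (2 + ((W * 3 + 4) + 1)))))

    slack-exec : ∀ {σ cur w S} → Small σ → Consts σ → reg σ 28 ≡ cur → reg σ 31 ≡ w →
                 Bitmap σ cur S → Below Z S → w ≤ X → cur + 4 * Z ≤ M →
                 Exec slack-step σ slackCost (λ σ′ →
                   reg σ′ 28 ≡ cur + Z × Agree (cur + Z) σ σ′ × Bitmap σ′ (cur + Z) (Slack S w))
    slack-exec {σ} {cur} {w} {S} sm cs e28 e31 bm bl w≤ top≤ =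
      seq (constₑ 0 sm z≤n λ sm₁ →
      bind (push-exec {g = 0} {S} {λ _ → ⊥} sm₁ cs e28 refl (λ x _ → bm x) (Bitmap-∅ {σ} {cur} bm bl)
             (≤-trans (≤-reflexive (cong (_+ Z) (+-identityʳ (cur + Z)))) top₂)) λ { σ₂ sm₂ fr₂ (ag₂ , bm₂) →
      let c₂ = keepConsts push fr₂ cs in
      seq (addₑ w sm₂ (trans (+0 (e40 c₂)) (trans (regs fr₂ 31 _) e31)) (subst (_≤ M) e31 (regs≤ sm 31)) λ sm₃ →
      bind (push-exec {g = w} {S} {Added (λ _ → ⊥) S Z 0} sm₃ c₂ (trans (regs fr₂ 28 _) e28) refl
             (Bitmap-agree {σ} {σ₂} {cur} ag₂ bm) bm₂ top₃) λ { σ₄ sm₄ fr₄ (ag₄ , bm₄) →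
      addₑ (cur + Z) sm₄ (cong₂ _+_ (trans (regs fr₄ 28 _) (trans (regs fr₂ 28 _) e28)) (e14 (keepConsts push fr₄ c₂))) (≤-trans (m≤m+n _ Z) top₂) λ _ →
      refl , (λ y y< → trans (ag₄ y y<) (ag₂ y y<)) , bm₄ }) })
      where
      top₃′ : cur + Z + Z + Z + Z ≤ M
      top₃′ = ≤-trans (≤-reflexive (solve 2 (λ c z → c :+ z :+ z :+ z :+ z := c :+ con 4 :* z) refl cur Z)) top≤
        where open +-*-Solver
      top₂ : cur + Z + Z ≤ M
      top₂ = ≤-trans (≤-trans (m≤m+n _ Z) (m≤m+n _ Z)) top₃′
      top₃ : cur + Z + w + Z ≤ M
      top₃ = ≤-trans (+-monoˡ-≤ Z (+-monoʳ-≤ (cur + Z) (≤-trans w≤ X≤Z))) (≤-trans (m≤m+n _ Z) top₃′)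

    scale-exec : ∀ {σ x y z} → Small σ → Consts σ → reg σ 31 ≡ x → reg σ 44 ≡ y → reg σ 45 ≡ z →
                 x * W ≤ M → y * W ≤ M → z * W ≤ M →
                 Exec scale σ scaleCost (λ σ′ → reg σ′ 31 ≡ x * W × reg σ′ 44 ≡ y * W × reg σ′ 45 ≡ z * W)
    scale-exec {σ} {x} {y} {z} sm cs e31 e44 e45 x≤ y≤ z≤ =
      seq (addₑ x sm (trans (+0 (e40 cs)) e31) (subst (_≤ M) e31 (regs≤ sm 31)) λ s₁ →
      bind (times-W-exec s₁ (e1 cs) (e40 cs) (e5 cs) refl x≤) λ σ₂ s₂ f₂ e8 →
      let c₂ = keepConsts times-W f₂ cs in
      seq (addₑ (x * W) s₂ (trans (+0 (e40 c₂)) e8) x≤ λ s₃ →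
      seq (addₑ y s₃ (trans (+0 (e40 c₂)) (trans (regs f₂ 44 _) e44)) (subst (_≤ M) e44 (regs≤ sm 44)) λ s₄ →
      bind (times-W-exec s₄ (e1 c₂) (e40 c₂) (e5 c₂) refl y≤) λ σ₅ s₅ f₅ e8 →
      let c₅ = keepConsts times-W f₅ c₂ in
      seq (addₑ (y * W) s₅ (trans (+0 (e40 c₅)) e8) y≤ λ s₆ →
      seq (addₑ z s₆ (trans (+0 (e40 c₅)) (trans (regs f₅ 45 _) (trans (regs f₂ 45 _) e45))) (subst (_≤ M) e45 (regs≤ sm 45)) λ s₇ →
      bind (times-W-exec s₇ (e1 c₅) (e40 c₅) (e5 c₅) refl z≤) λ σ₈ s₈ f₈ e8 →
      addₑ (z * W) s₈ (trans (+0 (trans (regs f₈ 40 _) (e40 c₅))) e8) z≤ λ _ →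
      trans (regs f₈ 31 _) (regs f₅ 31 _) , regs f₈ 44 _ , refl)))))

    Targets : State → (ℕ → ℕ) → Set
    Targets σ b = ∀ i → i ≤ m → mem σ (base + i) ≡ b i

    -- The bitmaps used up: for each vote one per candidate and one shared by `select` and `keep`;
    -- then one for coordinate 0, a slack and a carry for each of the other `m` coordinates, and one
    -- for the final scan.
    voteSlots slots : ℕ
    voteSlots = N * suc m
    slots = voteSlots + (m + m + 2)

    votes-exec : ∀ {σ cur S} → 2 ≤ W → m ≤ W → Small σ → Consts σ → reg σ 28 ≡ cur → reg σ 35 ≡ N →
                 Bitmap σ cur S → (∀ j → j ≤ N → ∀ i → i ≤ m → Below Z (Stage (Votes S j) i)) →
                 cur + (voteSlots + (m + 4)) * Z ≤ M →
                 Exec (whileNonZero 35 vote-step) σ (N * suc voteCost + 1) (λ σ′ →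
                   reg σ′ 28 ≡ cur + voteSlots * Z × Agree cur σ σ′ × Bitmap σ′ (cur + voteSlots * Z) (Votes S N))
    votes-exec {σ} {cur} {S} 2≤W m≤W sm cs e28 e35 bm bl top≤ =
      finish (repeat Inv N sm e35
          (trans e28 (sym (+-identityʳ cur)) , (λ _ _ → refl) , subst (λ a → Bitmap σ a S) (sym (+-identityʳ cur)) bm) step)
        λ _ _ _ inv → inv
      where
      Inv : ℕ → State → Set
      Inv i σ₁ = (reg σ₁ 28 ≡ cur + i * suc m * Z × Agree cur σ σ₁ × Bitmap σ₁ (cur + i * suc m * Z) (Votes S i))
      step : ∀ i j σ₁ → Small σ₁ → Frame vote-step σ σ₁ → i < N → reg σ₁ 35 ≡ suc j → Inv i σ₁ →
             Exec vote-step σ₁ voteCost (λ σ₂ → reg σ₂ 35 ≡ j × Inv (suc i) σ₂)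
      step i j σ₁ sm₁ fr i<N e35′ (e28′ , ag , bm₁) =
        finish (vote-exec {S = Votes S i} 2≤W m≤W sm₁ (keepConsts vote-step fr cs) e28′ e35′ bm₁ (bl i (<⇒≤ i<N))
                  (≤-trans (≤-reflexive (solve 4 (λ c i m z → c :+ i :* z :+ (m :+ con 4) :* z := c :+ (i :+ (m :+ con 4)) :* z) refl cur (i * suc m) m Z))
                           (≤-trans (+-monoʳ-≤ cur (*-monoˡ-≤ Z (+-monoˡ-≤ (m + 4) (*-monoˡ-≤ (suc m) (<⇒≤ i<N))))) top≤)))
          λ { σ₂ _ _ (e35″ , e28″ , ag′ , bm₂) →
            e35″ , trans e28″ next ,
            Agree-trans {cur} {cur + i * suc m * Z + Z} {σ} {σ₁} {σ₂} (≤-trans (m≤m+n cur _) (m≤m+n _ Z)) ag ag′ ,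
            subst (λ a → Bitmap σ₂ a (Votes S (suc i))) next bm₂ }
        where
        open +-*-Solver
        next : cur + i * suc m * Z + suc m * Z ≡ cur + suc i * suc m * Z
        next = solve 4 (λ c i m z → c :+ i :* m :* z :+ m :* z := c :+ (con 1 :+ i) :* m :* z) refl cur i (suc m) Z

    halves-step : Program
    halves-step = scale ⨾ add 25 25 1 ⨾ slack-step ⨾ carry-step ⨾ sub 26 26 1

    halvesCost : ℕ → ℕ
    halvesCost H = scaleCost + (1 + (slackCost + (carryCost H + 1)))

    halves-exec : ∀ {σ cur S b H} → E < W → Small σ → Consts σ → reg σ 28 ≡ cur + Z → reg σ 31 ≡ 1 → reg σ 25 ≡ base →
                  reg σ 36 ≡ code (λ _ → E) 1 → reg σ 44 ≡ E → reg σ 45 ≡ X ∸ 2 → reg σ 26 ≡ m → mem σ base ≡ b 0 / 2 →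
                  (∀ i → 1 ≤ i → i ≤ m → mem σ (base + i) ≡ b i) → (∀ i → i ≤ m → b i ≤ H) → base + m < cur →
                  Bitmap σ (cur + Z) (Halves S b 0) → (∀ i → i ≤ m → Below Z (Halves S b i)) →
                  (∀ i → i < m → Below Z (Slack (Halves S b i) (W ^ suc i))) → cur + (m + m + 6) * Z ≤ M →
                  Exec (whileNonZero 26 halves-step) σ (m * suc (halvesCost H) + 1) (λ σ′ →
                    reg σ′ 28 ≡ cur + (m + m + 1) * Z × reg σ′ 36 ≡ code (λ _ → E) (suc m) × Targets σ′ (λ i → b i / 2) ×
                    Bitmap σ′ (cur + (m + m + 1) * Z) (Halves S b m))
    halves-exec {σ} {cur} {S} {b} {H} E<W sm cs e28 e31 e25 e36 e44 e45 e26 t₀ tg b≤H low bm blH blS top≤ =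
      finish (repeat Inv m sm e26
          (trans e28 (cong (cur +_) (sym (+-identityʳ Z))) , e31 , trans e25 (sym (+-identityʳ base)) , e36 ,
           trans e44 (sym (*-identityʳ E)) , trans e45 (cong (_∸ 2) (sym (*-identityʳ X))) ,
           (λ { zero _ _ → trans (cong (mem σ) (+-identityʳ base)) t₀ }) , tg ,
           subst (λ a → Bitmap σ (cur + a) (Halves S b 0)) (sym (+-identityʳ Z)) bm) step)
        λ { _ _ _ (e28′ , _ , _ , e36′ , _ , _ , done , _ , bm′) → e28′ , e36′ , (λ l l≤m → done l l≤m l≤m) , bm′ }
      where
      Inv : ℕ → State → Set
      Inv i σ₁ = (reg σ₁ 28 ≡ cur + (i + i + 1) * Z × reg σ₁ 31 ≡ W ^ i × reg σ₁ 25 ≡ base + i ×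
                   reg σ₁ 36 ≡ code (λ _ → E) (suc i) × reg σ₁ 44 ≡ E * W ^ i × reg σ₁ 45 ≡ X * W ^ i ∸ 2 * W ^ i ×
                   (∀ l → l ≤ i → l ≤ m → mem σ₁ (base + l) ≡ b l / 2) ×
                   (∀ l → i < l → l ≤ m → mem σ₁ (base + l) ≡ b l) × Bitmap σ₁ (cur + (i + i + 1) * Z) (Halves S b i))
      step : ∀ i j σ₁ → Small σ₁ → Frame halves-step σ σ₁ → i < m → reg σ₁ 26 ≡ suc j → Inv i σ₁ →
             Exec halves-step σ₁ (halvesCost H) (λ σ₂ → reg σ₂ 26 ≡ j × Inv (suc i) σ₂)
      step i j σ₁ sm₁ fr i<m e26′ (e28′ , e31′ , e25′ , e36′ , e44′ , e45′ , done , todo , bm₁) =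
        bind (scale-exec sm₁ c₁ e31′ e44′ e45′ (≤-trans W≤ X≤M) (≤-trans EW≤ X≤M) (≤-trans δW≤ Z≤M))
          λ { σ₂ sm₂ fr₂ (e31₂ , e44₂ , e45₂) →
        let c₂ = keepConsts scale fr₂ c₁ in
        seq (addₑ (base + suc i) sm₂ (trans (cong₂ _+_ (trans (regs fr₂ 25 _) e25′) (e1 c₂)) (trans (+-assoc base i 1) (cong (base +_) (+-comm i 1))))
               (≤-trans (+-monoʳ-≤ base i<m) (≤-trans (<⇒≤ low) (≤-trans (m≤m+n cur _) top≤))) λ sm₃ →
        bind (slack-exec {w = W ^ suc i} {Halves S b i} sm₃ c₂ (trans (regs fr₂ 28 _) e28′) (trans e31₂ (*-comm (W ^ i) W))
               (λ x → subst (λ μ → μ (a + x) ≢ 0 ⇔ Halves S b i x) (sym (memory fr₂ _)) (bm₁ x)) (blH i (<⇒≤ i<m)) w≤X topA)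
          λ { σ₄ sm₄ fr₄ (e28₄ , ag₄ , bm₄) →
        let c₄ = keepConsts slack-step fr₄ c₂
            old = λ y (y< : y < a) → trans (ag₄ y (<-≤-trans y< (m≤m+n a Z))) (cong (λ μ → μ y) (memory fr₂ _)) in
        bind (carry-exec {w = W ^ suc i} {b = b (suc i)} {Slack (Halves S b i) (W ^ suc i)} {H} sm₄ c₄ e28₄
               (trans (regs fr₄ 31 _) (trans e31₂ (*-comm (W ^ i) W)))
               (trans (regs fr₄ 44 _) (trans e44₂ (shiftW E i)))
               (trans (regs fr₄ 45 _) (trans e45₂ (trans (*-distribʳ-∸ W (X * W ^ i) (2 * W ^ i)) (cong₂ _∸_ (shiftW X i) (shiftW 2 i)))))
               (regs fr₄ 25 _) (trans (regs fr₄ 36 _) (trans (regs fr₂ 36 _) e36′))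
               (trans (old _ (inside (suc i) i<m)) (todo (suc i) (n<1+n i) i<m)) (b≤H (suc i) i<m)
               (<-≤-trans (inside (suc i) i<m) (m≤m+n a Z)) bm₄ (blS i i<m) Ew≤X DXw≤Z
               (≤-trans (+-mono-≤ (≤-trans (<⇒≤ (code< (λ _ → E) (suc i) (λ _ _ → E<W))) (≤-trans (^-monoʳ-≤ W (≤-trans i<m (n≤1+n m))) X≤Z)) (≤-trans Ew≤X X≤Z))
                  (≤-trans (m≤n+m (Z + Z) a) topZZ))
               topB)
          λ { σ₅ sm₅ fr₅ (e28₅ , e36₅ , same , half , bm₅) →
        let c₅ = keepConsts carry-step fr₅ c₄ in
        subₑ j sm₅ (cong₂ _∸_ (trans (regs fr₅ 26 _) (trans (regs fr₄ 26 _) (trans (regs fr₂ 26 _) e26′))) (e1 c₅)) λ _ →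
          refl , trans e28₅ next ,
          trans (regs fr₅ 31 _) (trans (regs fr₄ 31 _) (trans e31₂ (*-comm (W ^ i) W))) ,
          trans (regs fr₅ 25 _) (regs fr₄ 25 _) , e36₅ ,
          trans (regs fr₅ 44 _) (trans (regs fr₄ 44 _) (trans e44₂ (shiftW E i))) ,
          trans (regs fr₅ 45 _) (trans (regs fr₄ 45 _) (trans e45₂ (trans (*-distribʳ-∸ W (X * W ^ i) (2 * W ^ i)) (cong₂ _∸_ (shiftW X i) (shiftW 2 i))))) ,
          halvedUpTo σ₅ (λ y y< ne → trans (same y (<-≤-trans y< (≤-trans (m≤m+n a Z) (m≤m+n _ Z))) ne) (old y y<)) half ,
          (λ l i<l l≤m → trans (trans (same (base + l) (<-≤-trans (inside l l≤m) (≤-trans (m≤m+n a Z) (m≤m+n _ Z))) (λ e → <⇒≢ i<l (sym (+-cancelˡ-≡ base _ _ e)))) (old _ (inside l l≤m)))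
                               (todo l (<⇒≤ i<l) l≤m)) ,
          subst (λ z → Bitmap σ₅ z (Halves S b (suc i))) next bm₅ } }) }
        where
        open +-*-Solver
        a : ℕ
        a = cur + (i + i + 1) * Z
        c₁ : Consts σ₁
        c₁ = keepConsts halves-step fr cs
        shiftW : ∀ x i → x * W ^ i * W ≡ x * W ^ suc i
        shiftW x i = trans (*-assoc x (W ^ i) W) (cong (x *_) (*-comm (W ^ i) W))
        w≤X : W ^ suc i ≤ X
        w≤X = ^-monoʳ-≤ W (≤-trans i<m (n≤1+n m))
        WW≤X : W * W ^ suc i ≤ X
        WW≤X = ^-monoʳ-≤ W (s≤s i<m)
        Ew≤X : E * W ^ suc i ≤ X
        Ew≤X = ≤-trans (*-monoˡ-≤ (W ^ suc i) (<⇒≤ E<W)) WW≤X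
        DXw≤Z : suc D * (X * W ^ suc i) ≤ Z
        DXw≤Z = ≤-trans (*-monoˡ-≤ (X * W ^ suc i) (≤-trans (s≤s (m≤m+n D D)) (<⇒≤ E<W)))
                  (≤-trans (≤-reflexive (solve 3 (λ w x v → w :* (x :* v) := x :* (w :* v)) refl W X (W ^ suc i))) (*-monoʳ-≤ X WW≤X))
        next : a + Z + Z ≡ cur + (suc i + suc i + 1) * Z
        next = solve 3 (λ c i z → c :+ (i :+ i :+ con 1) :* z :+ z :+ z := c :+ (con 1 :+ i :+ (con 1 :+ i) :+ con 1) :* z) refl cur i Z
        topB : a + Z + 4 * Z ≤ M
        topB = ≤-trans (≤-reflexive (solve 3 (λ c i z → c :+ (i :+ i :+ con 1) :* z :+ z :+ con 4 :* z := c :+ (i :+ i :+ con 6) :* z) refl cur i Z))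
                 (≤-trans (+-monoʳ-≤ cur (*-monoˡ-≤ Z (+-monoˡ-≤ 6 (+-mono-≤ (<⇒≤ i<m) (<⇒≤ i<m))))) top≤)
        topA : a + 4 * Z ≤ M
        topA = ≤-trans (+-monoˡ-≤ (4 * Z) (m≤m+n a Z)) topB
        topZZ : a + (Z + Z) ≤ M
        topZZ = ≤-trans (+-monoʳ-≤ a (≤-trans (≤-reflexive (solve 1 (λ z → z :+ z := con 2 :* z) refl Z)) (*-monoˡ-≤ Z (s≤s (s≤s (z≤n {2})))))) topA
        Z≤M : Z ≤ M
        Z≤M = ≤-trans (≤-trans (m≤m+n Z Z) (m≤n+m (Z + Z) a)) topZZ
        X≤M : X ≤ M
        X≤M = ≤-trans X≤Z Z≤M
        W≤ : W ^ i * W ≤ X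
        W≤ = ≤-trans (≤-reflexive (*-comm (W ^ i) W)) w≤X
        EW≤ : E * W ^ i * W ≤ X
        EW≤ = ≤-trans (≤-reflexive (shiftW E i)) Ew≤X
        δW≤ : (X * W ^ i ∸ 2 * W ^ i) * W ≤ Z
        δW≤ = ≤-trans (*-monoˡ-≤ W (m∸n≤m (X * W ^ i) (2 * W ^ i)))
                (≤-trans (≤-reflexive (shiftW X i)) (*-monoʳ-≤ X w≤X))
        inside : ∀ l → l ≤ m → base + l < a
        inside l l≤m = <-≤-trans (≤-<-trans (+-monoʳ-≤ base l≤m) low) (m≤m+n cur _)
        halvedUpTo : ∀ σ₂ → (∀ y → y < a → y ≢ base + suc i → mem σ₂ y ≡ mem σ₁ y) → mem σ₂ (base + suc i) ≡ b (suc i) / 2 →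
                     ∀ l → l ≤ suc i → l ≤ m → mem σ₂ (base + l) ≡ b l / 2
        halvedUpTo σ₂ same half l l≤ l≤m with l ≟ suc i
        ... | yes refl = half
        ... | no ne = trans (same (base + l) (inside l l≤m) (ne ∘ +-cancelˡ-≡ base _ _)) (done l (s≤s⁻¹ (≤∧≢⇒< l≤ ne)) l≤m)

    levelCost : ℕ → ℕ
    levelCost H = 1 + ((N * suc voteCost + 1) + (5 + (carryCost H + (1 + ((m * suc (halvesCost H) + 1) + (4 + ((X * 7 + 1) + 2)))))))

    level-exec : ∀ {σ cur k S b H} → E < W → m ≤ W → Small σ → Consts σ → reg σ 28 ≡ cur → reg σ 34 ≡ suc k →
                 Bitmap σ cur S → Targets σ b → (∀ i → i ≤ m → b i ≤ H) → base + m < cur →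
                 (∀ j → j ≤ N → ∀ i → i ≤ m → Below Z (Stage (Votes S j) i)) →
                 (∀ i → i ≤ m → Below Z (Halves (Votes S N) b i)) →
                 (∀ i → i < m → Below Z (Slack (Halves (Votes S N) b i) (W ^ suc i))) →
                 cur + (slots + (m + 6)) * Z ≤ M →
                 Exec level σ (levelCost H) (λ σ′ →
                   reg σ′ 34 ≡ k × reg σ′ 28 ≡ cur + slots * Z × Targets σ′ (λ i → b i / 2) ×
                   Bitmap σ′ (cur + slots * Z) (Next N S b))
    level-exec {σ} {cur} {k} {S} {b} {H} E<W m≤W sm cs e28 e34 bm tg b≤H low blV blH blS top≤ =
      seq (addₑ N sm (trans (+0 (e40 cs)) (e11 cs)) (subst (_≤ M) (e11 cs) (regs≤ sm 11)) λ sm₁ →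
      bind (votes-exec {S = S} 2≤W m≤W sm₁ cs e28 refl bm blV topV) λ { σ₂ sm₂ fr₂ (e28₂ , ag₂ , bm₂) →
      let c₂ = keepConsts (whileNonZero 35 vote-step) fr₂ cs
          tg₂ = λ i (i≤m : i ≤ m) → trans (ag₂ (base + i) (≤-<-trans (+-monoʳ-≤ base i≤m) low)) (tg i i≤m) in
      seq (constₑ 0 sm₂ z≤n λ sm₃ →
      seq (constₑ 1 sm₃ 1≤M λ sm₄ →
      seq (addₑ E sm₄ (trans (+0 (e40 c₂)) (e47 c₂)) (subst (_≤ M) (e47 c₂) (regs≤ sm₂ 47)) λ sm₅ →
      seq (subₑ (X ∸ 2) sm₅ (cong₂ _∸_ (e12 c₂) (e42 c₂)) λ sm₆ →
      seq (addₑ base sm₆ (trans (+0 (e40 c₂)) (e20 c₂)) (subst (_≤ M) (e20 c₂) (regs≤ sm₂ 20)) λ sm₇ →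
      bind (carry-exec {cur = a} {w = 1} {c = 0} {base} {b 0} {Votes S N} {H} sm₇ c₂ e28₂ refl (sym (*-identityʳ E))
              (cong (_∸ 2) (sym (*-identityʳ X))) refl refl (trans (cong (mem σ₂) (sym (+-identityʳ base))) (tg₂ 0 z≤n)) (b≤H 0 z≤n)
              (<-≤-trans base<cur (m≤m+n cur _)) bm₂ (blV N ≤-refl 0 z≤n)
              (≤-trans (≤-reflexive (*-identityʳ E)) (≤-trans (<⇒≤ E<W) W≤X))
              (≤-trans (≤-reflexive (cong (suc D *_) (*-identityʳ X))) (*-monoˡ-≤ X (≤-trans (s≤s (m≤m+n D D)) (≤-trans (<⇒≤ E<W) W≤X))))
              (≤-trans (≤-reflexive (*-identityʳ E)) (≤-trans (<⇒≤ E<W) (≤-trans W≤X X≤M)))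
              top₄)
        λ { σ₈ sm₈ fr₈ (e28₈ , e36₈ , same , half , bm₈) →
      let c₈ = keepConsts carry-step fr₈ c₂ in
      seq (addₑ m sm₈ (trans (+0 (e40 c₈)) (e2 c₈)) (subst (_≤ M) (e2 c₈) (regs≤ sm₈ 2)) λ sm₉ →
      bind (halves-exec {cur = a} {S = Votes S N} {b} {H} E<W sm₉ c₈ e28₈ (regs fr₈ 31 _) (regs fr₈ 25 _) e36₈ (regs fr₈ 44 _) (regs fr₈ 45 _) refl half
              (λ i 1≤i i≤m → trans (same (base + i) (<-≤-trans (≤-<-trans (+-monoʳ-≤ base i≤m) low) (≤-trans (m≤m+n cur _) (m≤m+n a Z)))
                  (λ e → <⇒≢ 1≤i (sym (+-cancelˡ-≡ base i 0 (trans e (sym (+-identityʳ base))))))) (tg₂ i i≤m))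
              b≤H (<-≤-trans low (m≤m+n cur _)) bm₈ blH blS topH)
        λ { σ₁₀ sm₁₀ fr₁₀ (e28₁₀ , e36₁₀ , tg₁₀ , bm₁₀) →
      let c₁₀ = keepConsts (whileNonZero 26 halves-step) fr₁₀ c₈ in
      seq (addₑ (a′ + EE) sm₁₀ (cong₂ _+_ e28₁₀ e36₁₀) (≤-trans (+-monoʳ-≤ a′ (≤-trans (<⇒≤ EE<X) X≤Z)) top₁) λ sm₁₁ →
      seq (addₑ (a′ + Z) sm₁₁ (cong₂ _+_ e28₁₀ (e14 c₁₀)) top₁ λ sm₁₂ →
      seq (addₑ X sm₁₂ (trans (+0 (e40 c₁₀)) (e12 c₁₀)) X≤M λ sm₁₃ →
      seq (addₑ X sm₁₃ (trans (+0 (e40 c₁₀)) (e12 c₁₀)) X≤M λ sm₁₄ →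
      bind (transfer-exec {b = a′ + Z + 0} sm₁₄ (e1 c₁₀) refl (sym (+-identityʳ (a′ + Z))) refl refl
              (λ x x<X → <-≤-trans (subst (_< a′ + Z) (sym (+-assoc a′ EE (X * x)))
                  (+-monoʳ-< a′ (inZ x x<X))) (m≤m+n _ 0))
              (≤-trans (≤-reflexive (+-assoc a′ EE Z)) (≤-trans (+-monoʳ-≤ a′ (+-monoˡ-≤ Z (≤-trans (<⇒≤ EE<X) X≤Z))) (≤-trans (≤-reflexive (sym (+-assoc a′ Z Z))) top₂)))
              (≤-trans (+-mono-≤ (≤-reflexive (+-identityʳ (a′ + Z))) X≤Z) top₂))
        λ { σ₁₅ sm₁₅ fr₁₅ t →
      let c₁₅ = keepConsts transfer fr₁₅ c₁₀ in
      seq (addₑ (cur + slots * Z) sm₁₅ (trans (cong₂ _+_ (trans (regs fr₁₅ 28 _) e28₁₀) (e14 c₁₅)) next) (≤-trans (≤-reflexive (sym next)) top₁) λ sm₁₆ →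
      subₑ k sm₁₆ (cong₂ _∸_ (trans (regs fr₁₅ 34 _) (trans (regs fr₁₀ 34 _) (trans (regs fr₈ 34 _) (trans (regs fr₂ 34 _) e34)))) (e1 c₁₅)) λ _ →
      refl , refl ,
      (λ i i≤m → trans (proj₁ t (base + i) (<-≤-trans (≤-<-trans (+-monoʳ-≤ base i≤m) low) (≤-trans cur≤a′ (≤-trans (m≤m+n a′ Z) (m≤m+n _ 0))))) (tg₁₀ i i≤m)) ,
      subst (λ z → Bitmap σ₁₅ z (Next N S b)) next
        (transferred-set {σ₁₀} {σ₁₅} {a′ + EE} {a′ + Z} {0} {X} {X} {λ x → Halves (Votes S N) b m (EE + X * x)} {λ _ → ⊥} t
          (λ x _ → subst (λ z → mem σ₁₀ z ≢ 0 ⇔ Halves (Votes S N) b m (EE + X * x)) (sym (+-assoc a′ EE (X * x))) (bm₁₀ (EE + X * x)))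
          (Bitmap-∅ {σ₁₀} {a′} bm₁₀ (blH m ≤-refl)))) })))) }) }))))) })
      where
      open +-*-Solver
      2≤W : 2 ≤ W
      2≤W = ≤-trans (s≤s (s≤s z≤n)) E<W
      EE a a′ : ℕ
      EE = code (λ _ → E) (suc m)
      a = cur + voteSlots * Z
      a′ = a + (m + m + 1) * Z
      EE<X : EE < X
      EE<X = code< (λ _ → E) (suc m) (λ _ _ → E<W)
      inZ : ∀ x → x < X → EE + X * x < Z
      inZ x x<X = <-≤-trans (+-monoˡ-< (X * x) EE<X) (≤-trans (≤-reflexive (sym (*-suc X x))) (*-monoʳ-≤ X x<X))
      cur≤a′ : cur ≤ a′
      cur≤a′ = ≤-trans (m≤m+n cur _) (m≤m+n a _)
      base<cur : base < cur
      base<cur = ≤-<-trans (m≤m+n base m) low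
      1≤M : 1 ≤ M
      1≤M = 1≤-small (e1 cs) sm
      W≤X : W ≤ X
      W≤X = m≤m*n W (W ^ m) {{m^n≢0 W m}}
      next : a′ + Z ≡ cur + slots * Z
      next = solve 4 (λ c v m z → c :+ v :* z :+ (m :+ m :+ con 1) :* z :+ z := c :+ (v :+ (m :+ m :+ con 2)) :* z) refl cur voteSlots m Z
      topV : cur + (voteSlots + (m + 4)) * Z ≤ M
      topV = ≤-trans (+-monoʳ-≤ cur (*-monoˡ-≤ Z (+-mono-≤ (m≤m+n voteSlots _) (+-monoʳ-≤ m (s≤s (s≤s (s≤s (s≤s (z≤n {2})))))))))  top≤
      topH : a + (m + m + 6) * Z ≤ M
      topH = ≤-trans (≤-reflexive (solve 4 (λ c v n z → c :+ v :* z :+ n :* z := c :+ (v :+ n) :* z) refl cur voteSlots (m + m + 6) Z))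
               (≤-trans (+-monoʳ-≤ cur (*-monoˡ-≤ Z (≤-trans (m≤m+n (voteSlots + (m + m + 6)) (m + 2)) (≤-reflexive (solve 2 (λ v m → v :+ (m :+ m :+ con 6) :+ (m :+ con 2) := v :+ (m :+ m :+ con 2) :+ (m :+ con 6)) refl voteSlots m))))) top≤)
      top₄ : a + 4 * Z ≤ M
      top₄ = ≤-trans (+-monoʳ-≤ a (*-monoˡ-≤ Z (≤-trans (s≤s (s≤s (s≤s (s≤s z≤n)))) (m≤n+m 6 (m + m))))) topH
      top₂ : a′ + Z + Z ≤ M
      top₂ = ≤-trans (≤-trans (≤-reflexive (solve 3 (λ a m z → a :+ (m :+ m :+ con 1) :* z :+ z :+ z := a :+ (m :+ m :+ con 3) :* z) refl a m Z))
                 (+-monoʳ-≤ a (*-monoˡ-≤ Z (+-monoʳ-≤ (m + m) (s≤s (s≤s (s≤s z≤n))))))) topH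
      top₁ : a′ + Z ≤ M
      top₁ = ≤-trans (m≤m+n _ Z) top₂
      X≤M : X ≤ M
      X≤M = ≤-trans X≤Z (≤-trans (m≤n+m Z a′) top₁)

  geometricCost : ℕ → ℕ → ℕ
  geometricCost w k = k * (w * 3 + 7) + 2

  -- Computing the constants and the targets

  module SetUp (m : ℕ) where

    open Parameters m
    open Input m

    record Ready (n t : ℕ) (σ : State) : Set where
      field
        e1  : reg σ 1 ≡ 1
        e2  : reg σ 2 ≡ m
        e3  : reg σ 3 ≡ n
        e4  : reg σ 4 ≡ t
        e5  : reg σ 5 ≡ W
        e11 : reg σ 11 ≡ N
        e12 : reg σ 12 ≡ X
        e13 : reg σ 13 ≡ U
        e14 : reg σ 14 ≡ Z
        e40 : reg σ 40 ≡ 0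
        e41 : reg σ 41 ≡ geometricSum W W m
        e42 : reg σ 42 ≡ 2
        e46 : reg σ 46 ≡ suc D
        e47 : reg σ 47 ≡ E

    constantsCost : ℕ
    constantsCost = 8 + (geometricCost q m + (1 + ((q * 3 + 4) + (3 + (geometricCost q 2 + (2 + (geometricCost W m +
                    (3 + (geometricCost W m + (1 + ((W * 3 + 4) + 1)))))))))))

    constants-exec : ∀ {σ n t} → Small σ → (∀ r → reg σ r ≡ 0) → mem σ 0 ≡ m → mem σ 1 ≡ n → mem σ 2 ≡ t → Z ≤ M →
                     Exec constants σ constantsCost (Ready n t)
    constants-exec {σ} {n} {t} sm r0 μ0 μ1 μ2 Z≤M =
      seq (constₑ 1 sm 1≤M λ s₁ → seq (constₑ 2 s₁ 2≤M λ s₂ →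
      seq (loadₑ m s₂ (trans (cong (mem σ) (r0 40)) μ0) λ s₃ →
      seq (loadₑ n s₃ μ1 λ s₄ → seq (loadₑ t s₄ μ2 λ s₅ →
      seq (addₑ q s₅ (+-comm m 2) (≤-trans q≤W W≤M) λ s₆ →
      seq (constₑ 1 s₆ 1≤M λ s₇ → seq (addₑ m s₇ (+0 (r0 40)) (≤-trans (m≤n+m m 2) (≤-trans q≤W W≤M)) λ s₈ →
      bind (geometric-exec s₈ refl (r0 40) refl refl refl
              (≤-trans (≤-reflexive (*-identityˡ N)) N≤M)
              (≤-trans (≤-trans (m≤m+n _ 1) (≤-trans (geometricSum-bound q 1 m (s≤s (s≤s z≤n))) (≤-reflexive (*-identityˡ N)))) N≤M)) λ { σ₉ s₉ f₉ (e8 , _) →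
      seq (addₑ N s₉ (trans (+0 (trans (regs f₉ 40 _) (r0 40))) (trans e8 (*-identityˡ N))) N≤M λ s₁₀ →
      bind (times-W-exec {w = q} {q = N} s₁₀ (regs f₉ 1 _) (trans (regs f₉ 40 _) (r0 40)) (regs f₉ 5 _) (trans e8 (*-identityˡ N)) D≤M) λ σ₉ s₉′ g₉ e8 →
      let z₉ = trans (regs g₉ 40 _) (trans (regs f₉ 40 _) (r0 40)) in
      seq (addₑ (suc D) s₉′ (trans (cong₂ _+_ e8 (trans (regs g₉ 1 _) (regs f₉ 1 _))) (+-comm D 1)) (≤-trans (<⇒≤ (s≤s (m≤m+n (suc D) D))) E+1≤M) λ s₁₀ →
      seq (addₑ E s₁₀ (cong (suc D +_) e8) (≤-trans (n≤1+n E) E+1≤M) λ s₁₀ →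
      seq (addₑ 2 s₁₀ (trans (+0 z₉) (trans (regs g₉ 42 _) (regs f₉ 42 _))) 2≤M λ s₁₁ →
      bind (geometric-exec {w = q} {q = D} {k = 2} s₁₁ (trans (regs g₉ 1 _) (regs f₉ 1 _)) z₉ (trans (regs g₉ 5 _) (regs f₉ 5 _)) e8 refl
              W≤M (≤-trans (≤-trans (m≤m+n _ D) (geometricSum-bound q D 2 (s≤s (s≤s z≤n)))) W≤M)) λ { σ₁₂ s₁₂ f₁₂ (e8 , _) →
      let z₁₂ = trans (regs f₁₂ 40 _) z₉ in
      seq (addₑ W s₁₂ (trans (+0 z₁₂) e8) W≤M λ s₁₃ →
      seq (addₑ m s₁₃ (trans (+0 z₁₂) (trans (regs f₁₂ 2 _) (trans (regs g₉ 2 _) (regs f₉ 2 _)))) (≤-trans (m≤n+m m 2) (≤-trans q≤W W≤M)) λ s₁₄ →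
      bind (geometric-exec {q = W} s₁₄ (trans (regs f₁₂ 1 _) (trans (regs g₉ 1 _) (regs f₉ 1 _))) z₁₂ refl e8 refl
              X≤M (≤-trans (≤-trans (m≤m+n _ W) (geometricSum-bound W W m 2≤W)) X≤M)) λ { σ₁₅ s₁₅ f₁₅ (e8 , e9) →
      let z₁₅ = trans (regs f₁₅ 40 _) z₁₂ in
      seq (addₑ (geometricSum W W m) s₁₅ (trans (+0 z₁₅) e9) (≤-trans (≤-trans (m≤m+n _ W) (geometricSum-bound W W m 2≤W)) X≤M) λ s₁₆ →
      seq (addₑ X s₁₆ (trans (+0 z₁₅) e8) X≤M λ s₁₇ →
      seq (addₑ m s₁₇ (trans (+0 z₁₅) (trans (regs f₁₅ 2 _) (trans (regs f₁₂ 2 _) (trans (regs g₉ 2 _) (regs f₉ 2 _))))) (≤-trans (m≤n+m m 2) (≤-trans q≤W W≤M)) λ s₁₈ →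
      bind (geometric-exec {q = X} s₁₈ (trans (regs f₁₅ 1 _) (trans (regs f₁₂ 1 _) (trans (regs g₉ 1 _) (regs f₉ 1 _)))) z₁₅ (regs f₁₅ 5 _) e8 refl
              (≤-trans (*-monoʳ-≤ X (^-monoʳ-≤ W (n≤1+n m))) Z≤M) U≤M) λ { σ₁₉ s₁₉ f₁₉ (e8 , e9) →
      let z₁₉ = trans (regs f₁₉ 40 _) z₁₅ in
      seq (addₑ U s₁₉ (trans (+0 z₁₉) e9) U≤M λ s₂₀ →
      bind (times-W-exec {q = X * W ^ m} s₂₀ (trans (regs f₁₉ 1 _) (trans (regs f₁₅ 1 _) (trans (regs f₁₂ 1 _) (trans (regs g₉ 1 _) (regs f₉ 1 _))))) z₁₉
              (trans (regs f₁₉ 5 _) (regs f₁₅ 5 _)) e8 (≤-trans (≤-reflexive XWW) Z≤M)) λ σ₂₁ s₂₁ f₂₁ e8 →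
      addₑ Z s₂₁ (trans (+0 (trans (regs f₂₁ 40 _) z₁₉)) (trans e8 XWW)) Z≤M λ _ → record
        { e1  = trans (regs f₂₁ 1 _) (trans (regs f₁₉ 1 _) (trans (regs f₁₅ 1 _) (trans (regs f₁₂ 1 _) (trans (regs g₉ 1 _) (regs f₉ 1 _)))))
        ; e2  = trans (regs f₂₁ 2 _) (trans (regs f₁₉ 2 _) (trans (regs f₁₅ 2 _) (trans (regs f₁₂ 2 _) (trans (regs g₉ 2 _) (regs f₉ 2 _)))))
        ; e3  = trans (regs f₂₁ 3 _) (trans (regs f₁₉ 3 _) (trans (regs f₁₅ 3 _) (trans (regs f₁₂ 3 _) (trans (regs g₉ 3 _) (regs f₉ 3 _)))))
        ; e4  = trans (regs f₂₁ 4 _) (trans (regs f₁₉ 4 _) (trans (regs f₁₅ 4 _) (trans (regs f₁₂ 4 _) (trans (regs g₉ 4 _) (regs f₉ 4 _)))))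
        ; e5  = trans (regs f₂₁ 5 _) (trans (regs f₁₉ 5 _) (regs f₁₅ 5 _))
        ; e11 = trans (regs f₂₁ 11 _) (trans (regs f₁₉ 11 _) (trans (regs f₁₅ 11 _) (trans (regs f₁₂ 11 _) (regs g₉ 11 _))))
        ; e12 = trans (regs f₂₁ 12 _) (regs f₁₉ 12 _)
        ; e13 = regs f₂₁ 13 _
        ; e14 = refl
        ; e40 = trans (regs f₂₁ 40 _) z₁₉
        ; e41 = trans (regs f₂₁ 41 _) (regs f₁₉ 41 _)
        ; e42 = trans (regs f₂₁ 42 _) (trans (regs f₁₉ 42 _) (trans (regs f₁₅ 42 _) (trans (regs f₁₂ 42 _) (trans (regs g₉ 42 _) (regs f₉ 42 _)))))
        ; e46 = trans (regs f₂₁ 46 _) (trans (regs f₁₉ 46 _) (trans (regs f₁₅ 46 _) (regs f₁₂ 46 _)))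
        ; e47 = trans (regs f₂₁ 47 _) (trans (regs f₁₉ 47 _) (trans (regs f₁₅ 47 _) (regs f₁₂ 47 _)))
        }) }))) })) })))) }))))))))
      where
      W≤M : W ≤ M
      W≤M = ≤-trans W≤X (≤-trans X≤Z Z≤M)
      X≤M : X ≤ M
      X≤M = ≤-trans X≤Z Z≤M
      D≤M : D ≤ M
      D≤M = ≤-trans (m≤m*n D (q ^ 2) {{m^n≢0 q 2}}) W≤M
      N≤M : N ≤ M
      N≤M = ≤-trans (m≤m*n N q) D≤M
      E+1≤M : suc E ≤ M
      E+1≤M = ≤-trans E<W W≤M
      1≤M : 1 ≤ M
      1≤M = ≤-trans 1≤N N≤M
      2≤M : 2 ≤ M
      2≤M = ≤-trans 2≤W W≤M
      U≤M : U ≤ M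
      U≤M = ≤-trans (≤-trans (≤-trans (m≤m+n U X) (geometricSum-bound W X m 2≤W)) (*-monoʳ-≤ X (^-monoʳ-≤ W (n≤1+n m)))) Z≤M
      XWW : X * W ^ m * W ≡ Z
      XWW = trans (*-assoc X (W ^ m) W) (cong (X *_) (*-comm (W ^ m) W))

    columnCost : ℕ → ℕ
    columnCost n = 3 + (n * 5 + 1)

    column-sum-exec : ∀ {σ n a} → Small σ → reg σ 1 ≡ 1 → reg σ 3 ≡ n → reg σ 21 ≡ suc m → reg σ 23 ≡ a → reg σ 40 ≡ 0 →
                      columnSum m (mem σ) a n ≤ M → a + n * suc m ≤ M →
                      Exec column-sum σ (columnCost n) (λ σ′ → reg σ′ 24 ≡ columnSum m (mem σ) a n × reg σ′ 15 ≡ a + n * suc m)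
    column-sum-exec {σ} {n} {a} sm e1 e3 e21 e23 e40 sum≤ top≤ =
      seq (constₑ 0 sm z≤n λ s₁ → seq (addₑ a s₁ (trans (+0 e40) e23) (≤-trans (m≤m+n a _) top≤) λ s₂ →
      seq (addₑ n s₂ (trans (+0 e40) e3) (subst (_≤ M) e3 (regs≤ sm 3)) λ s₃ →
      finish (for Inv n s₃ refl (refl , refl) step) λ σ₁ _ _ (i₁ , i₂) → trans (sym (+-identityʳ _)) i₁ , trans (sym (+-identityʳ _)) i₂)))
      where
      body = load 19 15 ⨾ add 24 24 19 ⨾ add 15 15 21 ⨾ sub 18 18 1
      Inv : ℕ → State → Set
      Inv j σ₁ = reg σ₁ 24 + columnSum m (mem σ) (reg σ₁ 15) j ≡ columnSum m (mem σ) a n × reg σ₁ 15 + j * suc m ≡ a + n * suc m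
      step : ∀ j σ₁ → Small σ₁ → Frame body (setReg (setReg (setReg σ 24 0) 15 a) 18 n) σ₁ → j < n → reg σ₁ 18 ≡ suc j → Inv (suc j) σ₁ →
             Exec body σ₁ 4 (λ σ₂ → reg σ₂ 18 ≡ j × Inv j σ₂)
      step j σ₁ s₁ fr _ e18 (i₁ , i₂) =
        seq (loadₑ v s₁ (cong (λ μ → μ (reg σ₁ 15)) (memory fr _)) λ s₂ →
        seq (addₑ (reg σ₁ 24 + v) s₂ refl (≤-trans (≤-trans (m≤m+n _ _) (≤-reflexive i₁′)) sum≤) λ s₃ →
        seq (addₑ (reg σ₁ 15 + suc m) s₃ (cong (reg σ₁ 15 +_) (trans (regs fr 21 _) e21))
               (≤-trans (≤-trans (m≤m+n _ _) (≤-reflexive i₂′)) top≤) λ s₄ →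
        subₑ j s₄ (cong₂ _∸_ e18 (trans (regs fr 1 _) e1)) λ _ → refl , i₁′ , i₂′)))
        where
        v = mem σ (reg σ₁ 15)
        i₁′ : reg σ₁ 24 + v + columnSum m (mem σ) (reg σ₁ 15 + suc m) j ≡ columnSum m (mem σ) a n
        i₁′ = trans (+-assoc (reg σ₁ 24) v _) i₁
        i₂′ : reg σ₁ 15 + suc m + j * suc m ≡ a + n * suc m
        i₂′ = trans (+-assoc (reg σ₁ 15) (suc m) (j * suc m)) i₂

    targetStepCost : ℕ → ℕ
    targetStepCost n = 2 + (columnCost n + 3)

    targetsCost : ℕ → ℕ → ℕ
    targetsCost n t = 2 + (columnCost n + (3 + ((t * 3 + 1) + (3 + (m * suc (targetStepCost n) + 1)))))

    targets-exec : ∀ {σ n t} → Small σ → Ready n t σ → base n + suc m ≤ M → total (mem σ) n t ≤ M →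
                   (∀ i → i ≤ m → columnSum m (mem σ) (3 + i) n ≤ M) →
                   Exec targets σ (targetsCost n t) (λ σ′ →
                     reg σ′ 20 ≡ base n × reg σ′ 22 ≡ total (mem σ) n t × reg σ′ 25 ≡ base n + m ×
                     (∀ i → i ≤ m → mem σ′ (base n + i) ≡ target (mem σ) n t i) ×
                     (∀ y → base n + m < y → mem σ′ y ≡ mem σ y))
    targets-exec {σ} {n} {t} sm rd base≤ total≤ col≤ =
      seq (addₑ (suc m) sm (trans (cong₂ _+_ e2 e1) (+-comm m 1)) m₁≤M λ s₁ →
      seq (constₑ 3 s₁ 3≤M λ s₂ →
      bind (column-sum-exec s₂ e1 e3 refl refl e40 (col≤ 0 z≤n) (≤-trans (m≤m+n b (suc m)) base≤)) λ { σ₃ s₃ f₃ (e24 , e15) →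
      let z₃ = trans (regs f₃ 40 _) e40 in
      seq (addₑ b s₃ (trans (+0 z₃) e15) (≤-trans (m≤m+n b (suc m)) base≤) λ s₄ →
      seq (addₑ c₀ s₄ (trans (+0 z₃) e24) (col≤ 0 z≤n) λ s₅ →
      seq (addₑ t s₅ (trans (+0 z₃) (trans (regs f₃ 4 _) e4)) (subst (_≤ M) e4 (regs≤ sm 4)) λ s₆ →
      bind (for (λ j σ₁ → reg σ₁ 22 + j * m ≡ A) t s₆ refl refl
              λ j σ₁ s₁ fr _ e18 inv →
                seq (addₑ (reg σ₁ 22 + m) s₁ (cong (reg σ₁ 22 +_) (trans (regs fr 2 _) (trans (regs f₃ 2 _) e2)))
                       (≤-trans (m≤m+n _ (j * m)) (≤-trans (≤-reflexive (trans (+-assoc (reg σ₁ 22) m (j * m)) inv)) total≤)) λ s₂ →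
                subₑ j s₂ (cong₂ _∸_ e18 (trans (regs fr 1 _) (trans (regs f₃ 1 _) e1))) λ _ →
                  refl , trans (+-assoc (reg σ₁ 22) m (j * m)) inv))
        λ σ₇ s₇ f₇ e22 →
      let z₇ = trans (regs f₇ 40 _) z₃ in
      seq (storeₑ b t s₇ (regs f₇ 20 _) (trans (regs f₇ 4 _) (trans (regs f₃ 4 _) e4)) λ s₈ →
      seq (addₑ b s₈ (trans (+0 z₇) (regs f₇ 20 _)) (≤-trans (m≤m+n b (suc m)) base≤) λ s₉ →
      seq (addₑ m s₉ (trans (+0 z₇) (trans (regs f₇ 2 _) (trans (regs f₃ 2 _) e2))) (subst (_≤ M) e2 (regs≤ sm 2)) λ s₁₀ →
      let μ₇ : ∀ y → mem σ₇ y ≡ mem σ y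
          μ₇ = λ y → cong (λ μ → μ y) (trans (memory f₇ _) (memory f₃ _)) in
      finish (repeat Inv m s₁₀ refl
          (trans (regs f₇ 23 _) (regs f₃ 23 _) , sym (+-identityʳ b) , trans (regs f₇ 20 _) refl , trans (sym (+-identityʳ _)) e22 ,
           (λ y y<b → trans (update-≢ (mem σ₇) b t (<⇒≢ y<b)) (μ₇ y)) ,
           (λ { zero _ → trans (cong (mem (setMem σ₇ b t)) (+-identityʳ b)) (update-≡ (mem σ₇) b t) }) ,
           (λ y b<y → trans (update-≢ (mem σ₇) b t (λ y≡b → <⇒≱ b<y (≤-trans (≤-reflexive y≡b) (m≤m+n b m)))) (μ₇ y)))
          (step σ₇ (trans (regs f₇ 1 _) (trans (regs f₃ 1 _) e1)) (trans (regs f₇ 3 _) (trans (regs f₃ 3 _) e3))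
               (trans (regs f₇ 21 _) (regs f₃ 21 _)) z₇))
        λ { _ _ _ (_ , e25 , e20 , e22′ , _ , tg , hi) → e20 , e22′ , e25 , tg , hi })))))) }))
      where
      open Ready rd
      b A c₀ : ℕ
      b = base n
      A = total (mem σ) n t
      c₀ = columnSum m (mem σ) 3 n
      m₁≤M : suc m ≤ M
      m₁≤M = ≤-trans (m≤n+m (suc m) b) base≤
      3≤M : 3 ≤ M
      3≤M = ≤-trans (≤-trans (m≤m+n 3 _) (m≤m+n b (suc m))) base≤
      Inv : ℕ → State → Set
      Inv i σ₁ = (reg σ₁ 23 ≡ 3 + i × reg σ₁ 25 ≡ b + i × reg σ₁ 20 ≡ b × reg σ₁ 22 ≡ A ×
                   Agree b σ σ₁ × (∀ l → l ≤ i → mem σ₁ (b + l) ≡ target (mem σ) n t l) ×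
                   (∀ y → b + m < y → mem σ₁ y ≡ mem σ y))
      step : ∀ σ₀ → reg σ₀ 1 ≡ 1 → reg σ₀ 3 ≡ n → reg σ₀ 21 ≡ suc m → reg σ₀ 40 ≡ 0 →
             ∀ i j σ₁ → Small σ₁ → Frame target-step (setReg (setReg (setMem σ₀ b t) 25 b) 26 m) σ₁ → i < m →
             reg σ₁ 26 ≡ suc j → Inv i σ₁ →
             Exec target-step σ₁ (targetStepCost n) (λ σ₂ → reg σ₂ 26 ≡ j × Inv (suc i) σ₂)
      step σ₀ e1 e3 e21 e40 i j σ₁ s₁ fr i<m e26 (e23 , e25 , e20 , e22 , lo , tg , hi) =
        seq (addₑ (3 + suc i) s₁ (trans (cong₂ _+_ e23 (trans (regs fr 1 _) e1)) (cong (3 +_) (+-comm i 1))) 4+i≤M λ s₂ →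
        seq (addₑ (b + suc i) s₂ (trans (cong₂ _+_ e25 (trans (regs fr 1 _) e1)) (trans (+-assoc b i 1) (cong (b +_) (+-comm i 1)))) b+i≤M λ s₃ →
        bind (column-sum-exec s₃ (trans (regs fr 1 _) e1) (trans (regs fr 3 _) e3) (trans (regs fr 21 _) e21) refl (trans (regs fr 40 _) e40)
               (≤-trans (≤-reflexive col) (col≤ (suc i) i<m)) (≤-trans endᵢ (≤-trans (+-monoʳ-≤ b (n≤1+n m)) base≤))) λ { σ₄ s₄ f₄ (e24 , _) →
        seq (subₑ (A ∸ columnSum m (mem σ) (3 + suc i) n) s₄ (cong₂ _∸_ (trans (regs f₄ 22 _) e22) (trans e24 col)) λ s₅ →
        seq (storeₑ (b + suc i) (target (mem σ) n t (suc i)) s₅ (regs f₄ 25 _) refl λ s₆ →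
        subₑ j s₆ (cong₂ _∸_ (trans (regs f₄ 26 _) e26) (trans (regs f₄ 1 _) (trans (regs fr 1 _) e1))) λ _ →
        refl , regs f₄ 23 _ , regs f₄ 25 _ , trans (regs f₄ 20 _) e20 , trans (regs f₄ 22 _) e22 ,
        (λ y y<b → trans (update-≢ (mem σ₄) (b + suc i) _ (λ e → <⇒≱ y<b (≤-trans (m≤m+n b (suc i)) (≤-reflexive (sym e))))) (trans (cong (λ μ → μ y) (memory f₄ _)) (lo y y<b))) ,
        tg′ σ₄ (memory f₄ _) ,
        (λ y b<y → trans (update-≢ (mem σ₄) (b + suc i) _ (λ e → <⇒≱ b<y (≤-trans (≤-reflexive e) (+-monoʳ-≤ b i<m)))) (trans (cong (λ μ → μ y) (memory f₄ _)) (hi y b<y))))) }))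
        where
        b+i≤M : b + suc i ≤ M
        b+i≤M = ≤-trans (+-monoʳ-≤ b (≤-trans i<m (n≤1+n m))) base≤
        4+i≤M : 3 + suc i ≤ M
        4+i≤M = ≤-trans (+-monoˡ-≤ (suc i) (m≤m+n 3 (n * suc m))) b+i≤M
        endᵢ : 3 + suc i + n * suc m ≤ b + m
        endᵢ = ≤-trans (≤-reflexive (solve 2 (λ i k → con 3 :+ i :+ k := con 3 :+ k :+ i) refl (suc i) (n * suc m))) (+-monoʳ-≤ b i<m)
          where open +-*-Solver
        col : columnSum m (mem σ₁) (3 + suc i) n ≡ columnSum m (mem σ) (3 + suc i) n
        col = columnSum-cong (3 + suc i) n b lo endᵢ
        tg′ : ∀ σ₄ → mem σ₄ ≡ mem σ₁ → ∀ l → l ≤ suc i →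
              mem (setMem σ₄ (b + suc i) (target (mem σ) n t (suc i))) (b + l) ≡ target (mem σ) n t l
        tg′ σ₄ eq l l≤ with l ≟ suc i
        ... | yes refl = update-≡ (mem σ₄) (b + suc i) _
        ... | no ne = trans (update-≢ (mem σ₄) (b + suc i) _ (ne ∘ +-cancelˡ-≡ b _ _)) (trans (cong (λ μ → μ (b + l)) eq) (tg l (s≤s⁻¹ (≤∧≢⇒< l≤ ne))))

-- Multiplicities and permutations

remainder-unique : ∀ {q q′ r r′ d} → r < d → r′ < d → r + q * d ≡ r′ + q′ * d → r ≡ r′ × q ≡ q′
remainder-unique {q} {q′} {r} {r′} {d} r< r′< e with <-cmp q q′
... | tri≈ _ refl _ = +-cancelʳ-≡ (q * d) r r′ e , refl
... | tri< q<q′ _ _ = ⊥-elim (<⇒≢ (<-≤-trans (+-monoˡ-< (q * d) r<) (≤-trans (*-monoˡ-≤ d q<q′) (m≤n+m (q′ * d) r′))) e)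
... | tri> _ _ q′<q = ⊥-elim (<⇒≢ (<-≤-trans (+-monoˡ-< (q′ * d) r′<) (≤-trans (*-monoˡ-≤ d q′<q) (m≤n+m (q * d) r))) (sym e))

-- Vectors are kept as functions on all of ℕ, so that `code` can recurse on a plain length.
ext : ∀ {k} → (Fin k → ℕ) → ℕ → ℕ
ext {zero}  f i       = 0
ext {suc k} f zero    = f zero
ext {suc k} f (suc i) = ext (f ∘ suc) i

ext-toℕ : ∀ {k} (f : Fin k → ℕ) c → ext f (toℕ c) ≡ f c
ext-toℕ f zero    = refl
ext-toℕ f (suc c) = ext-toℕ (f ∘ suc) c

ext-fromℕ< : ∀ {k} (f : Fin k → ℕ) {i} (i<k : i < k) → ext f i ≡ f (fromℕ< i<k)
ext-fromℕ< f i<k = trans (cong (ext f) (sym (toℕ-fromℕ< i<k))) (ext-toℕ f (fromℕ< i<k))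

ext< : ∀ {k b} (f : Fin k → ℕ) → 0 < b → (∀ c → f c < b) → ∀ i → ext f i < b
ext< {zero}  f 0<b f<b i       = 0<b
ext< {suc k} f 0<b f<b zero    = f<b zero
ext< {suc k} f 0<b f<b (suc i) = ext< (f ∘ suc) 0<b (f<b ∘ suc) i

indicator : ℕ → ℕ → ℕ
indicator a j = if a ≡ᵇ j then 1 else 0

indicator-≡ : ∀ a → indicator a a ≡ 1
indicator-≡ a with a ≡ᵇ a | ≡⇒≡ᵇ a a refl
... | true | _ = refl

indicator-≢ : ∀ {a j} → a ≢ j → indicator a j ≡ 0
indicator-≢ {a} {j} ne with a ≡ᵇ j | ≡ᵇ⇒≡ a j
... | true  | e = ⊥-elim (ne (e _))
... | false | _ = refl

count : (ℕ → ℕ) → ℕ → ℕ → ℕ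
count g zero    j = 0
count g (suc k) j = count g k j + indicator (g k) j

indicator≤1 : ∀ a j → indicator a j ≤ 1
indicator≤1 a j with a ≡ᵇ j
... | true  = s≤s z≤n
... | false = z≤n

count≤ : ∀ g k j → count g k j ≤ k
count≤ g zero    j = z≤n
count≤ g (suc k) j = ≤-trans (+-mono-≤ (count≤ g k j) (indicator≤1 (g k) j)) (≤-reflexive (+-comm k 1))

count-hit : ∀ g k {c j} → c < k → g c ≡ j → 1 ≤ count g k j
count-hit g (suc k) {c} c<k refl with c ≟ k
... | yes refl = ≤-trans (≤-reflexive (sym (indicator-≡ (g c)))) (m≤n+m _ (count g c (g c)))
... | no c≢k = ≤-trans (count-hit g k (≤∧≢⇒< (s≤s⁻¹ c<k) c≢k) refl) (m≤m+n _ _)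

count-witness : ∀ g k {j} → 1 ≤ count g k j → ∃[ c ] (c < k × g c ≡ j)
count-witness g (suc k) {j} 1≤ with g k ≟ j
... | yes e = k , n<1+n k , e
... | no ne with count-witness g k (subst (1 ≤_) (trans (cong (count g k j +_) (indicator-≢ ne)) (+-identityʳ _)) 1≤)
...   | c , c<k , e = c , m<n⇒m<1+n c<k , e

count-two : ∀ g k {c c′ j} → c < c′ → c′ < k → g c ≡ j → g c′ ≡ j → 2 ≤ count g k j
count-two g (suc k) {c} {c′} c<c′ c′<k e refl with c′ ≟ k
... | yes refl = +-mono-≤ (count-hit g k c<c′ e) (≤-reflexive (sym (indicator-≡ (g k))))
... | no c′≢k = ≤-trans (count-two g k c<c′ (≤∧≢⇒< (s≤s⁻¹ c′<k) c′≢k) e refl) (m≤m+n _ _)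

count-injective : ∀ g k j → (∀ {c c′} → c < k → c′ < k → g c ≡ g c′ → c ≡ c′) → count g k j ≤ 1
count-injective g zero    j inj = z≤n
count-injective g (suc k) j inj with g k ≟ j
... | no ne = ≤-trans (≤-reflexive (trans (cong (count g k j +_) (indicator-≢ ne)) (+-identityʳ _)))
                      (count-injective g k j (λ c<k c′<k → inj (m<n⇒m<1+n c<k) (m<n⇒m<1+n c′<k)))
... | yes refl with count g k (g k) in eq
...   | zero  = ≤-reflexive (indicator-≡ (g k))
...   | suc _ with count-witness g k (subst (1 ≤_) (sym eq) (s≤s z≤n))
...     | c , c<k , e = ⊥-elim (<⇒≢ c<k (inj (m<n⇒m<1+n c<k) (n<1+n k) e))

-- That each value is hit at least once provides the inverse map; that none is hit twice makes `to`
-- injective.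
permutation-of : ∀ {m} g → (∀ c → c < m → g c < m) → (∀ j → j < m → count g m j ≡ 1) →
                 ∃[ ρ ] (∀ c → c < m → ext (toℕ ∘ (_⟨$⟩ʳ_ {m} {m} ρ)) c ≡ g c)
permutation-of {m} g g< once = permutation to from to∘from from∘to ,
  λ c c<m → trans (ext-fromℕ< _ c<m) (trans (toℕ-to (fromℕ< c<m)) (cong g (toℕ-fromℕ< c<m)))
  where
  to : Fin m → Fin m
  to c = fromℕ< (g< (toℕ c) (toℕ<n c))
  toℕ-to : ∀ c → toℕ (to c) ≡ g (toℕ c)
  toℕ-to c = toℕ-fromℕ< _
  hit : ∀ j → ∃[ c ] (c < m × g c ≡ toℕ j)
  hit j = count-witness g m (≤-reflexive (sym (once (toℕ j) (toℕ<n j))))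
  from : Fin m → Fin m
  from j = fromℕ< (proj₁ (proj₂ (hit j)))
  to∘from : ∀ j → to (from j) ≡ j
  to∘from j = toℕ-injective (trans (toℕ-to (from j)) (trans (cong g (toℕ-fromℕ< _)) (proj₂ (proj₂ (hit j)))))
  to-injective : ∀ {c c′} → to c ≡ to c′ → c ≡ c′
  to-injective {c} {c′} e with <-cmp (toℕ c) (toℕ c′)
  ... | tri≈ _ e′ _ = toℕ-injective e′
  ... | tri< lt _ _ = ⊥-elim (1+n≰n (≤-trans (count-two g m lt (toℕ<n c′) (trans (sym (toℕ-to c)) (trans (cong toℕ e) (toℕ-to c′))) refl)
                                 (≤-reflexive (once _ (g< _ (toℕ<n c′))))))
  ... | tri> _ _ gt = ⊥-elim (1+n≰n (≤-trans (count-two g m gt (toℕ<n c) (trans (sym (toℕ-to c′)) (trans (cong toℕ (sym e)) (toℕ-to c))) refl)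
                                 (≤-reflexive (once _ (g< _ (toℕ<n c))))))
  from∘to : ∀ c → from (to c) ≡ c
  from∘to c = to-injective (to∘from (to c))

permutation-count : ∀ {m} (ρ : Permutation′ m) j → j < m → count (ext (toℕ ∘ (ρ ⟨$⟩ʳ_))) m j ≡ 1
permutation-count {m} ρ j j<m = ≤-antisym
  (count-injective g m j λ {c} {c′} c< c′< e → trans (sym (toℕ-fromℕ< c<)) (trans (cong toℕ (inj (trans (sym (ext-fromℕ< _ c<)) (trans e (ext-fromℕ< _ c′<))))) (toℕ-fromℕ< c′<)))
  (count-hit g m (toℕ<n (ρ ⟨$⟩ˡ fromℕ< j<m)) (trans (ext-toℕ _ (ρ ⟨$⟩ˡ fromℕ< j<m)) (trans (cong toℕ (inverseʳ ρ)) (toℕ-fromℕ< j<m))))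
  where
  g = ext (toℕ ∘ (ρ ⟨$⟩ʳ_))
  inj : ∀ {x y} → toℕ (ρ ⟨$⟩ʳ x) ≡ toℕ (ρ ⟨$⟩ʳ y) → x ≡ y
  inj e = trans (sym (inverseˡ ρ)) (trans (cong (ρ ⟨$⟩ˡ_) (toℕ-injective e)) (inverseˡ ρ))

cons : ℕ → (ℕ → ℕ) → ℕ → ℕ
cons a v zero    = a
cons a v (suc i) = v i

-- Codes as vectors of digits

module CodeProperties (m W D : ℕ) where
  open Codes m W D

  code-cong : ∀ {u v} k → (∀ i → i < k → u i ≡ v i) → code u k ≡ code v k
  code-cong zero    e = refl
  code-cong (suc k) e = cong₂ _+_ (code-cong k (λ i i<k → e i (m<n⇒m<1+n i<k))) (cong (_* W ^ k) (e k (n<1+n k)))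

  code-+ : ∀ u v k → code (λ i → u i + v i) k ≡ code u k + code v k
  code-+ u v zero    = refl
  code-+ u v (suc k) = trans (cong (_+ (u k + v k) * W ^ k) (code-+ u v k))
    (solve 5 (λ a b x y w → a :+ b :+ (x :+ y) :* w := a :+ x :* w :+ (b :+ y :* w)) refl (code u k) (code v k) (u k) (v k) (W ^ k))
    where open +-*-Solver

  code-0 : ∀ k → code (λ _ → 0) k ≡ 0
  code-0 zero    = refl
  code-0 (suc k) = trans (+-identityʳ _) (code-0 k)

  code-cons : ∀ v k → code v (suc k) ≡ v 0 + W * code (v ∘ suc) k
  code-cons v zero    = trans (*-identityʳ (v 0)) (sym (trans (cong (v 0 +_) (*-zeroʳ W)) (+-identityʳ (v 0))))
  code-cons v (suc k) = trans (cong (_+ v (suc k) * (W * W ^ k)) (code-cons v k))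
    (solve 5 (λ a w c x p → a :+ w :* c :+ x :* (w :* p) := a :+ w :* (c :+ x :* p)) refl (v 0) W (code (v ∘ suc) k) (v (suc k)) (W ^ k))
    where open +-*-Solver

  code-injective : ∀ u v k → (∀ i → i < k → u i < W) → (∀ i → i < k → v i < W) → code u k ≡ code v k → ∀ i → i < k → u i ≡ v i
  code-injective u v (suc k) u< v< e i i<k with
    remainder-unique {u k} {v k} (code< u k (λ i i<k → u< i (m<n⇒m<1+n i<k))) (code< v k (λ i i<k → v< i (m<n⇒m<1+n i<k))) e
  ... | e₁ , e₂ with i ≟ k
  ...   | yes refl = e₂
  ...   | no i≢k = code-injective u v k (λ i i<k → u< i (m<n⇒m<1+n i<k)) (λ i i<k → v< i (m<n⇒m<1+n i<k)) e₁ i (≤∧≢⇒< (s≤s⁻¹ i<k) i≢k)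

  geometricSum-code : ∀ k q → geometricSum W q k ≡ q * code (λ _ → 1) k
  geometricSum-code zero    q = sym (*-zeroʳ q)
  geometricSum-code (suc k) q = trans (cong (q +_) (geometricSum-code k (q * W)))
    (trans (solve 3 (λ q w c → q :+ q :* w :* c := q :* (con 1 :+ w :* c)) refl q W (code (λ _ → 1) k)) (cong (q *_) (sym (code-cons (λ _ → 1) k))))
    where open +-*-Solver

  code-indicator : ∀ a k → a < k → code (indicator a) k ≡ W ^ a
  code-indicator a (suc k) a<k with a ≟ k
  ... | yes refl = trans (cong₂ _+_ (trans (code-cong k (λ i i<k → indicator-≢ (λ e → <⇒≢ i<k (sym e)))) (code-0 k))
                                    (cong (_* W ^ k) (indicator-≡ k))) (*-identityˡ (W ^ k))
  ... | no a≢k = trans (cong₂ _+_ (code-indicator a k (≤∧≢⇒< (s≤s⁻¹ a<k) a≢k)) (cong (_* W ^ k) (indicator-≢ a≢k))) (+-identityʳ _)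

  -- What the scores `g` leave in the upper digits: by `powers-count`, the multiplicity of each
  -- score.
  powers : (ℕ → ℕ) → ℕ → ℕ
  powers g zero    = 0
  powers g (suc k) = powers g k + W ^ g k

  powers-cong : ∀ {g h} k → (∀ i → i < k → g i ≡ h i) → powers g k ≡ powers h k
  powers-cong zero    e = refl
  powers-cong (suc k) e = cong₂ _+_ (powers-cong k (λ i i<k → e i (m<n⇒m<1+n i<k))) (cong (W ^_) (e k (n<1+n k)))

  powers-count : ∀ g k → (∀ c → c < k → g c < m) → powers g k ≡ code (count g k) m
  powers-count g zero    g< = sym (code-0 m)
  powers-count g (suc k) g< = trans (cong₂ _+_ (powers-count g k (λ c c<k → g< c (m<n⇒m<1+n c<k))) (sym (code-indicator (g k) m (g< k (n<1+n k)))))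
                                    (sym (code-+ (count g k) (indicator (g k)) m))

  module _ {S : ℕ → Set} where

    Stage-elim : ∀ k {y} → Stage S k y →
                 ∃[ s ] ∃[ g ] (S s × (∀ c → c < k → g c < m) × y ≡ s + (W * code g k + X * powers g k))
    Stage-elim zero {y} sy = y , (λ _ → 0) , sy , (λ _ ()) ,
      sym (trans (cong (y +_) (cong₂ _+_ (*-zeroʳ W) (*-zeroʳ X))) (+-identityʳ y))
    Stage-elim (suc k) (x , i , i<m , st , refl) with Stage-elim k st
    ... | s , g , ss , g< , refl = s , g [ k ↦ i ] , ss , below , (begin
      s + (W * code g k + X * powers g k) + (i * W ^ suc k + X * W ^ i)
        ≡⟨ solve 8 (λ s w c x p i v u → s :+ (w :* c :+ x :* p) :+ (i :* (w :* v) :+ x :* u) := s :+ (w :* (c :+ i :* v) :+ x :* (p :+ u)))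
             refl s W (code g k) X (powers g k) i (W ^ k) (W ^ i) ⟩
      s + (W * (code g k + i * W ^ k) + X * (powers g k + W ^ i))
        ≡⟨ cong₂ (λ a b → s + (W * a + X * b))
             (cong₂ _+_ (code-cong k old) (cong (_* W ^ k) (sym (update-≡ g k i))))
             (cong₂ _+_ (powers-cong k old) (cong (W ^_) (sym (update-≡ g k i)))) ⟩
      s + (W * code (g [ k ↦ i ]) (suc k) + X * powers (g [ k ↦ i ]) (suc k)) ∎)
      where
      open ≡-Reasoning
      open +-*-Solver
      old : ∀ c → c < k → g c ≡ (g [ k ↦ i ]) c
      old c c<k = sym (update-≢ g k i (<⇒≢ c<k))
      below : ∀ c → c < suc k → (g [ k ↦ i ]) c < m
      below c c<k with c ≟ k
      ... | yes refl = subst (_< m) (sym (update-≡ g c i)) i<m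
      ... | no c≢k = subst (_< m) (sym (update-≢ g k i c≢k)) (g< c (≤∧≢⇒< (s≤s⁻¹ c<k) c≢k))

    Stage-intro : ∀ k {s} g → S s → (∀ c → c < k → g c < m) → Stage S k (s + (W * code g k + X * powers g k))
    Stage-intro zero {s} g ss g< = subst S (sym (trans (cong (s +_) (cong₂ _+_ (*-zeroʳ W) (*-zeroʳ X))) (+-identityʳ s))) ss
    Stage-intro (suc k) {s} g ss g< =
      s + (W * code g k + X * powers g k) , g k , g< k (n<1+n k) , Stage-intro k g ss (λ c c<k → g< c (m<n⇒m<1+n c<k)) ,
      solve 8 (λ s w c x p i v u → s :+ (w :* (c :+ i :* v) :+ x :* (p :+ u)) := s :+ (w :* c :+ x :* p) :+ (i :* (w :* v) :+ x :* u))
             refl s W (code g k) X (powers g k) (g k) (W ^ k) (W ^ g k)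
      where open +-*-Solver

  -- The bound matters as much as the digits: only below `W` can they be recovered from the code.
  Digits : ℕ → (ℕ → Set) → Set
  Digits B S = ∀ {x} → S x → ∃[ v ] ((∀ i → i ≤ m → v i ≤ B) × x ≡ code v (suc m))

  +code : ∀ v g → code v (suc m) + W * code g m ≡ code (λ i → v i + cons 0 g i) (suc m)
  +code v g = sym (trans (code-+ v (cons 0 g) (suc m)) (cong (code v (suc m) +_) (code-cons (cons 0 g) m)))

  -- Padding by zeros turns a vector of which only `k` coordinates have been handled into one of
  -- full length, to which the bounds for full codes apply.
  cutoff : (ℕ → ℕ) → ℕ → ℕ → ℕ
  cutoff g k c with c <? k
  ... | yes _ = g c
  ... | no _  = 0

  code-cutoff : ∀ g k n → code (cutoff g k) (n + k) ≡ code g k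
  code-cutoff g k zero = code-cong k λ i i<k → lemma i i<k
    where
    lemma : ∀ i → i < k → cutoff g k i ≡ g i
    lemma i i<k with i <? k
    ... | yes _ = refl
    ... | no i≮k = ⊥-elim (i≮k i<k)
  code-cutoff g k (suc n) = trans (cong₂ _+_ (code-cutoff g k n) (cong (_* W ^ (n + k)) (lemma (m≤n+m k n)))) (+-identityʳ _)
    where
    lemma : ∀ {i} → k ≤ i → cutoff g k i ≡ 0
    lemma {i} k≤i with i <? k
    ... | yes i<k = ⊥-elim (<⇒≱ i<k k≤i)
    ... | no _ = refl

  module _ {B} (1≤m : 1 ≤ m) (B+m≤W : B + m ≤ W) where

    private
      m≤W : m ≤ W
      m≤W = ≤-trans (m≤n+m m B) B+m≤W

      cons< : ∀ (v g : ℕ → ℕ) → (∀ i → i ≤ m → v i ≤ B) → (∀ c → c < m → g c < m) → ∀ i → i < suc m → v i + cons 0 g i < W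
      cons< v g v≤ g< zero    _ = <-≤-trans (+-mono-≤-< (v≤ 0 z≤n) 1≤m) B+m≤W
      cons< v g v≤ g< (suc i) i< = <-≤-trans (+-mono-≤-< (v≤ (suc i) (s≤s⁻¹ i<)) (g< i (s≤s⁻¹ i<))) B+m≤W

      low< : ∀ {v g : ℕ → ℕ} → (∀ i → i ≤ m → v i ≤ B) → (∀ c → c < m → g c < m) → code v (suc m) + W * code g m < X
      low< {v} {g} v≤ g< = subst (_< X) (sym (+code v g)) (code< _ (suc m) (cons< v g v≤ g<))

    module _ (m<W : m < W) {S : ℕ → Set} (ds : Digits B S) where

      Stage-below : ∀ i → i ≤ m → Below Z (Stage S i)
      Stage-below k k≤m {y} st with Stage-elim k st
      ... | s , g , ss , g< , refl with ds ss
      ...   | v , v≤ , refl = begin-strict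
        code v (suc m) + (W * code g k + X * powers g k)  ≡⟨ sym (+-assoc (code v (suc m)) _ _) ⟩
        code v (suc m) + W * code g k + X * powers g k    <⟨ +-monoˡ-< (X * powers g k) (subst (λ c → code v (suc m) + W * c < X) (trans (cong (code (cutoff g k)) (sym (m∸n+n≡m k≤m))) (code-cutoff g k (m ∸ k))) (low< v≤ cut<)) ⟩
        X + X * powers g k                                ≡⟨ sym (*-suc X (powers g k)) ⟩
        X * suc (powers g k)                              ≤⟨ *-monoʳ-≤ X (subst (_< W ^ m) (sym (powers-count g k g<)) (code< (count g k) m (λ j _ → ≤-<-trans (≤-trans (count≤ g k j) k≤m) m<W))) ⟩
        X * W ^ m                                         ≤⟨ *-monoʳ-≤ X (m≤n*m (W ^ m) W {{>-nonZero (≤-trans (s≤s z≤n) m<W)}}) ⟩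
        X * X                                             ∎
        where
        open ≤-Reasoning
        cut< : ∀ c → c < m → cutoff g k c < m
        cut< c c<m with c <? k
        ... | yes c<k = g< c c<k
        ... | no _ = 1≤m

      Selected : ℕ → Set
      Selected y = ∃[ s ] ∃[ ρ ] (S s × y ≡ s + W * code (ext (toℕ ∘ (_⟨$⟩ʳ_ {m} {m} ρ))) m)

      -- No digit overflows, so division by `X` separates the scores added below from their
      -- multiplicities above. Comparison with `U` makes all multiplicities 1, and then the scores
      -- form a permutation.
      Stage-select : ∀ {x} → x < X → Stage S m (U + x) ⇔ Selected x
      Stage-select {x} x<X = mk⇔ to from
        where
        to : Stage S m (U + x) → Selected x
        to st with Stage-elim m st
        ... | s , g , ss , g< , e with ds ss
        ...   | v , v≤ , refl with remainder-unique {code (λ _ → 1) m} {code (count g m) m} x<X (low< v≤ g<)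
                                    (trans (+-comm x _) (trans (cong (_+ x) (trans (*-comm (code (λ _ → 1) m) X) (sym (geometricSum-code m X))))
                                      (trans e (trans (sym (+-assoc (code v (suc m)) _ _)) (cong (code v (suc m) + W * code g m +_)
                                        (trans (cong (X *_) (powers-count g m g<)) (*-comm X _)))))))
        ...     | e₁ , e₂ with permutation-of g g< (λ j j<m → sym (code-injective (λ _ → 1) (count g m) m (λ _ _ → ≤-<-trans 1≤m m<W) (λ j _ → ≤-<-trans (count≤ g m j) m<W) e₂ j j<m))
        ...       | ρ , ρ≡g = _ , ρ , ss , trans e₁ (cong (λ c → code v (suc m) + W * c) (code-cong m (λ i i<m → sym (ρ≡g i i<m))))
        from : Selected x → Stage S m (U + x)
        from (s , ρ , ss , refl) = subst (Stage S m) eq (Stage-intro m g ss g<)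
          where
          open ≡-Reasoning
          open +-*-Solver
          g = ext (toℕ ∘ (ρ ⟨$⟩ʳ_))
          g< : ∀ c → c < m → g c < m
          g< c _ = ext< _ 1≤m (λ c → toℕ<n (ρ ⟨$⟩ʳ c)) c
          eq : s + (W * code g m + X * powers g m) ≡ U + (s + W * code g m)
          eq = begin
            s + (W * code g m + X * powers g m)     ≡⟨ solve 3 (λ s a b → s :+ (a :+ b) := b :+ (s :+ a)) refl s (W * code g m) (X * powers g m) ⟩
            X * powers g m + (s + W * code g m)     ≡⟨ cong (_+ (s + W * code g m)) (cong (X *_) (trans (powers-count g m g<) (code-cong m (permutation-count ρ)))) ⟩
            X * code (λ _ → 1) m + (s + W * code g m) ≡⟨ cong (_+ (s + W * code g m)) (sym (geometricSum-code m X)) ⟩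
            U + (s + W * code g m)                  ∎

-- A vote that puts p first, as a vector: its first entry counts the votes.

ballot : ∀ {m} → Permutation′ m → ℕ → ℕ
ballot ρ = cons 1 (ext (toℕ ∘ (ρ ⟨$⟩ʳ_)))

tally : ∀ {m} → List (Permutation′ m) → ℕ → ℕ
tally L i = sum (map (λ ρ → ballot ρ i) L)

ballot≤ : ∀ {m} → 1 ≤ m → (ρ : Permutation′ m) → ∀ i → ballot ρ i ≤ m
ballot≤ 1≤m ρ zero    = 1≤m
ballot≤ 1≤m ρ (suc i) = <⇒≤ (ext< _ 1≤m (λ c → toℕ<n (ρ ⟨$⟩ʳ c)) i)

tally≤ : ∀ {m} → 1 ≤ m → (L : List (Permutation′ m)) → ∀ i → tally L i ≤ length L * m
tally≤ 1≤m []      i = z≤n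
tally≤ 1≤m (ρ ∷ L) i = +-mono-≤ (ballot≤ 1≤m ρ i) (tally≤ 1≤m L i)

-- What the sets of one level contain

module Level (m W D N : ℕ) (1≤m : 1 ≤ m) (Nm<D : N * m < D) (W-large : D * 4 + 2 ≤ W) where
  open Codes m W D
  open CodeProperties m W D

  private
    D≤W : ∀ k → k ≤ 4 → D * k + 2 ≤ W
    D≤W k k≤4 = ≤-trans (+-monoˡ-≤ 2 (*-monoʳ-≤ D k≤4)) W-large

    2≤W : 2 ≤ W
    2≤W = ≤-trans (m≤n+m 2 (D * 4)) W-large

    m≤D : 0 < N → m ≤ D
    m≤D 0<N = ≤-trans (m≤n*m m N {{>-nonZero 0<N}}) (<⇒≤ Nm<D)

  module _ {S : ℕ → Set} (ds : Digits D S) (0<N : 0 < N) where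

    private
      m<W : m < W
      m<W = ≤-<-trans (m≤D 0<N) (≤-trans (≤-trans (≤-reflexive (trans (cong suc (sym (*-identityʳ D))) (+-comm 1 (D * 1)))) (+-monoʳ-≤ (D * 1) (s≤s z≤n))) (D≤W 1 (s≤s z≤n)))

    bound : ℕ → ℕ
    bound j = D + j * m

    bound≤ : ∀ j → j ≤ N → bound j + m + 2 ≤ W
    bound≤ j j≤N = ≤-trans (+-monoˡ-≤ 2 (≤-trans (+-mono-≤ (+-monoʳ-≤ D (≤-trans (*-monoˡ-≤ m j≤N) (<⇒≤ Nm<D))) (m≤D 0<N))
                     (≤-reflexive (solve 1 (λ d → d :+ d :+ d := d :* con 3) refl D)))) (D≤W 3 (s≤s (s≤s (s≤s z≤n))))
      where open +-*-Solver

    Reached : ℕ → ℕ → Set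
    Reached j y = ∃[ v ] ∃[ L ] (S (code v (suc m)) × (∀ i → i ≤ m → v i ≤ D) × length {A = Permutation′ m} L ≤ j ×
                                 y ≡ code (λ i → v i + tally L i) (suc m))

    code-ballot : ∀ v (ρ : Permutation′ m) → code v (suc m) + W * code (ext (toℕ ∘ (ρ ⟨$⟩ʳ_))) m + 1 ≡ code (λ i → v i + ballot ρ i) (suc m)
    code-ballot v ρ = trans (+-assoc (code v (suc m)) _ 1) (trans (cong (code v (suc m) +_) (trans (+-comm _ 1) (sym (code-cons (ballot ρ) m))))
                        (sym (code-+ v (ballot ρ) (suc m))))

    Reached-digits : ∀ j → Digits (bound j) (Reached j)
    Reached-digits j (v , L , _ , v≤ , L≤ , e) = (λ i → v i + tally L i) ,
      (λ i i≤m → +-mono-≤ (v≤ i i≤m) (≤-trans (tally≤ 1≤m L i) (*-monoˡ-≤ m L≤))) , e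

    <X : ∀ {B y} → B < W → (∃[ v ] ((∀ i → i ≤ m → v i ≤ B) × y ≡ code v (suc m))) → y < X
    <X B<W (v , v≤ , refl) = code< v (suc m) (λ i i<m → ≤-<-trans (v≤ i (s≤s⁻¹ i<m)) B<W)

    -- Proved together with `Votes-digits`: the digit bound for `j` votes is what permits
    -- `Stage-select` for the next one.
    Votes-reached : ∀ j → j ≤ N → ∀ y → Votes S j y ⇔ Reached j y

    Votes-digits : ∀ j → j ≤ N → Digits (bound j) (Votes S j)
    Votes-digits j j≤N vy = Reached-digits j (Equivalence.to (Votes-reached j j≤N _) vy)

    Votes-reached zero _ y = mk⇔ to from
      where
      to : S y → Reached zero y
      to sy with ds sy
      ... | v , v≤ , refl = v , [] , sy , v≤ , z≤n , code-cong (suc m) (λ i _ → sym (+-identityʳ (v i)))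
      from : Reached zero y → S y
      from (v , [] , sv , _ , _ , refl) = subst S (code-cong (suc m) (λ i _ → sym (+-identityʳ (v i)))) sv
    Votes-reached (suc j) j<N y = mk⇔ to from
      where
      j≤N = <⇒≤ j<N
      B+m≤W = ≤-trans (m≤m+n (bound j + m) 2) (bound≤ j j≤N)
      chosen : ∀ {x} → x < X → _
      chosen = Stage-select 1≤m B+m≤W m<W (Votes-digits j j≤N)
      more : Reached j y → Reached (suc j) y
      more (v , L , sv , v≤ , L≤ , e) = v , L , sv , v≤ , m≤n⇒m≤1+n L≤ , e
      to : Votes S (suc j) y → Reached (suc j) y
      to (inj₂ (x , _ , vx , refl)) = more (Equivalence.to (Votes-reached j j≤N _) (subst (Votes S j) (sym (+-identityʳ x)) vx))
      to (inj₁ (inj₂ (x , x<X , st , refl))) with Equivalence.to (chosen x<X) st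
      ... | s , ρ , vs , refl with Equivalence.to (Votes-reached j j≤N s) vs
      ...   | v , L , sv , v≤ , L≤ , refl = v , ρ ∷ L , sv , v≤ , s≤s L≤ ,
        trans (code-ballot _ ρ) (code-cong (suc m) (λ i _ → trans (+-assoc (v i) (tally L i) (ballot ρ i)) (cong (v i +_) (+-comm (tally L i) (ballot ρ i)))))
      keep-old : Reached j y → Votes S (suc j) y
      keep-old r = inj₂ (y , <X (≤-trans (s≤s (m≤m+n (bound j) m)) (≤-trans (≤-reflexive (+-comm 1 (bound j + m))) (≤-trans (+-monoʳ-≤ (bound j + m) (s≤s z≤n)) (bound≤ j j≤N)))) (Reached-digits j r) ,
                         Equivalence.from (Votes-reached j j≤N y) r , sym (+-identityʳ y))
      from : Reached (suc j) y → Votes S (suc j) y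
      from (v , [] , sv , v≤ , _ , e) = keep-old (v , [] , sv , v≤ , z≤n , e)
      from (v , ρ ∷ L , sv , v≤ , s≤s L≤ , refl) =
        inj₁ (inj₂ (x , x<X ,
                    Equivalence.from (chosen x<X) (s , ρ , Equivalence.from (Votes-reached j j≤N s) (v , L , sv , v≤ , L≤ , refl) , refl) , sym eq))
        where
        s = code (λ i → v i + tally L i) (suc m)
        x = s + W * code (ext (toℕ ∘ (ρ ⟨$⟩ʳ_))) m
        eq : x + 1 ≡ code (λ i → v i + tally (ρ ∷ L) i) (suc m)
        eq = trans (code-ballot _ ρ) (code-cong (suc m) (λ i _ → trans (+-assoc (v i) (tally L i) (ballot ρ i)) (cong (v i +_) (+-comm (tally L i) (ballot ρ i)))))
        bound< : bound (suc j) < W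
        bound< = ≤-trans (≤-trans (≤-reflexive (+-comm 1 (bound (suc j)))) (+-mono-≤ (m≤m+n (bound (suc j)) m) (s≤s z≤n))) (bound≤ (suc j) j<N)
        x<X : x < X
        x<X = <-≤-trans (subst (x <_) eq (≤-reflexive (+-comm 1 x))) (<⇒≤ (<X bound< (Reached-digits (suc j) {y} (v , ρ ∷ L , sv , v≤ , s≤s L≤ , refl))))

    Votes-Stage-below : ∀ j → j ≤ N → ∀ i → i ≤ m → Below Z (Stage (Votes S j) i)
    Votes-Stage-below j j≤N = Stage-below 1≤m (≤-trans (m≤m+n (bound j + m) 2) (bound≤ j j≤N)) m<W (Votes-digits j j≤N)

  -- Adding `(b + 2 * u) * w` back clears the truncated subtractions, which are exact because
  -- `b ≤ E` and `2 ≤ X`.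
  carry-shift : ∀ {b w} u → b ≤ 1 → 2 ≤ X → (E * w ∸ b * w) + u * (X * w ∸ 2 * w) + (b + 2 * u) * w ≡ E * w + X * (u * w)
  carry-shift {b} {w} u b≤1 2≤X = begin
    h + u * q + (b + 2 * u) * w          ≡⟨ solve 5 (λ h q u b w → h :+ u :* q :+ (b :+ con 2 :* u) :* w := h :+ b :* w :+ u :* (q :+ con 2 :* w)) refl h q u b w ⟩
    h + b * w + u * (q + 2 * w)          ≡⟨ cong₂ (λ x y → x + u * y) (m∸n+n≡m (*-monoˡ-≤ w (≤-trans b≤1 (s≤s (z≤n {D + D}))))) (m∸n+n≡m (*-monoˡ-≤ w 2≤X)) ⟩
    E * w + u * (X * w)                  ≡⟨ cong (E * w +_) (solve 3 (λ u x w → u :* (x :* w) := x :* (u :* w)) refl u X w) ⟩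
    E * w + X * (u * w)                  ∎
    where
    open ≡-Reasoning
    open +-*-Solver
    h = E * w ∸ b * w
    q = X * w ∸ 2 * w

  module _ {V : ℕ → Set} {B : ℕ} (dv : Digits B V) (B+E<W : B + suc E < W) (b : ℕ → ℕ) where

    private
      W≤X : W ≤ X
      W≤X = m≤m*n W (W ^ m) {{m^n≢0 W m {{>-nonZero (≤-trans (s≤s z≤n) B+E<W)}}}}

      2≤X : 2 ≤ X
      2≤X = ≤-trans 2≤W W≤X

      bit≤1 : ∀ i → b i % 2 ≤ 1
      bit≤1 i = s≤s⁻¹ (m%n<n (b i) 2)

    -- s is the original code, u the vector of the quotients and ε the slack.

    record Halving (i y s : ℕ) (u ε : ℕ → ℕ) : Set where
      field
        source   : V s
        u≤D      : ∀ l → u l ≤ D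
        ε≤1      : ∀ l → ε l ≤ 1
        ε₀       : ε 0 ≡ 0
        equation : y + code (λ l → b l % 2 + 2 * u l) i ≡ s + code (λ l → E + ε l) i + X * code u i

    private
      extend : ∀ {i y s u ε u′ ε′} → Halving i y s u ε → u′ ≤ D → ε′ ≤ 1 → (i ≡ 0 → ε′ ≡ 0) →
               Halving (suc i) (y + ε′ * W ^ i + ((E * W ^ i ∸ b i % 2 * W ^ i) + u′ * (X * W ^ i ∸ 2 * W ^ i))) s (u [ i ↦ u′ ]) (ε [ i ↦ ε′ ])
      extend {i} {y} {s} {u} {ε} {u′} {ε′} h u′≤ ε′≤ z = record
        { source = source ; u≤D = upd u u≤D u′≤ ; ε≤1 = upd ε ε≤1 ε′≤ ; ε₀ = zeroth i z
        ; equation = begin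
            y + ε′ * w + g + (code (λ l → b l % 2 + 2 * (u [ i ↦ u′ ]) l) i + (b i % 2 + 2 * (u [ i ↦ u′ ]) i) * w)
              ≡⟨ cong₂ (λ c d → y + ε′ * w + g + (c + (b i % 2 + 2 * d) * w)) (code-cong i (λ l l<i → cong (λ z → b l % 2 + 2 * z) (old u l l<i))) (update-≡ u i u′) ⟩
            y + ε′ * w + g + (c + (b i % 2 + 2 * u′) * w)
              ≡⟨ solve 5 (λ y e g c d → y :+ e :+ g :+ (c :+ d) := y :+ c :+ e :+ (g :+ d)) refl y (ε′ * w) g c ((b i % 2 + 2 * u′) * w) ⟩
            y + c + ε′ * w + (g + (b i % 2 + 2 * u′) * w)
              ≡⟨ cong₂ (λ x z → x + ε′ * w + z) equation (carry-shift u′ (bit≤1 i) 2≤X) ⟩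
            s + d + X * code u i + ε′ * w + (E * w + X * (u′ * w))
              ≡⟨ solve 8 (λ s d x k e w f v → s :+ d :+ x :* k :+ e :* w :+ (f :* w :+ x :* (v :* w)) := s :+ (d :+ (f :+ e) :* w) :+ x :* (k :+ v :* w)) refl s d X (code u i) ε′ w E u′ ⟩
            s + (d + (E + ε′) * w) + X * (code u i + u′ * w)
              ≡⟨ sym (cong₂ (λ p q → s + p + X * q)
                   (cong₂ (λ a e → a + (E + e) * w) (code-cong i (λ l l<i → cong (E +_) (old ε l l<i))) (update-≡ ε i ε′))
                   (cong₂ (λ a e → a + e * w) (code-cong i (old u)) (update-≡ u i u′))) ⟩
            s + code (λ l → E + (ε [ i ↦ ε′ ]) l) (suc i) + X * code (u [ i ↦ u′ ]) (suc i) ∎ }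
        where
        open Halving h
        open ≡-Reasoning
        open +-*-Solver
        w = W ^ i
        g = (E * w ∸ b i % 2 * w) + u′ * (X * w ∸ 2 * w)
        c = code (λ l → b l % 2 + 2 * u l) i
        d = code (λ l → E + ε l) i
        old : ∀ f {v} l → l < i → (f [ i ↦ v ]) l ≡ f l
        old f l l<i = update-≢ f i _ (<⇒≢ l<i)
        upd : ∀ {k v} f → (∀ l → f l ≤ k) → v ≤ k → ∀ l → (f [ i ↦ v ]) l ≤ k
        upd {v = v} f f≤ v≤ l with l ≟ i
        ... | yes refl = ≤-trans (≤-reflexive (update-≡ f i v)) v≤
        ... | no ne = ≤-trans (≤-reflexive (update-≢ f i v ne)) (f≤ l)
        zeroth : ∀ i → (i ≡ 0 → ε′ ≡ 0) → (ε [ i ↦ ε′ ]) 0 ≡ 0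
        zeroth zero    z = z refl
        zeroth (suc i) z = ε₀

      start : ∀ {s} → V s → Halving 0 s s (λ _ → 0) (λ _ → 0)
      start {s} vs = record
        { source = vs ; u≤D = λ _ → z≤n ; ε≤1 = λ _ → z≤n ; ε₀ = refl
        ; equation = sym (cong₂ _+_ (+-identityʳ s) (*-zeroʳ X)) }

      slack-elim : ∀ {S w y} → Slack S w y → ∃[ x ] ∃[ ε ] (ε ≤ 1 × S x × y ≡ x + ε * w)
      slack-elim (inj₁ (inj₂ (x , _ , sx , e))) = x , 0 , z≤n , sx , e
      slack-elim {w = w} (inj₂ (x , _ , sx , e)) = x , 1 , s≤s z≤n , sx , trans e (cong (x +_) (sym (*-identityˡ w)))

      slack-intro : ∀ {S w x} ε → Below Z S → ε ≤ 1 → S x → Slack S w (x + ε * w)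
      slack-intro {x = x} zero bl _ sx = inj₁ (inj₂ (x , bl sx , sx , refl))
      slack-intro {w = w} {x} (suc zero) bl _ sx = inj₂ (x , bl sx , sx , cong (x +_) (*-identityˡ w))
      slack-intro (suc (suc _)) bl (s≤s ()) sx

    Halves-elim : ∀ i {y} → Halves V b i y → ∃[ s ] ∃[ u ] ∃[ ε ] Halving (suc i) y s u ε
    Halves-elim zero (x , u′ , u′< , vx , refl) = x , _ , _ ,
      subst (λ z → Halving 1 (z + g) x ((λ _ → 0) [ 0 ↦ u′ ]) ((λ _ → 0) [ 0 ↦ 0 ])) (+-identityʳ x) (extend (start vx) (s≤s⁻¹ u′<) z≤n (λ _ → refl))
      where
      g : ℕ
      g = (E * 1 ∸ b 0 % 2 * 1) + u′ * (X * 1 ∸ 2 * 1)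
    Halves-elim (suc i) (x , u′ , u′< , sx , refl) with slack-elim sx
    ... | x₀ , ε′ , ε′≤ , hx , refl with Halves-elim i hx
    ...   | s , u , ε , h = s , _ , _ , extend h (s≤s⁻¹ u′<) ε′≤ (λ ())

    private
      -- Here `B + suc E < W` does its work: a digit raised by `E` and a slack bit still fits.
      raised< : ∀ {s} {ε : ℕ → ℕ} i → i ≤ m → V s → (∀ l → ε l ≤ 1) → s + code (λ l → E + ε l) (suc i) < X
      raised< {s} {ε} i i≤m vs ε≤ with dv vs
      ... | v , v≤ , refl = subst (_< X) (trans (code-+ v e (suc m)) (cong (code v (suc m) +_) (trans (cong (code e) (sym (m∸n+n≡m (s≤s i≤m)))) (code-cutoff _ (suc i) (m ∸ i)))))
              (code< (λ l → v l + e l) (suc m) (λ l l< → ≤-<-trans (+-mono-≤ (v≤ l (s≤s⁻¹ l<)) (e≤ l)) B+E<W))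
        where
        e = cutoff (λ l → E + ε l) (suc i)
        e≤ : ∀ l → e l ≤ suc E
        e≤ l with l <? suc i
        ... | yes _ = ≤-trans (+-monoʳ-≤ E (ε≤ l)) (≤-reflexive (+-comm E 1))
        ... | no _ = z≤n

      E<W : E < W
      E<W = ≤-<-trans (≤-trans (n≤1+n E) (m≤n+m (suc E) B)) B+E<W

      quotient< : ∀ {u : ℕ → ℕ} i → i ≤ m → (∀ l → u l ≤ D) → code u (suc i) < X
      quotient< {u} i i≤m u≤ = <-≤-trans (code< u (suc i) (λ l _ → ≤-<-trans (≤-trans (u≤ l) (≤-trans (m≤m+n D D) (n≤1+n (D + D)))) E<W))
        (^-monoʳ-≤ W {{>-nonZero (≤-trans (s≤s z≤n) E<W)}} (s≤s i≤m))

    Halves-below : ∀ i → i ≤ m → Below Z (Halves V b i)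
    Halves-below i i≤m {y} hy with Halves-elim i hy
    ... | s , u , ε , h = begin-strict
      y                                                        ≤⟨ m≤m+n y _ ⟩
      y + code (λ l → b l % 2 + 2 * u l) (suc i)               ≡⟨ equation ⟩
      s + code (λ l → E + ε l) (suc i) + X * code u (suc i)    <⟨ +-monoˡ-< _ (raised< i i≤m source ε≤1) ⟩
      X + X * code u (suc i)                                   ≡⟨ sym (*-suc X _) ⟩
      X * suc (code u (suc i))                                 ≤⟨ *-monoʳ-≤ X (quotient< i i≤m u≤D) ⟩
      X * X                                                    ∎
      where
      open Halving h
      open ≤-Reasoning

    -- Guessing the quotient 0 moves a slackened code, if at all, upwards to a member of `Halves` at
    -- the next coordinate, which is already known to lie below `Z`.
    Slack-below : ∀ i → i < m → Below Z (Slack (Halves V b i) (W ^ suc i))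
    Slack-below i i<m {y} sy with slack-elim sy
    ... | x , ε′ , ε′≤ , hx , refl with Halves-elim i hx
    ...   | s , u , ε , h = ≤-<-trans (m≤m+n _ _) (Halves-below (suc i) i<m (_ , 0 , s≤s z≤n , sy , refl))

    Halves-intro : ∀ i → i ≤ m → ∀ {s} {u ε : ℕ → ℕ} → V s → (∀ l → u l ≤ D) → (∀ l → ε l ≤ 1) → ε 0 ≡ 0 →
                   ∃[ y ] (Halves V b i y × y + code (λ l → b l % 2 + 2 * u l) (suc i) ≡ s + code (λ l → E + ε l) (suc i) + X * code u (suc i))
    Halves-intro zero _ {s} {u} {ε} vs u≤ ε≤ ε₀ = _ , (s , u 0 , s≤s (u≤ 0) , vs , refl) ,
      trans (+-assoc s (E * 1 ∸ b 0 % 2 * 1 + u 0 * (X * 1 ∸ 2 * 1)) ((b 0 % 2 + 2 * u 0) * 1)) (trans (cong (s +_) (trans (carry-shift (u 0) (bit≤1 0) 2≤X) (cong (λ e → e * 1 + X * (u 0 * 1)) (trans (sym (+-identityʳ E)) (cong (E +_) (sym ε₀))))))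
        (sym (+-assoc s _ _)))
    Halves-intro (suc i) i<m {s} {u} {ε} vs u≤ ε≤ ε₀ with Halves-intro i (<⇒≤ i<m) {s} {u} {ε} vs u≤ ε≤ ε₀
    ... | y , hy , eq = _ , (y + ε (suc i) * w , u (suc i) , s≤s (u≤ (suc i)) , slack-intro (ε (suc i)) (Halves-below i (<⇒≤ i<m)) (ε≤ (suc i)) hy , refl) , (begin
      y + ε (suc i) * w + g + (c + (b (suc i) % 2 + 2 * u (suc i)) * w)
        ≡⟨ solve 5 (λ y e g c d → y :+ e :+ g :+ (c :+ d) := y :+ c :+ e :+ (g :+ d)) refl y (ε (suc i) * w) g c ((b (suc i) % 2 + 2 * u (suc i)) * w) ⟩
      y + c + ε (suc i) * w + (g + (b (suc i) % 2 + 2 * u (suc i)) * w)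
        ≡⟨ cong₂ (λ x z → x + ε (suc i) * w + z) eq (carry-shift (u (suc i)) (bit≤1 (suc i)) 2≤X) ⟩
      s + d + X * code u (suc i) + ε (suc i) * w + (E * w + X * (u (suc i) * w))
        ≡⟨ solve 8 (λ s d x k e w f v → s :+ d :+ x :* k :+ e :* w :+ (f :* w :+ x :* (v :* w)) := s :+ (d :+ (f :+ e) :* w) :+ x :* (k :+ v :* w)) refl s d X (code u (suc i)) (ε (suc i)) w E (u (suc i)) ⟩
      s + (d + (E + ε (suc i)) * w) + X * (code u (suc i) + u (suc i) * w) ∎)
      where
      open ≡-Reasoning
      open +-*-Solver
      w = W ^ suc i
      g = (E * w ∸ b (suc i) % 2 * w) + u (suc i) * (X * w ∸ 2 * w)
      c = code (λ l → b l % 2 + 2 * u l) (suc i)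
      d = code (λ l → E + ε l) (suc i)

    -- Column addition in binary: `v + ε` must end in the current digit of `b`, and `u` is carried
    -- over.
    Halved-to : ℕ → Set
    Halved-to x = ∃[ v ] ∃[ u ] Σ[ ε ∈ (ℕ → ℕ) ] (V (code v (suc m)) × x ≡ code u (suc m) × (∀ l → u l ≤ D) × (∀ l → ε l ≤ 1) × ε 0 ≡ 0 ×
                    (∀ l → l ≤ m → b l % 2 + 2 * u l ≡ v l + ε l))

    -- After the digits `E` are cancelled, both lower parts lie below `X`. Uniqueness of division by
    -- `X` identifies `x` with the quotients, and `code-injective` compares the lower parts digit by
    -- digit.
    selected-elim : ∀ {x} → Halves V b m (code (λ _ → E) (suc m) + X * x) → Halved-to x
    selected-elim {x} hx with Halves-elim m hx
    ... | s , u , ε , h with dv (Halving.source h)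
    ...   | v , v≤ , refl = v , u , ε , source , proj₂ split , u≤D , ε≤1 , ε₀ ,
      λ l l≤m → code-injective (λ l → b l % 2 + 2 * u l) (λ l → v l + ε l) (suc m) (λ l _ → digit< l)
        (λ l l< → ≤-<-trans (≤-trans (+-mono-≤ (v≤ l (s≤s⁻¹ l<)) (ε≤1 l)) (+-monoʳ-≤ B (s≤s z≤n))) B+E<W)
        (trans (proj₁ split) (sym (code-+ v ε (suc m)))) l (s≤s l≤m)
      where
      open Halving h
      open +-*-Solver
      digit< : ∀ l → b l % 2 + 2 * u l < W
      digit< l = ≤-<-trans (≤-trans (+-mono-≤ (bit≤1 l) (*-monoʳ-≤ 2 (u≤D l))) (≤-reflexive (cong (λ z → suc (D + z)) (+-identityʳ D)))) E<W
      EE = code (λ _ → E) (suc m)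
      split : code (λ l → b l % 2 + 2 * u l) (suc m) ≡ code v (suc m) + code ε (suc m) × x ≡ code u (suc m)
      split = remainder-unique {d = X} (code< _ (suc m) (λ l _ → digit< l))
        (≤-<-trans (+-monoʳ-≤ (code v (suc m)) (≤-trans (m≤n+m (code ε (suc m)) EE) (≤-reflexive (sym (code-+ (λ _ → E) ε (suc m)))))) (raised< m ≤-refl source ε≤1))
        (+-cancelˡ-≡ EE _ _ (trans (solve 4 (λ e c x y → e :+ (c :+ y :* x) := e :+ x :* y :+ c) refl EE (code (λ l → b l % 2 + 2 * u l) (suc m)) X x)
          (trans equation (trans (cong (λ z → code v (suc m) + z + X * code u (suc m)) (code-+ (λ _ → E) ε (suc m)))
            (solve 5 (λ s e f x y → s :+ (e :+ f) :+ x :* y := e :+ (s :+ f :+ y :* x)) refl (code v (suc m)) EE (code ε (suc m)) X (code u (suc m)))))))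

    selected-intro : ∀ {x} → Halved-to x → x < X × Halves V b m (code (λ _ → E) (suc m) + X * x)
    selected-intro (v , u , ε , vv , refl , u≤ , ε≤ , ε₀ , eq) with Halves-intro m ≤-refl {code v (suc m)} {u} {ε} vv u≤ ε≤ ε₀
    ... | y , hy , e = quotient< m ≤-refl u≤ , subst (Halves V b m) (+-cancelʳ-≡ c y (EE + X * code u (suc m)) (trans e (begin
      code v (suc m) + code (λ l → E + ε l) (suc m) + X * code u (suc m)
        ≡⟨ cong (λ z → code v (suc m) + z + X * code u (suc m)) (code-+ (λ _ → E) ε (suc m)) ⟩
      code v (suc m) + (EE + code ε (suc m)) + X * code u (suc m)
        ≡⟨ solve 4 (λ v e f x → v :+ (e :+ f) :+ x := e :+ x :+ (v :+ f)) refl (code v (suc m)) EE (code ε (suc m)) (X * code u (suc m)) ⟩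
      EE + X * code u (suc m) + (code v (suc m) + code ε (suc m))
        ≡⟨ cong (EE + X * code u (suc m) +_) (trans (sym (code-+ v ε (suc m))) (sym (code-cong (suc m) (λ l l< → eq l (s≤s⁻¹ l<))))) ⟩
      EE + X * code u (suc m) + c ∎))) hy
      where
      open ≡-Reasoning
      open +-*-Solver
      EE = code (λ _ → E) (suc m)
      c = code (λ l → b l % 2 + 2 * u l) (suc m)

-- Pairing off equal votes

ext-cong : ∀ {k} {f g : Fin k → ℕ} → (∀ c → f c ≡ g c) → ∀ i → ext f i ≡ ext g i
ext-cong {zero}  e i       = refl
ext-cong {suc k} e zero    = e zero
ext-cong {suc k} e (suc i) = ext-cong (e ∘ suc) i

extract : ∀ {A : Set} (L : List A) i → ∃[ L′ ] (suc (length L′) ≡ length L × (∀ (g : A → ℕ) → sum (map g L) ≡ g (lookup L i) + sum (map g L′)))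
extract (x ∷ L) zero = L , refl , λ g → refl
extract (x ∷ L) (suc i) with extract L i
... | L′ , len , e = x ∷ L′ , cong suc len , λ g → trans (cong (g x +_) (e g)) (x∙yz≈y∙xz (g x) (g (lookup L i)) (sum (map g L′)))
  where open import Algebra.Properties.CommutativeSemigroup +-commutativeSemigroup using (x∙yz≈y∙xz)

extract-two : ∀ {A : Set} (L : List A) {i j} → toℕ i < toℕ j → ∃[ L′ ] (suc (suc (length L′)) ≡ length L ×
                (∀ (g : A → ℕ) → sum (map g L) ≡ g (lookup L i) + (g (lookup L j) + sum (map g L′))))
extract-two (x ∷ L) {zero} {suc j} _ with extract L j
... | L′ , len , e = L′ , cong suc len , λ g → cong (g x +_) (e g)
extract-two (x ∷ L) {suc i} {suc j} (s≤s i<j) with extract-two L i<j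
... | L′ , len , e = x ∷ L′ , cong suc len , λ g → trans (cong (g x +_) (e g))
  (solve 4 (λ x a b s → x :+ (a :+ (b :+ s)) := a :+ (b :+ (x :+ s))) refl (g x) (g (lookup L i)) (g (lookup L j)) (sum (map g L′)))
  where open +-*-Solver

-- By the pigeonhole principle, equal votes can be paired off until at most m ^ m
-- votes remain.

halve-votes : ∀ {m} (L : List (Permutation′ m)) → ∃[ K ] Σ[ R ∈ List (Permutation′ m) ]
              (length R ≤ m ^ m × (∀ i → tally L i ≡ tally R i + 2 * tally K i))
halve-votes {m} L = go (length L) L ≤-refl
  where
  go : ∀ n L → length L ≤ n → ∃[ K ] Σ[ R ∈ List (Permutation′ m) ] (length R ≤ m ^ m × (∀ i → tally L i ≡ tally R i + 2 * tally K i))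
  go n L L≤n with length L ≤? m ^ m
  ... | yes small = [] , L , small , λ i → sym (+-identityʳ (tally L i))
  go zero    L L≤n | no large = ⊥-elim (large (≤-trans L≤n z≤n))
  -- The pigeonholes are all `m ^ m` maps of `Fin m` to itself, numbered by `funToFin`.
  go (suc n) L L≤n | no large with pigeonhole (≰⇒> large) (λ i → funToFin (lookup L i ⟨$⟩ʳ_))
  ... | i , j , i<j , same with extract-two L i<j
  ...   | L′ , len , e with go n L′ (s≤s⁻¹ (≤-trans (n≤1+n _) (≤-trans (≤-reflexive len) L≤n)))
  ...     | K , R , R≤ , t = lookup L i ∷ K , R , R≤ , λ x → begin
    tally L x                                                      ≡⟨ e (λ ρ → ballot ρ x) ⟩
    ballot (lookup L i) x + (ballot (lookup L j) x + tally L′ x)   ≡⟨ cong₂ (λ a b → ballot (lookup L i) x + (a + b)) (sym (ballots≡ x)) (t x) ⟩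
    ballot (lookup L i) x + (ballot (lookup L i) x + (tally R x + 2 * tally K x))
      ≡⟨ solve 3 (λ b r k → b :+ (b :+ (r :+ con 2 :* k)) := r :+ con 2 :* (b :+ k)) refl (ballot (lookup L i) x) (tally R x) (tally K x) ⟩
    tally R x + 2 * (ballot (lookup L i) x + tally K x)            ∎
    where
    open ≡-Reasoning
    open +-*-Solver
    pointwise : ∀ c → lookup L i ⟨$⟩ʳ c ≡ lookup L j ⟨$⟩ʳ c
    pointwise c = trans (sym (finToFun-funToFin (lookup L i ⟨$⟩ʳ_) c)) (trans (cong (λ f → finToFun f c) same) (finToFun-funToFin (lookup L j ⟨$⟩ʳ_) c))
    ballots≡ : ∀ x → ballot (lookup L i) x ≡ ballot (lookup L j) x
    ballots≡ zero    = refl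
    ballots≡ (suc x) = ext-cong (λ c → cong toℕ (pointwise c)) x

tally-++ : ∀ {m} (K L : List (Permutation′ m)) i → tally (K ++ L) i ≡ tally K i + tally L i
tally-++ []      L i = refl
tally-++ (ρ ∷ K) L i = trans (cong (ballot ρ i +_) (tally-++ K L i)) (sym (+-assoc (ballot ρ i) (tally K i) (tally L i)))

-- Passing from one binary digit to the next

module Correct (m W D N : ℕ) (1≤m : 1 ≤ m) (m^m≤N : m ^ m ≤ N) (Nm<D : N * m < D) (W-large : D * 4 + 2 ≤ W) where
  open Codes m W D
  open CodeProperties m W D
  open Level m W D N 1≤m Nm<D W-large

  -- The carry coded by `x`, further votes `L` and a slack `s` make up the remaining target `b`.
  -- There is no slack in coordinate 0, where the votes are counted.
  Solvable : (ℕ → ℕ) → ℕ → Set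
  Solvable b x = ∃[ v ] ∃[ L ] Σ[ s ∈ (ℕ → ℕ) ] (x ≡ code v (suc m) × (∀ i → i ≤ m → v i ≤ D) × s 0 ≡ 0 ×
                   (∀ i → i ≤ m → v i + tally {m} L i + s i ≡ b i))

  Completable : (ℕ → Set) → (ℕ → ℕ) → Set
  Completable S b = ∃[ x ] (S x × Solvable b x)

  private
    0<N : 0 < N
    0<N = ≤-trans (m^n>0 m {{>-nonZero 1≤m}} m) m^m≤N

    divide : ∀ q r → (r + 2 * q) % 2 ≡ r % 2 × (r + 2 * q) / 2 ≡ r / 2 + q
    divide q r = trans (cong (λ z → (r + z) % 2) (*-comm 2 q)) ([m+kn]%n≡m%n r q 2) ,
      trans (cong (λ z → (r + z) / 2) (*-comm 2 q)) (trans (+-distrib-/-∣ʳ r (divides q refl)) (cong (r / 2 +_) (m*n/n≡m q 2)))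

    rebuild : ∀ x → x ≡ x % 2 + 2 * (x / 2)
    rebuild x = trans (m≡m%n+[m/n]*n x 2) (cong (x % 2 +_) (*-comm (x / 2) 2))

    cutoff-< : ∀ g k {i} → i < k → cutoff g k i ≡ g i
    cutoff-< g k {i} i<k with i <? k
    ... | yes _ = refl
    ... | no i≮k = ⊥-elim (i≮k i<k)

    2D+1<W : D + D + 1 < W
    2D+1<W = ≤-trans (≤-trans (≤-reflexive (solve 1 (λ d → con 1 :+ (d :+ d :+ con 1) := d :* con 2 :+ con 2) refl D))
               (+-monoˡ-≤ 2 (*-monoʳ-≤ D {2} {4} (s≤s (s≤s z≤n))))) W-large
      where open +-*-Solver

  -- `bound` is taken at the empty set and equals `D + N * m`, so the left side is less than
  -- `D * 4 + 2`.
  B+E<W : bound {λ _ → ⊥} (λ ()) 0<N N + suc E < W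
  B+E<W = ≤-trans (≤-trans (≤-reflexive (sym (+-suc (D + N * m) (suc E))))
            (≤-trans (≤-reflexive (solve 2 (λ d n → d :+ n :+ (con 3 :+ (d :+ d)) := con 1 :+ n :+ (d :+ d :+ d :+ con 2)) refl D (N * m)))
              (≤-trans (+-monoˡ-≤ (D + D + D + 2) Nm<D) (≤-reflexive (solve 1 (λ d → d :+ (d :+ d :+ d :+ con 2) := d :* con 4 :+ con 2) refl D))))) W-large
    where open +-*-Solver

  module _ {S : ℕ → Set} (ds : Digits D S) (b : ℕ → ℕ) where

    private
      dv : Digits (D + N * m) (Votes S N)
      dv = Votes-digits ds 0<N N ≤-refl

    Next-digits : Digits D (Next N S b)
    Next-digits (inj₂ (x , _ , hx , refl)) with selected-elim dv B+E<W b hx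
    ... | v , u , ε , _ , e , u≤ , _ = u , (λ i _ → u≤ i) , trans (+-identityʳ x) e

    -- With the votes split as `R` and twice `K`, and the slack into its last bit and twice its
    -- half, this digit deals with `R` and the bits. Half of `r`, the old carry with these, is the
    -- new carry, and `K` and the halved slack remain. The carry stays within `D` because `r` is at
    -- most `D + N * m + 1 ≤ D * 2`.
    forward : Completable S b → Completable (Next N S b) (λ i → b i / 2)
    forward (x , sx , v , L , s , refl , v≤ , s₀ , eq) with halve-votes L
    ... | K , R , R≤ , t = code u (suc m) , inj₂ (code u (suc m) , proj₁ sel , proj₂ sel , sym (+-identityʳ _)) ,
      u , K , (λ i → s i / 2) , refl , (λ i _ → u≤ i) , cong (_/ 2) s₀ ,
      λ i i≤m → trans (trans (cong (λ z → z + tally K i + s i / 2) (cutoff-< _ (suc m) (s≤s i≤m)))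
                  (trans (+-assoc (r i / 2) (tally K i) (s i / 2)) (sym (proj₂ (divide (tally K i + s i / 2) (r i)))))) (cong (_/ 2) (sum-eq i i≤m))
      where
      r u : ℕ → ℕ
      r i = v i + tally R i + s i % 2
      -- `Halved-to` bounds `u` at every index, whereas `r` is bounded only up to `m`.
      u = cutoff (λ i → r i / 2) (suc m)
      bit≤1 : ∀ i → s i % 2 ≤ 1
      bit≤1 i = s≤s⁻¹ (m%n<n (s i) 2)
      r≤ : ∀ i → i ≤ m → r i ≤ D * 2
      r≤ i i≤m = ≤-trans (+-mono-≤ (+-mono-≤ (v≤ i i≤m) (≤-trans (tally≤ 1≤m R i) (*-monoˡ-≤ m (≤-trans R≤ m^m≤N)))) (bit≤1 i))
        (≤-trans (≤-reflexive (trans (+-assoc D (N * m) 1) (cong (D +_) (+-comm (N * m) 1))))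
          (≤-trans (+-monoʳ-≤ D Nm<D) (≤-reflexive (trans (cong (D +_) (sym (+-identityʳ D))) (*-comm 2 D)))))
      u≤ : ∀ i → u i ≤ D
      u≤ i with i <? suc m
      ... | yes i< = ≤-trans (/-monoˡ-≤ 2 (r≤ i (s≤s⁻¹ i<))) (≤-reflexive (m*n/n≡m D 2))
      ... | no _ = z≤n
      sum-eq : ∀ i → i ≤ m → r i + 2 * (tally K i + s i / 2) ≡ b i
      sum-eq i i≤m = trans (solve 5 (λ v t e k h → v :+ t :+ e :+ con 2 :* (k :+ h) := v :+ (t :+ con 2 :* k) :+ (e :+ con 2 :* h)) refl (v i) (tally R i) (s i % 2) (tally K i) (s i / 2))
        (trans (cong₂ (λ x y → v i + x + y) (sym (t i)) (sym (rebuild (s i)))) (eq i i≤m))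
        where open +-*-Solver
      sel : code u (suc m) < X × Halves (Votes S N) b m (code (λ _ → E) (suc m) + X * code u (suc m))
      sel = selected-intro dv B+E<W b ((λ i → v i + tally R i) , u , (λ i → s i % 2) ,
        Equivalence.from (Votes-reached ds 0<N N ≤-refl _) (v , R , sx , v≤ , ≤-trans R≤ m^m≤N , refl) ,
        refl , u≤ , bit≤1 , cong (_% 2) s₀ ,
        λ i i≤m → trans (cong₂ (λ x y → x + 2 * y) (trans (cong (_% 2) (sym (sum-eq i i≤m))) (proj₁ (divide (tally K i + s i / 2) (r i)))) (cutoff-< _ (suc m) (s≤s i≤m)))
                        (sym (rebuild (r i))))

    -- A vote for the higher digits counts twice here, hence `L ++ L`, and so does the slack. The
    -- carries on both sides agree since their codes do and their entries are below `W`.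
    backward : Completable (Next N S b) (λ i → b i / 2) → Completable S b
    backward (_ , inj₂ (x , _ , hx , refl) , v′ , L , s , ex , v′≤ , s₀ , eq) with selected-elim dv B+E<W b hx
    ... | v̂ , u , ε , vv , eu , u≤ , ε≤ , ε₀ , digit with Equivalence.to (Votes-reached ds 0<N N ≤-refl _) vv
    ...   | v , R , sv , v≤ , R≤ , ev = code v (suc m) , sv , v , R ++ (L ++ L) , (λ i → ε i + 2 * s i) , refl , v≤ ,
      cong₂ (λ x y → x + 2 * y) ε₀ s₀ , λ i i≤m → begin
        v i + tally (R ++ (L ++ L)) i + (ε i + 2 * s i)
          ≡⟨ cong (λ z → v i + z + (ε i + 2 * s i)) (trans (tally-++ R (L ++ L) i) (cong (tally R i +_) (tally-++ L L i))) ⟩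
        v i + (tally R i + (tally L i + tally L i)) + (ε i + 2 * s i)
          ≡⟨ solve 5 (λ v r l e s → v :+ (r :+ (l :+ l)) :+ (e :+ con 2 :* s) := v :+ r :+ e :+ con 2 :* (l :+ s)) refl (v i) (tally R i) (tally L i) (ε i) (s i) ⟩
        v i + tally R i + ε i + 2 * (tally L i + s i)
          ≡⟨ cong (_+ 2 * (tally L i + s i)) (trans (cong (_+ ε i) (sym (v̂≡ i i≤m))) (sym (digit i i≤m))) ⟩
        b i % 2 + 2 * u i + 2 * (tally L i + s i)
          ≡⟨ solve 4 (λ b u l s → b :+ con 2 :* u :+ con 2 :* (l :+ s) := b :+ con 2 :* (u :+ l :+ s)) refl (b i % 2) (u i) (tally L i) (s i) ⟩
        b i % 2 + 2 * (u i + tally L i + s i)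
          ≡⟨ cong (λ z → b i % 2 + 2 * z) (trans (cong (λ z → z + tally L i + s i) (sym (v′≡ i i≤m))) (eq i i≤m)) ⟩
        b i % 2 + 2 * (b i / 2)
          ≡⟨ sym (rebuild (b i)) ⟩
        b i ∎
      where
      open ≡-Reasoning
      open +-*-Solver
      D<W : D < W
      D<W = ≤-<-trans (≤-trans (m≤m+n D D) (m≤m+n (D + D) 1)) 2D+1<W
      v′≡ : ∀ i → i ≤ m → v′ i ≡ u i
      v′≡ i i≤m = code-injective v′ u (suc m) (λ i i< → ≤-<-trans (v′≤ i (s≤s⁻¹ i<)) D<W) (λ i _ → ≤-<-trans (u≤ i) D<W)
        (trans (sym ex) (trans (+-identityʳ x) eu)) i (s≤s i≤m)
      v̂≡ : ∀ i → i ≤ m → v̂ i ≡ v i + tally R i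
      v̂≡ i i≤m = code-injective v̂ (λ i → v i + tally R i) (suc m)
        (λ i i< → ≤-<-trans (≤-trans (m≤m+n (v̂ i) (ε i)) (≤-trans (≤-reflexive (sym (digit i (s≤s⁻¹ i<))))
          (≤-trans (+-mono-≤ (s≤s⁻¹ (m%n<n (b i) 2)) (*-monoʳ-≤ 2 (u≤ i))) (≤-reflexive (solve 1 (λ d → con 1 :+ con 2 :* d := d :+ d :+ con 1) refl D))))) 2D+1<W)
        (λ i i< → ≤-<-trans (+-mono-≤ (v≤ i (s≤s⁻¹ i<)) (≤-trans (≤-trans (tally≤ 1≤m R i) (*-monoˡ-≤ m R≤)) (<⇒≤ Nm<D)))
          (≤-<-trans (m≤m+n (D + D) 1) 2D+1<W))
        ev i (s≤s i≤m)

  -- A sum of naturals that vanishes has only zero summands, so the carry itself must be 0.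
  Completable-0 : ∀ {S} → Digits D S → Completable S (λ _ → 0) ⇔ S 0
  Completable-0 {S} ds = mk⇔
    (λ { (x , sx , v , L , s , refl , _ , _ , eq) → subst S (trans (code-cong (suc m) (λ i i< → m+n≡0⇒m≡0 (v i) (m+n≡0⇒m≡0 (v i + tally L i) (eq i (s≤s⁻¹ i<))))) (code-0 (suc m))) sx })
    (λ s0 → 0 , s0 , (λ _ → 0) , [] , (λ _ → 0) , sym (code-0 (suc m)) , (λ _ _ → z≤n) , refl , λ _ _ → refl)

  Completable-cong : ∀ {S b b′} → (∀ i → i ≤ m → b i ≡ b′ i) → Completable S b → Completable S b′
  Completable-cong e (x , sx , v , L , s , ex , v≤ , s₀ , eq) = x , sx , v , L , s , ex , v≤ , s₀ , λ i i≤m → trans (eq i i≤m) (e i i≤m)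

-- The input word in memory

cells-++ˡ : ∀ xs ys {i} → i < length xs → cells (xs ++ ys) i ≡ cells xs i
cells-++ˡ (x ∷ xs) ys {zero}  _         = refl
cells-++ˡ (x ∷ xs) ys {suc i} (s≤s i<n) = cells-++ˡ xs ys i<n

cells-++ʳ : ∀ xs ys i → cells (xs ++ ys) (length xs + i) ≡ cells ys i
cells-++ʳ []       ys i = refl
cells-++ʳ (x ∷ xs) ys i = cells-++ʳ xs ys i

cells-tabulate : ∀ {k} (f : Fin k → ℕ) c → cells (tabulate f) (toℕ c) ≡ f c
cells-tabulate f zero    = refl
cells-tabulate f (suc c) = cells-tabulate (f ∘ suc) c

cells≤ : ∀ {B} xs → (∀ i → cells xs i ≤ B) → ∀ {x} → x ≤ B → ∀ i → cells (x ∷ xs) i ≤ B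
cells≤ xs h x≤ zero    = x≤
cells≤ xs h x≤ (suc i) = h i

cells-tabulate≤ : ∀ {k B} (f : Fin k → ℕ) → (∀ c → f c ≤ B) → ∀ {ys} → (∀ i → cells ys i ≤ B) → ∀ i → cells (tabulate f ++ ys) i ≤ B
cells-tabulate≤ {zero}  f f≤ h i       = h i
cells-tabulate≤ {suc k} f f≤ h zero    = f≤ zero
cells-tabulate≤ {suc k} f f≤ h (suc i) = cells-tabulate≤ (f ∘ suc) (f≤ ∘ suc) h i

toℕ-punchIn : ∀ {n} (i : Fin (suc n)) j → toℕ j ≤ toℕ (punchIn i j)
toℕ-punchIn zero    j       = n≤1+n (toℕ j)
toℕ-punchIn (suc i) zero    = z≤n
toℕ-punchIn (suc i) (suc j) = s≤s (toℕ-punchIn i j)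

toℕ-punchIn-last : ∀ {n} (j : Fin n) → toℕ (punchIn (fromℕ n) j) ≡ toℕ j
toℕ-punchIn-last zero    = refl
toℕ-punchIn-last (suc j) = cong suc (toℕ-punchIn-last j)

-- Votes, their positions and p on top

module _ {m : ℕ} where

  positions : List (Vote m) → List ℕ
  positions = concatMap (λ π → map (position π) (allFin (suc m)))

  position≤ : (π : Vote m) (c : Candidate m) → position π c ≤ suc m
  position≤ π c = toℕ<n (π ⟨$⟩ʳ c)

  positions≤ : (vs : List (Vote m)) → ∀ i → cells (positions vs) i ≤ suc m
  positions≤ []       i = z≤n
  positions≤ (π ∷ vs) i = subst (λ l → cells (l ++ positions vs) i ≤ suc m) (sym (map-tabulate id (position π)))
    (cells-tabulate≤ (position π) (position≤ π) (positions≤ vs) i)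

  positionSum : List (Vote m) → Candidate m → ℕ
  positionSum vs c = sum (map (λ π → position π c) vs)

  positionSum-score : (vs : List (Vote m)) → ∀ c → positionSum vs c ≡ length vs + totalScore vs c
  positionSum-score []       c = refl
  positionSum-score (π ∷ vs) c = cong suc (trans (cong (toℕ (π ⟨$⟩ʳ c) +_) (positionSum-score vs c))
    (solve 3 (λ a b c → a :+ (b :+ c) := b :+ (a :+ c)) refl (toℕ (π ⟨$⟩ʳ c)) (length vs) (totalScore vs c)))
    where open +-*-Solver

  positionSum≤ : (vs : List (Vote m)) → ∀ c → positionSum vs c ≤ length vs * suc m
  positionSum≤ []       c = z≤n
  positionSum≤ (π ∷ vs) c = +-mono-≤ (position≤ π c) (positionSum≤ vs c)

  -- The memory seen from `a` agrees with the list of positions seen from entry `toℕ c`. Passing to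
  -- the next vote moves both by `suc m`, which keeps the hypothesis inductive.
  columnSum-positions : (vs : List (Vote m)) (c : Candidate m) → ∀ {μ a} → (∀ x → μ (a + x) ≡ cells (positions vs) (toℕ c + x)) →
                        columnSum m μ a (length vs) ≡ positionSum vs c
  columnSum-positions []       c h = refl
  columnSum-positions (π ∷ vs) c {μ} {a} h = cong₂ _+_
    (trans (cong μ (sym (+-identityʳ a))) (trans (h 0) (trans (cong (cells (positions (π ∷ vs))) (+-identityʳ (toℕ c)))
      (trans (cells-++ˡ block (positions vs) (subst (toℕ c <_) (sym len) (toℕ<n c)))
        (trans (cong (λ l → cells l (toℕ c)) (map-tabulate id (position π))) (cells-tabulate (position π) c))))))
    (columnSum-positions vs c λ x → trans (cong μ (+-assoc a (suc m) x)) (trans (h (suc m + x))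
      (trans (cong (cells (positions (π ∷ vs))) (trans (solve 3 (λ c m x → c :+ (m :+ x) := m :+ (c :+ x)) refl (toℕ c) (suc m) x) (cong (_+ (toℕ c + x)) (sym len))))
        (cells-++ʳ block (positions vs) (toℕ c + x)))))
    where
    open +-*-Solver
    block = map (position π) (allFin (suc m))
    len : length block ≡ suc m
    len = trans (length-map (position π) (allFin (suc m))) (length-tabulate id)

  totalScore-++ : (vs ws : List (Vote m)) → ∀ c → totalScore (vs ++ ws) c ≡ totalScore vs c + totalScore ws c
  totalScore-++ vs ws c = trans (cong sum (map-++ (λ π → score π c) vs ws)) (sum-++ (map (λ π → score π c) vs) _)

  -- Manipulators may put p on top: removing p from a vote does not raise the score
  -- of any other candidate.

  ballotScore : List (Permutation′ m) → Fin m → ℕ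
  ballotScore L c = sum (map (λ ρ → toℕ (ρ ⟨$⟩ʳ c)) L)

  remove-p : ∀ {n} (bs : Vec (Vote m) n) → ∃[ L ] (length {A = Permutation′ m} L ≡ n ×
               (∀ c → ballotScore L c ≤ totalScore (toList bs) (suc c)) × totalScore (toList bs) p ≤ n * m)
  remove-p Vec.[] = [] , refl , (λ _ → z≤n) , z≤n
  remove-p (π Vec.∷ bs) with remove-p bs
  ... | L , len , lower , top = remove zero π ∷ L , cong suc len ,
    (λ c → +-mono-≤ (≤-trans (toℕ-punchIn (π ⟨$⟩ʳ zero) _) (≤-reflexive (cong toℕ (sym (punchIn-permute π zero c))))) (lower c)) ,
    +-mono-≤ (toℕ≤pred[n] (π ⟨$⟩ʳ zero)) top

  insert-p : (L : List (Permutation′ m)) → Σ[ bs ∈ Vec (Vote m) (length L) ]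
               ((∀ c → totalScore (toList bs) (suc c) ≡ ballotScore L c) × totalScore (toList bs) p ≡ length L * m)
  insert-p [] = Vec.[] , (λ _ → refl) , refl
  insert-p (ρ ∷ L) with insert-p L
  ... | bs , same , top = insert zero (fromℕ m) ρ Vec.∷ bs ,
    (λ c → cong₂ _+_ (trans (cong toℕ (insert-punchIn zero (fromℕ m) ρ c)) (toℕ-punchIn-last (ρ ⟨$⟩ʳ c))) (same c)) ,
    cong₂ _+_ (toℕ-fromℕ m) top

manipulable⇔ : (I : UBM) → Manipulable I ⇔ (Σ[ L ∈ List (Permutation′ (∣𝒞∣ I)) ] (length L ≡ t I ×
                 (∀ c → totalScore (votes I) (suc c) + ballotScore L c < totalScore (votes I) p + t I * ∣𝒞∣ I)))
manipulable⇔ I = mk⇔ to from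
  where
  tot : Candidate (∣𝒞∣ I) → ℕ
  tot = totalScore (votes I)
  to : Manipulable I → _
  to (bs , wins) with remove-p bs
  ... | L , len , lower , top = L , len , λ c → ≤-<-trans (+-monoʳ-≤ (tot (suc c)) (lower c))
    (<-≤-trans (subst₂ _<_ (totalScore-++ (votes I) (toList bs) (suc c)) (totalScore-++ (votes I) (toList bs) p) (wins c)) (+-monoʳ-≤ (tot p) top))
  from : _ → Manipulable I
  from (L , refl , wins) with insert-p L
  ... | bs , same , top = bs , λ c → subst₂ _<_
    (sym (trans (totalScore-++ (votes I) (toList bs) (suc c)) (cong (tot (suc c) +_) (same c))))
    (sym (trans (totalScore-++ (votes I) (toList bs) p) (cong (tot p +_) top))) (wins c)

-- Arithmetic of cost bounds

-- A record, so that c and Y are found by unification and the constants add up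
-- by computation.

record Bound (x c Y : ℕ) : Set where
  constructor mkBound
  field x≤ : x ≤ c * Y

open Bound public

module _ {Y : ℕ} where

  plus : ∀ {x y a b} → Bound x a Y → Bound y b Y → Bound (x + y) (a + b) Y
  plus {a = a} {b} (mkBound x≤) (mkBound y≤) = mkBound (≤-trans (+-mono-≤ x≤ y≤) (≤-reflexive (sym (*-distribʳ-+ Y a b))))

  const≤ : ∀ c → 1 ≤ Y → Bound c c Y
  const≤ c 1≤Y = mkBound (m≤m*n c Y {{>-nonZero 1≤Y}})

  scaled : ∀ {x} c → x ≤ Y → Bound (x * c) c Y
  scaled {x} c x≤ = mkBound (≤-trans (≤-reflexive (*-comm x c)) (*-monoʳ-≤ c x≤))

  times : ∀ {k x s a b} → Bound k b s → Bound x a Y → Bound (k * x) (b * a) (s * Y)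
  times {s = s} {a} {b} (mkBound k≤) (mkBound x≤) = mkBound (≤-trans (*-mono-≤ k≤ x≤)
    (≤-reflexive (solve 4 (λ s b a y → (b :* s) :* (a :* y) := (b :* a) :* (s :* y)) refl s b a Y)))
    where open +-*-Solver

  once : ∀ {x} → x ≤ Y → Bound x 1 Y
  once x≤ = mkBound (≤-trans x≤ (≤-reflexive (sym (*-identityˡ Y))))

  rebase : ∀ {x c Y′} → Y ≤ Y′ → Bound x c Y → Bound x c Y′
  rebase {c = c} Y≤ (mkBound x≤) = mkBound (≤-trans x≤ (*-monoʳ-≤ c Y≤))

n<2^n : ∀ n → n < 2 ^ n
n<2^n zero    = s≤s z≤n
n<2^n (suc n) = +-mono-≤ (m^n>0 2 n) (≤-trans (n<2^n n) (m≤m+n (2 ^ n) 0))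

-- For m ≥ 4 the base m + 2 is at most m ^ 2; the factor 3 ^ 11 covers m ≤ 3.

power≤ : ∀ m → 1 ≤ m → suc (suc m) ^ (2 * m ^ 2 + 9 * m) ≤ 3 ^ 11 * m ^ (9 * m ^ 2)
power≤ 1 _ = ≤ᵇ⇒≤ (3 ^ 11) (3 ^ 11 * 1 ^ 9) _
power≤ 2 _ = ≤ᵇ⇒≤ (4 ^ 26) (3 ^ 11 * 2 ^ 36) _
power≤ 3 _ = ≤ᵇ⇒≤ (5 ^ 45) (3 ^ 11 * 3 ^ 81) _
power≤ m@(suc (suc (suc (suc k)))) _ = begin
  suc (suc m) ^ e                ≤⟨ ^-monoˡ-≤ e q≤ ⟩
  (m ^ 2) ^ e                    ≡⟨ ^-*-assoc m 2 e ⟩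
  m ^ (2 * e)                    ≤⟨ ^-monoʳ-≤ m e≤ ⟩
  m ^ (9 * m ^ 2)                ≤⟨ m≤n*m _ (3 ^ 11) ⟩
  3 ^ 11 * m ^ (9 * m ^ 2)       ∎
  where
  open ≤-Reasoning
  open +-*-Solver
  e = 2 * m ^ 2 + 9 * m
  q≤ : suc (suc m) ≤ m ^ 2
  q≤ = ≤-trans (m≤m+n _ (10 + 7 * k + k * k)) (≤-reflexive (solve 1 (λ k → con 6 :+ k :+ (con 10 :+ con 7 :* k :+ k :* k) := (con 4 :+ k) :* ((con 4 :+ k) :* con 1)) refl k))
  e≤ : 2 * e ≤ 9 * m ^ 2
  e≤ = ≤-trans (m≤m+n _ (8 + 22 * k + 5 * (k * k))) (≤-reflexive (solve 1 (λ k → con 2 :* (con 2 :* ((con 4 :+ k) :* ((con 4 :+ k) :* con 1)) :+ con 9 :* (con 4 :+ k)) :+ (con 8 :+ con 22 :* k :+ con 5 :* (k :* k))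
         := con 9 :* ((con 4 :+ k) :* ((con 4 :+ k) :* con 1))) refl k))

-- The program on one instance

module Instance (I : UBM) (1≤m : 1 ≤ ∣𝒞∣ I) where

  private
    m n : ℕ
    m = ∣𝒞∣ I
    n = length (votes I)

    μ : ℕ → ℕ
    μ = cells (encode I)

  open Parameters m
  open Input m
  open Codes m W D using (code; code<; Next; Votes; Halves; Slack)
  open CodeProperties m W D using (Digits; code-cons; code-injective; geometricSum-code)
  open Correct m W D N 1≤m m^m≤N Nm<D (W-large 1≤m)
  open Level m W D N 1≤m Nm<D (W-large 1≤m)

  -- The 1 for each candidate makes p's victory strict: a ballot total and 1 must fit into the lead.
  -- The entry 0 leaves the count of the votes alone.
  v₀ : ℕ → ℕ
  v₀ = cons 0 (λ _ → 1)

  Start : ℕ → Set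
  Start x = x ≡ code v₀ (suc m)

  private
    v₀≤D : ∀ i → v₀ i ≤ D
    v₀≤D zero    = z≤n
    v₀≤D (suc i) = ≤-trans (s≤s z≤n) 2≤D

    D<W : D < W
    D<W = ≤-<-trans (≤-trans (m≤m+n D D) (n≤1+n (D + D))) E<W

  Start-digits : Digits D Start
  Start-digits e = v₀ , (λ i _ → v₀≤D i) , e

  column : ∀ c → columnSum m μ (3 + toℕ c) n ≡ n + totalScore (votes I) c
  column c = trans (columnSum-positions (votes I) c (λ x → refl)) (positionSum-score (votes I) c)

  private
    tally-0 : (L : List (Permutation′ m)) → tally L 0 ≡ length L
    tally-0 []      = refl
    tally-0 (ρ ∷ L) = cong suc (tally-0 L)

    tally-suc : (L : List (Permutation′ m)) → ∀ c → tally L (suc (toℕ c)) ≡ ballotScore L c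
    tally-suc []      c = refl
    tally-suc (ρ ∷ L) c = cong₂ _+_ (ext-toℕ _ c) (tally-suc L c)

    b₀ : ℕ → ℕ
    b₀ = target μ n (t I)

    target-suc : ∀ c → b₀ (suc (toℕ c)) ≡ n + totalScore (votes I) p + t I * m ∸ (n + totalScore (votes I) (suc c))
    target-suc c = cong₂ (λ x y → x + t I * m ∸ y) (column zero) (column (suc c))

    ∀suc : ∀ {P : ℕ → Set} → P 0 → (∀ (c : Fin m) → P (suc (toℕ c))) → ∀ i → i ≤ m → P i
    ∀suc         z s zero    _   = z
    ∀suc {P = P} z s (suc i) i<m = subst (λ j → P (suc j)) (toℕ-fromℕ< i<m) (s (fromℕ< i<m))

    <∸⇒+< : ∀ a x y → a < x ∸ y → y + a < x
    <∸⇒+< a x y a< = subst (_< x) (+-comm a y) (≤-trans (+-monoˡ-≤ y a<) (≤-reflexive (m∸n+n≡m (<⇒≤ (m<n∸o⇒o<n a<)))))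
      where
      m<n∸o⇒o<n : a < x ∸ y → y < x
      m<n∸o⇒o<n a< = m∸n≢0⇒n<m (λ e → <⇒≱ a< (≤-trans (≤-reflexive e) z≤n))

  manipulable⇔completable : Manipulable I ⇔ Completable Start b₀
  manipulable⇔completable = mk⇔ (to ∘ Equivalence.to (manipulable⇔ I)) (Equivalence.from (manipulable⇔ I) ∘ from)
    where
    tot = totalScore (votes I)
    Wins : List (Permutation′ m) → Set
    Wins L = ∀ c → tot (suc c) + ballotScore L c < tot p + t I * m
    to : Σ[ L ∈ List (Permutation′ m) ] (length L ≡ t I × Wins L) → Completable Start b₀
    to (L , len , wins) = _ , refl , v₀ , L , (λ i → b₀ i ∸ (v₀ i + tally L i)) , refl , (λ i _ → v₀≤D i) ,
      trans (cong (t I ∸_) first) (n∸n≡0 (t I)) ,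
      λ i i≤m → m+[n∸m]≡n (∀suc {λ i → v₀ i + tally L i ≤ b₀ i} (≤-reflexive first) other i i≤m)
      where
      first : tally L 0 ≡ t I
      first = trans (tally-0 L) len
      other : ∀ c → 1 + tally L (suc (toℕ c)) ≤ b₀ (suc (toℕ c))
      other c = subst₂ _≤_ (cong suc (sym (tally-suc L c))) (sym (target-suc c))
        (m+n≤o⇒m≤o∸n _ (≤-trans (≤-reflexive (solve 3 (λ b n t → con 1 :+ b :+ (n :+ t) := n :+ (con 1 :+ (t :+ b))) refl (ballotScore L c) n (tot (suc c))))
          (≤-trans (+-monoʳ-≤ n (wins c)) (≤-reflexive (sym (+-assoc n (tot p) (t I * m)))))))
        where open +-*-Solver
    from : Completable Start b₀ → Σ[ L ∈ List (Permutation′ m) ] (length L ≡ t I × Wins L)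
    from (_ , refl , v , L , s , ex , v≤ , s₀ , eq) = L ,
      trans (sym (tally-0 L)) (trans (sym (trans (cong₂ (λ a b → a + tally L 0 + b) (v≡ 0 z≤n) s₀) (+-identityʳ (tally L 0)))) (eq 0 z≤n)) ,
      λ c → +-cancelˡ-< n _ _ (subst₂ _<_ (+-assoc n (tot (suc c)) (ballotScore L c)) (+-assoc n (tot p) (t I * m))
        (<∸⇒+< (ballotScore L c) _ (n + tot (suc c)) (subst (ballotScore L c <_) (target-suc c)
          (≤-trans (s≤s (≤-reflexive (sym (tally-suc L c)))) (≤-trans (≤-reflexive (cong (_+ tally L (suc (toℕ c))) (sym (v≡ (suc (toℕ c)) (toℕ<n c)))))
            (≤-trans (m≤m+n _ (s (suc (toℕ c)))) (≤-reflexive (eq (suc (toℕ c)) (toℕ<n c)))))))))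
      where
      v≡ : ∀ i → i ≤ m → v i ≡ v₀ i
      v≡ i i≤m = code-injective v v₀ (suc m) (λ i i< → ≤-<-trans (v≤ i (s≤s⁻¹ i<)) D<W) (λ i _ → ≤-<-trans (v₀≤D i) D<W) (sym ex) i (s≤s i≤m)

  Levels : ℕ → ℕ → Set
  bits   : ℕ → ℕ → ℕ
  Levels zero    = Start
  Levels (suc i) = Next N (Levels i) (bits i)
  bits zero    l = target μ n (t I) l
  bits (suc i) l = bits i l / 2

  Levels-digits : ∀ i → Digits D (Levels i)
  Levels-digits zero    = Start-digits
  Levels-digits (suc i) = Next-digits (Levels-digits i) (bits i)

  Levels-completable : ∀ i → Manipulable I ⇔ Completable (Levels i) (bits i)
  Levels-completable zero    = manipulable⇔completable
  Levels-completable (suc i) = mk⇔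
    (forward (Levels-digits i) (bits i) ∘ Equivalence.to (Levels-completable i))
    (Equivalence.from (Levels-completable i) ∘ backward (Levels-digits i) (bits i))

  -- `M` is an address behind everything that is written: `K` levels of `slots` bitmaps each, and
  -- `m + 6` more for scans that reach beyond the current bitmap. It also bounds all values, which
  -- makes it the `M` of `Logic`.
  K cur₀ slots M : ℕ
  K = total μ n (t I) + t I
  cur₀ = base n + suc m
  slots = N * suc m + (m + m + 2)
  M = cur₀ + (K * slots + (m + 6)) * Z

  private
    target≤ : ∀ l → target μ n (t I) l ≤ K
    target≤ zero    = m≤n+m (t I) _
    target≤ (suc l) = ≤-trans (m∸n≤m _ (columnSum m μ (3 + suc l) n)) (m≤m+n _ (t I))

  bits≤ : ∀ i l → bits i l ≤ K
  bits≤ zero    l = target≤ l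
  bits≤ (suc i) l = ≤-trans (m/n≤m (bits i l) 2) (bits≤ i l)

  bits< : ∀ i j → i + j ≡ K → ∀ l → bits i l < 2 ^ j
  bits< zero    j refl l = ≤-<-trans (target≤ l) (n<2^n K)
  bits< (suc i) j e    l = m<n*o⇒m/o<n (subst (bits i l <_) (*-comm 2 (2 ^ j)) (bits< i (suc j) (trans (+-suc i j) e) l))

  open Blocks M
  open Logic M
  open SetUp m
  open Machine m W N D (base n) hiding (slots; X≤Z)

  private
    1≤Z : 1 ≤ Z
    1≤Z = ≤-trans (≤-trans (≤-trans (s≤s z≤n) 2≤W) W≤X) X≤Z

    cur₀≤M : cur₀ ≤ M
    cur₀≤M = m≤m+n cur₀ _

    Z≤M : Z ≤ M
    Z≤M = ≤-trans (m≤n*m Z (K * slots + (m + 6)) {{>-nonZero (≤-trans (≤-trans (s≤s z≤n) (m≤n+m 6 m)) (m≤n+m (m + 6) (K * slots)))}}) (m≤n+m _ cur₀)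

    K≤M : K ≤ M
    K≤M = ≤-trans (≤-trans (m≤m*n K slots {{>-nonZero (≤-trans (≤-trans (s≤s z≤n) (m≤n+m 2 (m + m))) (m≤n+m _ (N * suc m)))}})
            (≤-trans (m≤m+n (K * slots) (m + 6)) (m≤m*n _ Z {{>-nonZero 1≤Z}}))) (m≤n+m _ cur₀)

    base≤cur₀ : base n ≤ cur₀
    base≤cur₀ = m≤m+n (base n) (suc m)

    ini : ℕ
    ini = geometricSum W W m

    ini≡ : ini ≡ code v₀ (suc m)
    ini≡ = trans (geometricSum-code m W) (sym (code-cons v₀ m))

    n≤base : n ≤ base n
    n≤base = ≤-trans (m≤m*n n (suc m)) (m≤n+m (n * suc m) 3)

    initially-small : Small (initial (encode I))
    initially-small = mkSmall (λ _ → z≤n)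
      (cells≤ (n ∷ t I ∷ positions (votes I)) (cells≤ (t I ∷ positions (votes I)) (cells≤ (positions (votes I))
        (λ i → ≤-trans (positions≤ (votes I) i) (≤-trans (m≤n+m (suc m) (base n)) cur₀≤M))
        (≤-trans (m≤n+m (t I) _) K≤M))
        (≤-trans n≤base (≤-trans base≤cur₀ cur₀≤M)))
        (≤-trans (≤-trans (n≤1+n m) (m≤n+m (suc m) (base n))) cur₀≤M))

    beyond : ∀ xs i → length xs ≤ i → cells xs i ≡ 0
    beyond []       i       _         = refl
    beyond (x ∷ xs) (suc i) (s≤s n≤i) = beyond xs i n≤i

    length-positions : ∀ vs → length (positions {m} vs) ≡ length vs * suc m
    length-positions []       = refl
    length-positions (π ∷ vs) = trans (length-++ (map (position π) (allFin (suc m))))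
      (cong₂ _+_ (trans (length-map (position π) (allFin (suc m))) (length-tabulate id)) (length-positions vs))

    column≤ : ∀ i → i ≤ m → columnSum m μ (3 + i) n ≤ M
    column≤ i i≤m = subst (λ j → columnSum m μ (3 + j) n ≤ M) (toℕ-fromℕ< (s≤s i≤m))
      (≤-trans (≤-reflexive (columnSum-positions (votes I) c (λ x → refl))) (≤-trans (positionSum≤ (votes I) c) (≤-trans (m≤n+m (n * suc m) 3) (≤-trans base≤cur₀ cur₀≤M))))
      where c = fromℕ< (s≤s i≤m)

  totalCost : ℕ
  totalCost = constantsCost + (targetsCost n (t I) + (4 + ((K * suc (levelCost K) + 1) + 1)))

  program-exec : Exec program (initial (encode I)) totalCost (λ σ → reg σ 0 ≢ 0 ⇔ Manipulable I)
  program-exec =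
    bind (constants-exec initially-small (λ _ → refl) refl refl refl Z≤M) λ σ₁ s₁ f₁ r₁ →
    let module R = Ready r₁ in
    bind (targets-exec s₁ r₁ cur₀≤M (total≤ σ₁ (memory f₁ _)) (λ i i≤m → subst (λ ν → columnSum m ν (3 + i) n ≤ M) (sym (memory f₁ _)) (column≤ i i≤m)))
      λ { σ₂ s₂ f₂ (e20 , e22 , e25 , tg , hi) →
    let e1 = trans (regs f₂ 1 _) R.e1
        σ₂-targets = λ i (i≤m : i ≤ m) → trans (tg i i≤m) (cong (λ ν → target ν n (t I) i) (memory f₁ _))
        σ₂-clear = λ y (lt : base n + m < y) → trans (hi y lt) (trans (cong (λ ν → ν y) (memory f₁ _))
                     (beyond (encode I) y (≤-trans (≤-reflexive (cong (3 +_) (length-positions (votes I)))) (≤-trans (m≤m+n (base n) m) (<⇒≤ lt))))) in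
    seq (addₑ cur₀ s₂ (trans (cong₂ _+_ e25 e1) (trans (+-assoc (base n) m 1) (cong (base n +_) (+-comm m 1)))) cur₀≤M λ s₃ →
    seq (addₑ (cur₀ + ini) s₃ (cong (cur₀ +_) (trans (regs f₂ 41 _) R.e41)) (+-monoʳ-≤ cur₀ ini≤) λ s₄ →
    seq (storeₑ (cur₀ + ini) 1 s₄ refl e1 λ s₅ →
    seq (addₑ K s₅ (cong₂ _+_ (trans e22 (cong (λ ν → total ν n (t I)) (memory f₁ _))) (trans (regs f₂ 4 _) R.e4)) K≤M λ s₆ →
    let σ₆ = setReg (setMem (setReg (setReg σ₂ 28 cur₀) 16 (cur₀ + ini)) (cur₀ + ini) 1) 34 K
        c₆ : Consts σ₆
        c₆ = mkConsts e1 (trans (regs f₂ 2 _) R.e2) (trans (regs f₂ 5 _) R.e5) (trans (regs f₂ 11 _) R.e11) (trans (regs f₂ 12 _) R.e12)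
               (trans (regs f₂ 13 _) R.e13) (trans (regs f₂ 14 _) R.e14) e20 (trans (regs f₂ 40 _) R.e40) (trans (regs f₂ 42 _) R.e42)
               (trans (regs f₂ 46 _) R.e46) (trans (regs f₂ 47 _) R.e47) in
    bind (repeat Inv K s₆ refl
            (sym (+-identityʳ cur₀) ,
             (λ i i≤m → trans (update-≢ (mem σ₂) (cur₀ + ini) 1 (<⇒≢ (<-≤-trans (+-monoʳ-< (base n) (s≤s i≤m)) (m≤m+n cur₀ ini)))) (σ₂-targets i i≤m)) ,
             subst (λ a → Bitmap σ₆ a Start) (sym (+-identityʳ cur₀)) (start-bitmap σ₂ σ₂-clear))
            (step σ₆ c₆))
      λ { σ₇ s₇ f₇ (e28 , _ , bm) →
    loadₑ _ s₇ refl λ _ → mk⇔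
      (λ ne → Equivalence.from (Levels-completable K) (cong⁻ (Equivalence.from (Completable-0 (Levels-digits K))
                (Equivalence.to (bm 0) (ne ∘ trans (cong (mem σ₇) (trans e28 (sym (+-identityʳ _)))))))))
      (λ man e → Equivalence.from (bm 0) (Equivalence.to (Completable-0 (Levels-digits K)) (cong⁺ (Equivalence.to (Levels-completable K) man)))
                   (trans (cong (mem σ₇) (trans (+-identityʳ _) (sym e28))) e)) })))) }
    where
    total≤ : ∀ σ₁ → mem σ₁ ≡ μ → total (mem σ₁) n (t I) ≤ M
    total≤ σ₁ refl = ≤-trans (m≤m+n _ (t I)) K≤M
    ini≤ : ini ≤ (K * slots + (m + 6)) * Z
    ini≤ = ≤-trans (≤-trans (≤-trans (m≤m+n ini W) (geometricSum-bound W W m 2≤W)) X≤Z)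
      (m≤n*m Z (K * slots + (m + 6)) {{>-nonZero (≤-trans (≤-trans (s≤s z≤n) (m≤n+m 6 m)) (m≤n+m (m + 6) (K * slots)))}})
    start-bitmap : ∀ σ → (∀ y → base n + m < y → mem σ y ≡ 0) → Bitmap (setMem σ (cur₀ + ini) 1) cur₀ Start
    start-bitmap σ clear x = mk⇔ to from
      where
      to : mem (setMem σ (cur₀ + ini) 1) (cur₀ + x) ≢ 0 → Start x
      to ne with x ≟ ini
      ... | yes refl = ini≡
      ... | no x≢ = ⊥-elim (ne (trans (update-≢ (mem σ) (cur₀ + ini) 1 (x≢ ∘ +-cancelˡ-≡ cur₀ x ini))
                      (clear (cur₀ + x) (≤-trans (≤-reflexive (sym (+-suc (base n) m))) (m≤m+n cur₀ x)))))
      from : Start x → mem (setMem σ (cur₀ + ini) 1) (cur₀ + x) ≢ 0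
      from refl e = 1+n≢0 (trans (sym (update-≡ (mem σ) (cur₀ + ini) 1)) (trans (cong (λ z → mem (setMem σ (cur₀ + ini) 1) (cur₀ + z)) ini≡) e))
    last-bits : ∀ l → l ≤ m → bits K l ≡ 0
    last-bits l _ = n<1⇒n≡0 (bits< K 0 (+-identityʳ K) l)
    cong⁺ : Completable (Levels K) (bits K) → Completable (Levels K) (λ _ → 0)
    cong⁺ = Completable-cong last-bits
    cong⁻ : Completable (Levels K) (λ _ → 0) → Completable (Levels K) (bits K)
    cong⁻ = Completable-cong (λ l l≤m → sym (last-bits l l≤m))
    Inv : ℕ → State → Set
    Inv i σ = (reg σ 28 ≡ cur₀ + i * slots * Z × Targets σ (bits i) × Bitmap σ (cur₀ + i * slots * Z) (Levels i))
    step : ∀ σ₆ → Consts σ₆ → ∀ i j σ → Small σ → Frame level σ₆ σ → i < K → reg σ 34 ≡ suc j → Inv i σ →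
           Exec level σ (levelCost K) (λ σ′ → reg σ′ 34 ≡ j × Inv (suc i) σ′)
    step σ₆ c₆ i j σ sm fr i<K e34 (e28 , tg , bm) =
      finish (level-exec {S = Levels i} {bits i} {K} E<W (≤-trans (m≤n+m m 2) q≤W) sm (keepConsts level fr c₆) e28 e34 bm tg (λ l _ → bits≤ i l)
                (≤-trans (≤-reflexive (sym (+-suc (base n) m))) (m≤m+n cur₀ _))
                (Votes-Stage-below (Levels-digits i) 1≤N)
                (Halves-below dv B+E<W (bits i)) (Slack-below dv B+E<W (bits i))
                (≤-trans (≤-reflexive (solve 4 (λ c i s z → c :+ i :* z :+ s :* z := c :+ (i :+ s) :* z) refl cur₀ (i * slots) (slots + (m + 6)) Z))
                  (+-monoʳ-≤ cur₀ (*-monoˡ-≤ Z (≤-trans (≤-reflexive (solve 3 (λ i s k → i :* s :+ (s :+ k) := (con 1 :+ i) :* s :+ k) refl i slots (m + 6)))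
                    (+-monoˡ-≤ (m + 6) (*-monoˡ-≤ slots i<K)))))))
        λ { σ′ _ _ (e34′ , e28′ , tg′ , bm′) → e34′ , trans e28′ next , tg′ ,
            subst (λ a → Bitmap σ′ a (Levels (suc i))) next bm′ }
      where
      open +-*-Solver
      dv : Digits (D + N * m) (Votes (Levels i) N)
      dv = Votes-digits (Levels-digits i) 1≤N N ≤-refl
      next : cur₀ + i * slots * Z + slots * Z ≡ cur₀ + suc i * slots * Z
      next = solve 4 (λ c i s z → c :+ i :* s :* z :+ s :* z := c :+ (con 1 :+ i) :* s :* z) refl cur₀ i slots Z

  -- The running time in terms of the size

  private
    -- Up to a constant, the cost of a level. The votes take `N` times `m` candidates times `m`
    -- scores, each a scan of `Z` cells. One coordinate of the carry takes `suc D`, at most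
    -- `3 * (s * N)`, such scans, and the outer factor `s` covers the `m` coordinates.
    s C : ℕ
    s = size I
    C = s * (N * (s * (s * Z)))

    m₁≤s : suc m ≤ s
    m₁≤s = ≤-trans (m≤m+n (suc m) (n * suc m)) (m≤m+n _ (t I))

    m≤s : m ≤ s
    m≤s = ≤-trans (n≤1+n m) m₁≤s

    1≤s : 1 ≤ s
    1≤s = ≤-trans (s≤s z≤n) m₁≤s

    nm₁≤s : n * suc m ≤ s
    nm₁≤s = ≤-trans (m≤n+m (n * suc m) (suc m)) (m≤m+n _ (t I))

    n≤s : n ≤ s
    n≤s = ≤-trans (m≤m*n n (suc m)) nm₁≤s

    t≤s : t I ≤ s
    t≤s = m≤n+m (t I) _

    grow : ∀ {x} → x ≤ s * x
    grow {x} = m≤n*m x s {{>-nonZero 1≤s}}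

    2≤2s : Bound 2 2 s
    2≤2s = const≤ 2 1≤s

    q≤2s : q ≤ 2 * s
    q≤2s = ≤-trans (s≤s m₁≤s) (≤-trans (+-monoˡ-≤ s 1≤s) (≤-reflexive (cong (s +_) (sym (+-identityʳ s)))))

    D≤ : Bound (suc D) 3 (s * N)
    D≤ = mkBound (≤-trans (+-mono-≤ (≤-trans 1≤N (grow {N})) (*-monoʳ-≤ N q≤2s)) (≤-reflexive (solve 2 (λ s n → s :* n :+ n :* (con 2 :* s) := con 3 :* (s :* n)) refl s N)))
      where open +-*-Solver

    K≤ : Bound K 3 (s * s)
    K≤ = mkBound (≤-trans (+-mono-≤ (+-mono-≤ (≤-trans (≤-trans (≤-reflexive (columnSum-positions (votes I) zero (λ x → refl))) (≤-trans (positionSum≤ (votes I) zero) nm₁≤s)) grow)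
           (*-mono-≤ t≤s m≤s)) (≤-trans t≤s grow)) (≤-reflexive (solve 1 (λ x → x :+ x :+ x := con 3 :* x) refl (s * s))))
      where open +-*-Solver

    W≤Z : W ≤ Z
    W≤Z = ≤-trans W≤X X≤Z

    q≤Z : q ≤ Z
    q≤Z = ≤-trans q≤W W≤Z

    1≤sZ : 1 ≤ s * Z
    1≤sZ = ≤-trans 1≤Z grow

    1≤ssZ : 1 ≤ s * (s * Z)
    1≤ssZ = ≤-trans 1≤sZ grow

    ssZ≤B : s * (s * Z) ≤ N * (s * (s * Z))
    ssZ≤B = m≤n*m (s * (s * Z)) N {{N-nonZero}}

    Z≤B : Z ≤ N * (s * (s * Z))
    Z≤B = ≤-trans (≤-trans grow grow) ssZ≤B

    1≤B : 1 ≤ N * (s * (s * Z))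
    1≤B = ≤-trans 1≤Z Z≤B

    B≤C : N * (s * (s * Z)) ≤ C
    B≤C = grow

    1≤C : 1 ≤ C
    1≤C = ≤-trans 1≤B B≤C

    ss≤B : s * s ≤ N * (s * (s * Z))
    ss≤B = ≤-trans (*-monoʳ-≤ s (m≤m*n s Z {{>-nonZero 1≤Z}})) ssZ≤B

    times≤ : ∀ {w} → w ≤ Z → Bound (w * 3 + 4) 7 Z
    times≤ w≤ = plus (scaled 3 w≤) (const≤ 4 1≤Z)

    push≤ : Bound pushCost 13 Z
    push≤ = plus (const≤ 5 1≤Z) (plus (scaled 7 ≤-refl) (const≤ 1 1≤Z))

    transfer≤ : Bound (X * 7 + 1) 8 Z
    transfer≤ = plus (scaled 7 X≤Z) (const≤ 1 1≤Z)

    score≤ : Bound scoreCost 23 Z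
    score≤ = plus (const≤ 1 1≤Z) (plus push≤ (plus (const≤ 1 1≤Z) (plus (times≤ W≤Z) (const≤ 1 1≤Z))))

    candidate≤ : Bound candidateCost 39 (s * Z)
    candidate≤ = plus (const≤ 3 1≤sZ) (plus
      (plus (times (once m≤s) (plus (const≤ 1 1≤Z) score≤)) (const≤ 1 1≤sZ))
      (rebase grow (plus (const≤ 1 1≤Z) (plus (const≤ 1 1≤Z) (plus (times≤ W≤Z) (const≤ 2 1≤Z))))))

    vote≤ : Bound voteCost 71 (s * (s * Z))
    vote≤ = plus (const≤ 3 1≤ssZ) (plus
      (plus (times (once m≤s) (plus (const≤ 1 1≤sZ) candidate≤)) (const≤ 1 1≤ssZ))
      (rebase (≤-trans grow grow) (plus (plus (const≤ 5 1≤Z) transfer≤)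
        (plus (plus (const≤ 4 1≤Z) transfer≤) (const≤ 2 1≤Z)))))

    halve≤ : Bound (halveCost K) 20 (N * (s * (s * Z)))
    halve≤ = plus (const≤ 3 1≤B) (plus (plus K*4≤ (const≤ 1 1≤B)) (const≤ 4 1≤B))
      where
      K*4≤ : Bound (K * 4) 12 (N * (s * (s * Z)))
      K*4≤ = mkBound (≤-trans (*-monoˡ-≤ 4 (x≤ K≤)) (≤-trans (≤-reflexive (solve 1 (λ y → con 3 :* y :* con 4 := con 12 :* y) refl (s * s))) (*-monoʳ-≤ 12 ss≤B)))
        where open +-*-Solver

    carry≤ : Bound (carryCost K) 72 (N * (s * (s * Z)))
    carry≤ = plus halve≤ (plus (const≤ 1 1≤B) (plus (plus
      (rebase (≤-trans (≤-reflexive (solve 3 (λ s n z → s :* n :* z := n :* (s :* z)) refl s N Z)) (*-monoʳ-≤ N grow))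
        (times D≤ (plus (const≤ 1 1≤Z) (plus push≤ (const≤ 2 1≤Z)))))
      (const≤ 1 1≤B)) (const≤ 2 1≤B)))
      where open +-*-Solver

    halves≤ : Bound (halvesCost K) 130 (N * (s * (s * Z)))
    halves≤ = plus (rebase Z≤B (plus (const≤ 1 1≤Z) (plus (times≤ W≤Z) (plus (const≤ 2 1≤Z)
        (plus (times≤ W≤Z) (plus (const≤ 2 1≤Z) (plus (times≤ W≤Z) (const≤ 1 1≤Z))))))))
      (plus (const≤ 1 1≤B) (plus
        (rebase Z≤B (plus (const≤ 1 1≤Z) (plus push≤ (plus (const≤ 1 1≤Z) (plus push≤ (const≤ 1 1≤Z))))))
        (plus carry≤ (const≤ 1 1≤B))))

    level≤ : Bound (levelCost K) 298 C
    level≤ = plus (const≤ 1 1≤C) (plus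
      (rebase B≤C (plus (times (once {N} ≤-refl) (plus (const≤ 1 1≤ssZ) vote≤)) (const≤ 1 1≤B)))
      (plus (const≤ 5 1≤C) (plus (rebase B≤C carry≤) (plus (const≤ 1 1≤C) (plus
        (plus (times (once m≤s) (plus (const≤ 1 1≤B) halves≤)) (const≤ 1 1≤C))
        (rebase (≤-trans Z≤B B≤C) (plus (const≤ 4 1≤Z) (plus transfer≤ (const≤ 2 1≤Z)))))))))

    geometric≤ : ∀ {w k c} → w ≤ Z → Bound k c s → Bound (geometricCost w k) (c * 10 + 2) (s * Z)
    geometric≤ w≤ k≤ = plus (times k≤ (plus (scaled 3 w≤) (const≤ 7 1≤Z))) (const≤ 2 1≤sZ)

    constants≤ : Bound constantsCost 91 (s * Z)
    constants≤ = plus (k 8) (plus (geometric≤ q≤Z (once m≤s)) (plus (k 1) (plus (rebase grow (times≤ q≤Z))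
      (plus (k 3) (plus (geometric≤ q≤Z 2≤2s) (plus (k 2) (plus (geometric≤ W≤Z (once m≤s))
      (plus (k 3) (plus (geometric≤ W≤Z (once m≤s)) (plus (k 1) (plus (rebase grow (times≤ W≤Z)) (k 1))))))))))))
      where
      k : ∀ c → Bound c c (s * Z)
      k c = const≤ c 1≤sZ

    column≤9s : Bound (columnCost n) 9 s
    column≤9s = plus (const≤ 3 1≤s) (plus (scaled 5 n≤s) (const≤ 1 1≤s))

    targets≤ : Bound (targetsCost n (t I)) 37 (s * s)
    targets≤ = plus (k 2) (plus (rebase grow column≤9s) (plus (k 3)
      (plus (plus (scaled 3 (≤-trans t≤s grow)) (k 1)) (plus (k 3) (plus
        (times (once m≤s) (plus (const≤ 1 1≤s) (plus (const≤ 2 1≤s) (plus column≤9s (const≤ 3 1≤s))))) (k 1))))))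
      where
      k : ∀ c → Bound c c (s * s)
      k c = const≤ c (≤-trans 1≤s grow)

  totalCost≤ : Bound totalCost 1031 ((s * s) * C)
  totalCost≤ = plus (rebase (≤-trans (≤-trans grow ssZ≤B) (≤-trans B≤C C≤F)) constants≤)
    (plus (rebase (≤-trans ss≤B (≤-trans B≤C C≤F)) targets≤) (plus (k 4)
      (plus (plus (times K≤ (plus (const≤ 1 1≤C) level≤)) (k 1)) (k 1))))
    where
    C≤F : C ≤ (s * s) * C
    C≤F = m≤n*m C (s * s) {{>-nonZero (≤-trans 1≤s grow)}}
    k : ∀ c → Bound c c ((s * s) * C)
    k c = const≤ c (≤-trans 1≤C C≤F)

  private
    F e : ℕ
    F = (s * s) * C
    e = 2 * m ^ 2 + 9 * m

    C≤F : C ≤ F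
    C≤F = m≤n*m C (s * s) {{>-nonZero (≤-trans 1≤s grow)}}

    s≤F : s ≤ F
    s≤F = ≤-trans (≤-trans grow ss≤B) (≤-trans B≤C C≤F)

    s≤sN : s ≤ s * N
    s≤sN = m≤m*n s N {{N-nonZero}}

    slots≤ : Bound slots 5 (s * N)
    slots≤ = plus (rebase (≤-reflexive (*-comm N s)) (times (once {x = N} ≤-refl) (once m₁≤s)))
      (plus (plus (once (≤-trans m≤s s≤sN)) (once (≤-trans m≤s s≤sN))) (const≤ 2 (≤-trans 1≤s s≤sN)))

    M≤ : Bound M 26 F
    M≤ = plus (rebase s≤F cur₀≤) (rebase (≤-trans (≤-reflexive (solve 3 (λ s n z → z :* (s :* s :* (s :* n)) := s :* s :* (s :* (n :* z))) refl s N Z))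
               (*-monoʳ-≤ (s * s) (*-monoʳ-≤ s (*-monoʳ-≤ N (≤-trans grow grow))))) rest≤)
      where
      open +-*-Solver
      cur₀≤ : Bound cur₀ 4 s
      cur₀≤ = mkBound (≤-trans (≤-reflexive (+-assoc 3 (n * suc m) (suc m)))
        (x≤ (plus (const≤ 3 1≤s) (once (≤-trans (≤-reflexive (+-comm (n * suc m) (suc m))) (m≤m+n _ (t I)))))))
      s≤ : s ≤ s * s * (s * N)
      s≤ = ≤-trans grow (m≤m*n (s * s) (s * N) {{>-nonZero (≤-trans 1≤s s≤sN)}})
      rest≤ : Bound ((K * slots + (m + 6)) * Z) 22 (Z * (s * s * (s * N)))
      rest≤ = mkBound (≤-trans (≤-reflexive (*-comm _ Z)) (x≤ (times (once {x = Z} ≤-refl)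
        (plus (times K≤ slots≤) (plus (once (≤-trans m≤s s≤)) (const≤ 6 (≤-trans 1≤s s≤)))))))

    -- The exponent is `m + 2 * (m + 3) * (m + 1)`. The factor `q ^ 6` is split off as polynomial in
    -- the size, and the rest is left to `power≤`.
    NZ≡ : N * Z ≡ q ^ 6 * q ^ e
    NZ≡ = begin
      N * (W ^ suc m * W ^ suc m)                           ≡⟨ cong (λ w → N * (w ^ suc m * w ^ suc m)) W≡ ⟩
      N * ((q ^ (m + 3)) ^ suc m * (q ^ (m + 3)) ^ suc m)   ≡⟨ cong (λ x → N * (x * x)) (^-*-assoc q (m + 3) (suc m)) ⟩
      q ^ m * (q ^ d * q ^ d)                               ≡⟨ cong (q ^ m *_) (sym (^-distribˡ-+-* q d d)) ⟩
      q ^ m * q ^ (d + d)                                   ≡⟨ sym (^-distribˡ-+-* q m (d + d)) ⟩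
      q ^ (m + (d + d))                                     ≡⟨ cong (q ^_) (solve 1 (λ m → m :+ ((m :+ con 3) :* (con 1 :+ m) :+ (m :+ con 3) :* (con 1 :+ m))
                                                                  := con 6 :+ (con 2 :* (m :* (m :* con 1)) :+ con 9 :* m)) refl m) ⟩
      q ^ (6 + e)                                           ≡⟨ ^-distribˡ-+-* q 6 e ⟩
      q ^ 6 * q ^ e                                         ∎
      where
      open ≡-Reasoning
      open +-*-Solver
      d = (m + 3) * suc m
      W≡ : W ≡ q ^ (m + 3)
      W≡ = trans (solve 2 (λ n q → n :* q :* (q :* (q :* con 1)) := n :* (q :* (q :* (q :* con 1)))) refl N q) (sym (^-distribˡ-+-* q m 3))

    F≡ : F ≡ s ^ 5 * (N * Z)
    F≡ = solve 3 (λ s n z → s :* s :* (s :* (n :* (s :* (s :* z)))) := s :* (s :* (s :* (s :* (s :* con 1)))) :* (n :* z)) refl s N Z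
      where open +-*-Solver

    q≤ : Bound q 2 s
    q≤ = mkBound q≤2s

    6+e≤ : Bound (6 + e) 17 (s * s)
    6+e≤ = plus (const≤ 6 (≤-trans 1≤s grow))
      (plus (mkBound {c = 2} (*-monoʳ-≤ 2 (*-mono-≤ m≤s (≤-trans (≤-reflexive (*-identityʳ m)) m≤s)))) (mkBound {c = 9} (*-monoʳ-≤ 9 (≤-trans m≤s grow))))

    -- Bounding every base `x` by `2 ^ x` is wasteful, but the length of `M` only has to be
    -- polynomial, and this exponent is cubic in `s`.
    exponent : ℕ
    exponent = 5 + (s * 5 + q * (6 + e))

    M≤2^ : M ≤ 2 ^ exponent
    M≤2^ = begin
      M                                              ≤⟨ x≤ M≤ ⟩
      26 * F                                         ≡⟨ cong (26 *_) (trans F≡ (cong (s ^ 5 *_) (trans NZ≡ (sym (^-distribˡ-+-* q 6 e))))) ⟩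
      26 * (s ^ 5 * q ^ (6 + e))                     ≤⟨ *-mono-≤ {26} {32} (m≤m+n 26 6) (*-mono-≤ (^-monoˡ-≤ 5 (<⇒≤ (n<2^n s))) (^-monoˡ-≤ (6 + e) (<⇒≤ (n<2^n q)))) ⟩
      2 ^ 5 * ((2 ^ s) ^ 5 * (2 ^ q) ^ (6 + e))      ≡⟨ cong₂ (λ x y → 2 ^ 5 * (x * y)) (^-*-assoc 2 s 5) (^-*-assoc 2 q (6 + e)) ⟩
      2 ^ 5 * (2 ^ (s * 5) * 2 ^ (q * (6 + e)))      ≡⟨ cong (2 ^ 5 *_) (sym (^-distribˡ-+-* 2 (s * 5) (q * (6 + e)))) ⟩
      2 ^ 5 * 2 ^ (s * 5 + q * (6 + e))              ≡⟨ sym (^-distribˡ-+-* 2 5 (s * 5 + q * (6 + e))) ⟩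
      2 ^ exponent                                   ∎
      where open ≤-Reasoning

    1≤s³ : 1 ≤ s * (s * s)
    1≤s³ = ≤-trans 1≤s (≤-trans grow grow)

    exponent≤ : Bound exponent 44 (s * (s * s))
    exponent≤ = plus (const≤ 5 1≤s³) (plus (scaled 5 (≤-trans (grow {s}) grow)) (times q≤ 6+e≤))

    ℓM≤ : Bound (ℓ M) 45 (s * (s * s))
    ℓM≤ = plus (const≤ 1 1≤s³) (mkBound (≤-trans (≤-trans (⌊log₂⌋-mono-≤ M≤2^) (≤-reflexive (⌊log₂[2^n]⌋≡n exponent))) (x≤ exponent≤)))

    unit≤ : Bound unit 90 (s * (s * s))
    unit≤ = plus ℓM≤ ℓM≤

  -- The exponent 14 is 5 from `F`, 6 from `q ^ 6` and 3 from the unit. The constants come from the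
  -- number of units, the price of a unit, `2 ^ 6` for `q ≤ 2 * s`, and `power≤`.
  time-bound : totalCost * unit ≤ 1031 * 90 * 64 * 3 ^ 11 * s ^ 14 * m ^ (9 * m ^ 2)
  time-bound = begin
    totalCost * unit                                      ≤⟨ *-mono-≤ (x≤ totalCost≤) (x≤ unit≤) ⟩
    (1031 * F) * (90 * (s * (s * s)))                     ≡⟨ cong (λ f → (1031 * f) * (90 * (s * (s * s)))) (trans F≡ (cong (s ^ 5 *_) NZ≡)) ⟩
    (1031 * (s ^ 5 * (q ^ 6 * q ^ e))) * (90 * (s * (s * s)))
      ≤⟨ *-monoˡ-≤ (90 * (s * (s * s))) (*-monoʳ-≤ 1031 (*-monoʳ-≤ (s ^ 5) (*-mono-≤ (^-monoˡ-≤ 6 q≤2s) (power≤ m 1≤m)))) ⟩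
    (1031 * (s ^ 5 * ((2 * s) ^ 6 * (3 ^ 11 * m ^ (9 * m ^ 2))))) * (90 * (s * (s * s)))
      ≡⟨ cong (λ z → (1031 * (s ^ 5 * (z * (3 ^ 11 * m ^ (9 * m ^ 2))))) * (90 * (s * (s * s)))) (sixth-power s) ⟩
    (1031 * (s ^ 5 * ((64 * s ^ 6) * (3 ^ 11 * m ^ (9 * m ^ 2))))) * (90 * (s * (s * s)))
      ≡⟨ rearrange 1031 90 64 (3 ^ 11) (m ^ (9 * m ^ 2)) ⟩
    1031 * 90 * 64 * 3 ^ 11 * s ^ 14 * m ^ (9 * m ^ 2)    ∎
    where
    open ≤-Reasoning
    sixth-power : ∀ x → (2 * x) ^ 6 ≡ 64 * x ^ 6
    sixth-power = solve 1 (λ x → let y = con 2 :* x in y :* (y :* (y :* (y :* (y :* (y :* con 1))))) := con 64 :* (x :* (x :* (x :* (x :* (x :* (x :* con 1))))))) refl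
      where open +-*-Solver
    rearrange : ∀ a u g d r → (a * (s ^ 5 * ((g * s ^ 6) * (d * r)))) * (u * (s * (s * s))) ≡ a * u * g * d * s ^ 14 * r
    rearrange a u g d r = trans
      (solve 8 (λ a u g d r s x y → (a :* (x :* ((g :* y) :* (d :* r)))) :* (u :* (s :* (s :* s))) := a :* u :* g :* d :* (x :* (y :* (s :* (s :* (s :* con 1))))) :* r)
         refl a u g d r s (s ^ 5) (s ^ 6))
      (cong (λ z → a * u * g * d * z * r) (trans (cong (s ^ 5 *_) (sym (^-distribˡ-+-* s 6 3))) (sym (^-distribˡ-+-* s 5 9))))
      where open +-*-Solver

  decision : ∀ σ → reg σ 0 ≢ 0 ⇔ Manipulable I → Reflects (Manipulable I) (accepts σ)
  decision σ p with reg σ 0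
  ... | zero  = ofⁿ (λ man → Equivalence.from p man refl)
  ... | suc _ = ofʸ (Equivalence.to p λ ())

-- Without opponents p wins vacuously, contrary to `p-not-winner`.
nonempty : (I : UBM) → 1 ≤ ∣𝒞∣ I
nonempty record { ∣𝒞∣ = zero  ; p-not-winner = lost } = ⊥-elim (lost λ ())
nonempty record { ∣𝒞∣ = suc _ } = s≤s z≤n

theorem2 : ∃[ P ] ∃[ c ] ∃[ k ]
    ((I : UBM) → ∃[ T ] ∃[ σ ]
    (⟨ P , initial (encode I) ⟩⇓[ T ] σ)
    × Reflects (Manipulable I) (accepts σ)
    × T ≤ c * size I ^ k * ∣𝒞∣ I ^ (9 * ∣𝒞∣ I ^ 2))
theorem2 = program , 1031 * 90 * 64 * 3 ^ 11 , 14 , λ I →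
  let open Instance I (nonempty I)
      open Logic M
      e = program-exec
  in time e , final e , run e , decision (final e) (post e) , ≤-trans (time≤ e) time-bound
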